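{- There exists an absolute constant $C>0$ such that for every integer $g\geq 0$, every integer $p\geq 2$ and every graph $G$ of Euler genus $g$ we have $\chi_p(G)\leq C\,(gp+p^3\log p)$.
   Context: All graphs are finite and simple. For an integer $p\geq 1$, a vertex coloring $\phi$ of a graph $G$ is $p$-centered if for every connected subgraph $H$ of $G$, either $\phi$ uses more than $p$ colors on $V(H)$ or there is a color that appears on exactly one vertex of $H$. The $p$-centered chromatic number $\chi_p(G)$ is the minimum number of colors in a $p$-centered coloring of $G$. -}

module Defs where

open import Data.Nat using (ℕ; zero; suc; _+_; _*_; _^_; _>_)
open import Data.Nat.Logarithm using (⌊log₂_⌋)
open import Data.Bool using (Bool; true; false; _∧_; if_then_else_)
open import Data.Fin using (Fin)
open import Data.Fin.Properties using (_≟_)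
open import Data.Fin.Subset using (Subset; _∈_; ∣_∣; Nonempty)
open import Data.Vec using (Vec; lookup; tabulate)
open import Data.Product using (Σ; ∃; _×_; _,_)
open import Data.Sum using (_⊎_)
open import Relation.Nullary using (¬_)
open import Relation.Nullary.Decidable using (⌊_⌋)
open import Relation.Binary.PropositionalEquality using (_≡_; _≢_)
open import Relation.Binary.Construct.Closure.ReflexiveTransitive using (Star)
open import Function.Bundles using (_⇔_)

record Graph : Set where
  field
    n     : ℕ
    adj   : Fin n → Fin n → Bool
    sym   : ∀ u v → adj u v ≡ adj v u
    irrefl : ∀ v → adj v v ≡ false

open Graph public

InducedStep : (G : Graph) → Subset (n G) → Fin (n G) → Fin (n G) → Set
InducedStep G S u v = u ∈ S × v ∈ S × adj G u v ≡ true

-- G[S] is connected and nonempty (the vertex sets of connected subgraphs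
-- of G are exactly these sets S).
ConnectedSet : (G : Graph) → Subset (n G) → Set
ConnectedSet G S =
  Nonempty S × (∀ u v → u ∈ S → v ∈ S → Star (InducedStep G S) u v)

colorsOn : ∀ {m c} → (Fin m → Fin c) → Subset m → Subset c
colorsOn {m} φ S =
  tabulate λ col → Data.Vec.foldr (λ _ → Bool) (λ b acc → if b then true else acc) false
    (tabulate λ v → lookup S v ∧ ⌊ φ v ≟ col ⌋)

colorClass : ∀ {m c} → (Fin m → Fin c) → Subset m → Fin c → Subset m
colorClass φ S col = tabulate λ v → lookup S v ∧ ⌊ φ v ≟ col ⌋

IsCentered : (G : Graph) (p : ℕ) {c : ℕ} → (Fin (n G) → Fin c) → Set
IsCentered G p {c} φ =
  ∀ (S : Subset (n G)) → ConnectedSet G S →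
    (∣ colorsOn φ S ∣ > p) ⊎ (∃ λ (col : Fin c) → ∣ colorClass φ S col ∣ ≡ 1)

χ≤ : Graph → ℕ → ℕ → Set
χ≤ G p K = Σ (Fin (n G) → Fin K) λ φ → IsCentered G p φ

-- Euler genus via general combinatorial maps (flag systems):
-- flags Fin k, fixed-point-free involutions t0 t1 t2 with t0 t2 = t2 t0
-- and t0 t2 fixed-point-free.  Vertices = orbits of ⟨t1,t2⟩,
-- edges = orbits of ⟨t0,t2⟩, faces = orbits of ⟨t0,t1⟩,
-- components (surfaces) = orbits of ⟨t0,t1,t2⟩.  Every such map is a
-- cellular embedding of a graph in a (possibly disconnected) closed surface.

record FlagMap : Set where
  field
    k  : ℕ
    t0 t1 t2 : Fin k → Fin k
    t0-inv : ∀ x → t0 (t0 x) ≡ x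
    t1-inv : ∀ x → t1 (t1 x) ≡ x
    t2-inv : ∀ x → t2 (t2 x) ≡ x
    t0-fpf : ∀ x → t0 x ≢ x
    t1-fpf : ∀ x → t1 x ≢ x
    t2-fpf : ∀ x → t2 x ≢ x
    t02-comm : ∀ x → t0 (t2 x) ≡ t2 (t0 x)
    t02-fpf : ∀ x → t0 (t2 x) ≢ x

open FlagMap public

Gen2 : ∀ {k} → (Fin k → Fin k) → (Fin k → Fin k) → Fin k → Fin k → Set
Gen2 f g x y = (y ≡ f x) ⊎ (y ≡ g x)

Gen3 : ∀ {k} → (Fin k → Fin k) → (Fin k → Fin k) → (Fin k → Fin k) →
       Fin k → Fin k → Set
Gen3 f g h x y = (y ≡ f x) ⊎ (y ≡ g x) ⊎ (y ≡ h x)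

NumClasses : ∀ {k} → (Fin k → Fin k → Set) → ℕ → Set
NumClasses {k} R m =
  Σ (Fin k → Fin m) λ o →
    (∀ j → ∃ λ x → o x ≡ j) × (∀ x y → (o x ≡ o y) ⇔ R x y)

-- M is (a map of) an embedding of G: vo sends each flag to its vertex of G;
-- vertex orbits correspond injectively to vertices of G, edge orbits
-- correspond bijectively to edges of G.  (Isolated vertices of G are not
-- represented by flags; they contribute nothing to the Euler genus.)
-- Euler genus of the embedding: eg with eg + V + F = 2·c + E.
EmbedsWithEulerGenus : Graph → ℕ → Set
EmbedsWithEulerGenus G eg =
  Σ FlagMap λ M →
  Σ (Fin (k M) → Fin (n G)) λ vo →
    (∀ x y → (vo x ≡ vo y) ⇔ Star (Gen2 (t1 M) (t2 M)) x y)
  × (∀ x → adj G (vo x) (vo (t0 M x)) ≡ true)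
  × (∀ u v → adj G u v ≡ true → ∃ λ x → vo x ≡ u × vo (t0 M x) ≡ v)
  × (∀ x y → Star (Gen2 (t0 M) (t2 M)) x y ⇔
        ((vo x ≡ vo y × vo (t0 M x) ≡ vo (t0 M y))
         ⊎ (vo x ≡ vo (t0 M y) × vo (t0 M x) ≡ vo y)))
  × Σ ℕ λ V → Σ ℕ λ E → Σ ℕ λ F → Σ ℕ λ c →
      NumClasses (Star (Gen2 (t1 M) (t2 M))) V
    × NumClasses (Star (Gen2 (t0 M) (t2 M))) E
    × NumClasses (Star (Gen2 (t0 M) (t1 M))) F
    × NumClasses (Star (Gen3 (t0 M) (t1 M) (t2 M))) c
    × (eg + V + F ≡ 2 * c + E)

EulerGenus : Graph → ℕ → Set
EulerGenus G g =
  EmbedsWithEulerGenus G g × (∀ h → EmbedsWithEulerGenus G h → g Data.Nat.≤ h)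

{-# OPTIONS --safe #-}
module Submission where

-- A spanning forest of G found by breadth-first search, together with a spanning forest of the dual
-- of the barycentric subdivision that avoids it, misses at most g sides by Euler's formula.  The tree
-- paths to the ends of these sides meet every layer once, so they and the roots can be given O(gp)
-- private colours (path, layer modulo p+1).  Cutting a component open along everything but the dual
-- forest leaves a triangulated polygon whose boundary walks around the tree, and every
-- subtree without exceptional vertices occupies an interval of this boundary.
--
-- A region of the polygon bordered by three parts is split at a triangle with all three labels, as
-- in Sperner's lemma: the tree paths from its corners to the border form a new part with at most three
-- vertices in each layer, and each of the at most three remaining regions is bordered by
-- the new part and a different pair of old ones.  Contracting the parts thus gives a stacked triangulation.
--
-- A connected set with at most p colours spans at most p layers in each direction, so layers are
-- coloured modulo p+1: those of G, the distance of a part from the outer border, and the distance inside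
-- the resulting outerplanar layer.  What remains are paths of parts, where even positions follow
-- the ruler sequence, with O(log p) colours for each layer, while odd positions share 2p+1 colours
-- chosen greedily so that a long path has more than p of them and a single odd part differs from all
-- odd parts reachable below it.  The first part of the set, with its path, then contains the unique colour.

open import Defs hiding (sym) renaming (n to order; k to flagCount)
open import Data.Nat using (ℕ; zero; suc; _+_; _*_; _∸_; _^_; _≤_; _<_; _⊔_; z≤n; s≤s; ⌊_/2⌋; _≤?_; _<?_)
import Data.Nat as ℕ
open import Data.Nat.Properties
open import Data.Nat.DivMod using (_%_; _/_; m≡m%n+[m/n]*n; m%n<n)
open import Data.Nat.Logarithm using (⌊log₂_⌋; ⌊log₂⌋-mono-≤; ⌊log₂[2^n]⌋≡n)
open import Data.Nat.Solver using (module +-*-Solver)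
open import Data.Bool using (Bool; true; false; not; if_then_else_; _∧_; _xor_)
import Data.Bool.Properties as BoolP
open import Data.Fin as Fin using (Fin; zero; suc; toℕ; fromℕ<; combine; remQuot; join; splitAt)
import Data.Fin.Properties as FinP
open import Data.Fin.Patterns using (0F; 1F; 2F; 3F; 4F)
open import Data.Fin.Permutation using (permutation)
open import Data.Fin.Subset using (Subset; _∈_; ∣_∣; _-_; _∪_; ⁅_⁆)
import Data.Fin.Subset.Properties as SubP
open import Data.Vec using (Vec; []; _∷_; lookup; tabulate)
import Data.Vec.Properties as VecP
open import Data.List using (List; []; _∷_; length; take; _++_)
import Data.List.Properties as ListP
import Data.List.Membership.Propositional as LM
import Data.List.Membership.Propositional.Properties as LMP
open import Data.List.Membership.DecPropositional ℕ._≟_ using () renaming (_∈?_ to _∈ˡ?_)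
open import Data.List.Relation.Unary.Any as Any using (here; there)
open import Data.Maybe using (Maybe; just; nothing)
open import Data.Maybe.Properties using (just-injective)
open import Data.Product using (Σ; ∃; _×_; _,_; proj₁; proj₂)
open import Data.Sum using (_⊎_; inj₁; inj₂; [_,_]′)
import Data.Sum.Properties as SumP
open import Data.Empty using (⊥; ⊥-elim)
open import Data.Unit using (⊤; tt)
open import Relation.Nullary using (¬_; yes; no; Dec; does; contradiction)
open import Relation.Nullary.Decidable using (¬?; _→-dec_; _×-dec_; _⊎-dec_; toWitness; dec-true; dec-false; decidable-stable; ⌊_⌋; isYes≗does)
open import Relation.Binary.Definitions using (tri<; tri≈; tri>)
open import Relation.Binary.PropositionalEquality
open import Relation.Binary.Construct.Closure.ReflexiveTransitive using (Star; _◅◅_) renaming (ε to []*; _◅_ to _∷*_)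
open import Function.Bundles using (_⇔_; module Equivalence)
open import Algebra.Bundles using (CommutativeRing)
import Algebra.Properties.CommutativeMonoid.Sum as Sum

-- Parity, the ruler sequence and counting colours

-- A colour remembers the layer of G, `D` and `E`, each modulo p+1, and for even positions a ruler
-- value among O(log p); this is the origin of p^3 log p. The obstacle is the arms. A ruler sequence
-- with O(log p) values separates only stretches of O(p) parts, so on a longer stretch it alone may
-- show at most p colours, none of them unique. The odd positions are there to make such stretches
-- impossible: 2p+2 consecutive parts already contain p+1 odd ones, whose greedy colours differ.
-- This creates one new case, a stretch that is a single odd part and has no ruler value; a greedy
-- colour must therefore also avoid those of the odd parts through which a deeper region was
-- entered. Each of the two demands excludes at most p colours. Storing `E` as well for odd parts
-- would cost a further factor p. On the topological side parity replaces any separation theorem: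
-- that the tree does not disconnect the dual is proved by counting, modulo 2, the sides that cross
-- a cut.

odd : ℕ → Bool
odd zero    = false
odd (suc n) = not (odd n)

odd-suc-suc : ∀ n → odd (suc (suc n)) ≡ odd n
odd-suc-suc n with odd n
... | true  = refl
... | false = refl

odd-double-+ : ∀ t m → odd (t + t + m) ≡ odd m
odd-double-+ zero    m = refl
odd-double-+ (suc t) m rewrite +-suc t t = trans (odd-suc-suc (t + t + m)) (odd-double-+ t m)

odd-double : ∀ m → odd (m + m) ≡ false
odd-double m = trans (cong odd (sym (+-identityʳ (m + m)))) (odd-double-+ m 0)

data Parity (n : ℕ) : Set where
  even : ∀ m → n ≡ m + m → odd n ≡ false → Parity n
  odd′ : ∀ m → n ≡ suc (m + m) → odd n ≡ true → Parity n

parity : ∀ n → Parity n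
parity zero = even 0 refl refl
parity (suc n) with parity n
... | even m e o = odd′ m (cong suc e) (cong not o)
... | odd′ m e o = even (suc m) (trans (cong suc e) (cong suc (sym (+-suc m m)))) (cong not o)

double-cancel-< : ∀ {a b} → a + a < b + b → a < b
double-cancel-< {a} {b} lt with b ≤? a
... | yes b≤a = contradiction lt (≤⇒≯ (+-mono-≤ b≤a b≤a))
... | no  b≰a = ≰⇒> b≰a

double-cancel-≤ : ∀ {a b} → a + a ≤ suc (b + b) → a ≤ b
double-cancel-≤ {a} {b} le = ℕ.s≤s⁻¹ (double-cancel-< {a} {suc b}
  (≤-trans (s≤s le) (≤-reflexive (cong suc (sym (+-suc b b))))))

-- For positive n this is the exponent of 2 in n, truncated at c.
ruler : ℕ → ℕ → ℕ
ruler zero    _ = 0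
ruler (suc c) n = if odd n then 0 else suc (ruler c ⌊ n /2⌋)

ruler≤ : ∀ c n → ruler c n ≤ c
ruler≤ zero    n = z≤n
ruler≤ (suc c) n with odd n
... | true  = z≤n
... | false = s≤s (ruler≤ c ⌊ n /2⌋)

ruler-odd : ∀ c n → odd n ≡ true → ruler (suc c) n ≡ 0
ruler-odd c n o rewrite o = refl

ruler-even : ∀ c m → ruler (suc c) (m + m) ≡ suc (ruler c m)
ruler-even c m rewrite odd-double m | sym (n≡⌊n+n/2⌋ m) = refl

ruler-evenSuc : ∀ c n → odd n ≡ false → ∃ λ r → ruler (suc c) n ≡ suc r
ruler-evenSuc c n o rewrite o = _ , refl

-- A window of at least two numbers contains an even one, and its even numbers are the doubles of a
-- window from `h₀` to `h₁` of at most half the length; the point found there is doubled. Hence an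
-- odd `y` arises only from a one-point window, the case left to the greedy colours.
ruler-unique : ∀ c x l → l < 2 ^ c → ∃ λ y → x ≤ y × y ≤ x + l × (odd y ≡ true → l ≡ 0) ×
  (∀ z → x ≤ z → z ≤ x + l → ruler c z ≡ ruler c y → z ≡ y)
ruler-unique zero x zero lt = x , ≤-refl , m≤m+n x 0 , (λ _ → refl) ,
  λ z a b _ → ≤-antisym (subst (z ≤_) (+-identityʳ x) b) a
ruler-unique zero x (suc l) (s≤s ())
ruler-unique (suc c) x zero lt = x , ≤-refl , m≤m+n x 0 , (λ _ → refl) ,
  λ z a b _ → ≤-antisym (subst (z ≤_) (+-identityʳ x) b) a
ruler-unique (suc c) x (suc l) lt = go (halfUp x) (halfDown (x + suc l))
  where
  halfUp : ∀ n → ∃ λ h → n ≤ h + h × h + h ≤ suc n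
  halfUp n with parity n
  ... | even m e _ = m , ≤-reflexive e , ≤-trans (≤-reflexive (sym e)) (n≤1+n n)
  ... | odd′ m e _ = suc m , ≤-trans (≤-reflexive e) (s≤s (≤-trans (n≤1+n _) (≤-reflexive (sym (+-suc m m)))))
                   , ≤-reflexive (cong suc (trans (+-suc m m) (sym e)))
  halfDown : ∀ n → ∃ λ h → h + h ≤ n × n ≤ suc (h + h)
  halfDown n with parity n
  ... | even m e _ = m , ≤-reflexive (sym e) , ≤-trans (≤-reflexive e) (n≤1+n _)
  ... | odd′ m e _ = m , ≤-trans (n≤1+n _) (≤-reflexive (sym e)) , ≤-reflexive e
  go : (∃ λ h → x ≤ h + h × h + h ≤ suc x) → (∃ λ h → h + h ≤ x + suc l × x + suc l ≤ suc (h + h)) → _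
  go (h₀ , x≤ , ≤x) (h₁ , ≤y , y≤) = pick (ruler-unique c h₀ (h₁ ∸ h₀) bound)
    where
    h₀≤h₁ : h₀ ≤ h₁
    h₀≤h₁ = double-cancel-≤ (≤-trans ≤x (≤-trans (≤-trans (s≤s (m≤m+n x l)) (≤-reflexive (sym (+-suc x l)))) y≤))
    top : h₀ + (h₁ ∸ h₀) ≡ h₁
    top = m+[n∸m]≡n h₀≤h₁
    d = h₁ ∸ h₀
    bound : d < 2 ^ c
    bound = double-cancel-< (≤-<-trans dd≤ (subst (suc l <_) (cong (2 ^ c +_) (+-identityʳ (2 ^ c))) lt))
      where
      dd≤ : d + d ≤ suc l
      dd≤ = +-cancelˡ-≤ (h₀ + h₀) _ _ (≤-trans (≤-reflexive eq) (≤-trans ≤y (+-monoˡ-≤ (suc l) x≤)))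
        where
        eq : (h₀ + h₀) + (d + d) ≡ h₁ + h₁
        eq = trans (trans (+-assoc h₀ h₀ (d + d)) (trans (cong (h₀ +_) (trans (sym (+-assoc h₀ d d))
               (trans (cong (_+ d) (+-comm h₀ d)) (+-assoc d h₀ d)))) (sym (+-assoc h₀ d (h₀ + d)))))
               (cong₂ _+_ top top)
    pick : _ → _
    pick (y , a , b , _ , u) = y + y , ≤-trans x≤ (+-mono-≤ a a) , ≤-trans (+-mono-≤ b′ b′) ≤y ,
        (λ o → contradiction (trans (sym o) (odd-double y)) λ ()) , uniq
      where
      b′ : y ≤ h₁
      b′ = subst (y ≤_) top b
      uniq : ∀ z → x ≤ z → z ≤ x + suc l → ruler (suc c) z ≡ ruler (suc c) (y + y) → z ≡ y + y
      uniq z xz zx e with parity z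
      ... | odd′ m _ o = contradiction (trans (sym (ruler-odd c z o)) (trans e (ruler-even c y))) λ ()
      ... | even m refl _ = cong₂ _+_ m≡y m≡y
        where
        m≡y = u m (double-cancel-≤ (≤-trans ≤x (s≤s xz)))
                  (subst (m ≤_) (sym top) (double-cancel-≤ (≤-trans zx y≤)))
                  (suc-injective (trans (sym (ruler-even c m)) (trans e (ruler-even c y))))

abstract
  -- If all of 0, ..., `length xs` occurred in the list, their positions would contradict the
  -- pigeonhole principle.
  fresh : (xs : List ℕ) → ∃ λ n → n ≤ length xs × ¬ (n LM.∈ xs)
  fresh xs with FinP.any? {n = suc (length xs)} (λ i → ¬? (toℕ i ∈ˡ? xs))
  ... | yes (i , i∉) = toℕ i , ℕ.s≤s⁻¹ (FinP.toℕ<n i) , i∉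
  ... | no  none     = ⊥-elim (clash (FinP.pigeonhole ≤-refl idx))
    where
    all∈ : ∀ (i : Fin (suc (length xs))) → toℕ i LM.∈ xs
    all∈ i = decidable-stable (toℕ i ∈ˡ? xs) (λ i∉ → none (i , i∉))
    idx : Fin (suc (length xs)) → Fin (length xs)
    idx i = Any.index (all∈ i)
    at : ∀ {y : ℕ} {ys : List ℕ} (m : y LM.∈ ys) → y ≡ Data.List.lookup ys (Any.index m)
    at (here e)  = e
    at (there m) = at m
    clash : ¬ (∃ λ (i : Fin (suc (length xs))) → ∃ λ j → i Fin.< j × idx i ≡ idx j)
    clash (i , j , i<j , e) = <⇒≢ i<j (trans (at (all∈ i)) (trans (cong (Data.List.lookup xs) e) (sym (at (all∈ j)))))

-- Membership together with the position: greedy colours avoid only the first p entries of a list,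
-- so the distance has to be tracked.
data At {A : Set} : List A → ℕ → A → Set where
  hd : ∀ {x xs} → At (x ∷ xs) 0 x
  tl : ∀ {x y xs n} → At xs n x → At (y ∷ xs) (suc n) x

At-take : ∀ {A : Set} {xs : List A} {n x} p → At xs n x → n < p → x LM.∈ take p xs
At-take (suc p) hd     lt       = here refl
At-take (suc p) (tl a) (s≤s lt) = there (At-take p a lt)

length-take≤ : ∀ {A : Set} p (xs : List A) → length (take p xs) ≤ p
length-take≤ zero    xs       = z≤n
length-take≤ (suc p) []       = z≤n
length-take≤ (suc p) (x ∷ xs) = s≤s (length-take≤ p xs)

inj⇒≤card : ∀ {m N} (T : Subset N) (f : Fin m → Fin N) → (∀ i → f i ∈ T) →
  (∀ i j → f i ≡ f j → i ≡ j) → m ≤ ∣ T ∣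
inj⇒≤card {zero}  T f f∈ inj = z≤n
inj⇒≤card {suc m} T f f∈ inj = ≤-<-trans
  (inj⇒≤card (T - f zero) (λ i → f (suc i))
    (λ i → SubP.x∈p∧x≢y⇒x∈p-y (f∈ (suc i)) (λ e → contradiction (inj _ _ e) λ ()))
    (λ i j e → FinP.suc-injective (inj _ _ e)))
  (SubP.x∈p⇒∣p-x∣<∣p∣ (f∈ zero))

module _ {m c : ℕ} (φ : Fin m → Fin c) (S : Subset m) where

  private
    hasColor : Fin c → Fin m → Bool
    hasColor col v = lookup S v ∧ ⌊ φ v FinP.≟ col ⌋

    hasColor-intro : ∀ {v} → v ∈ S → hasColor (φ v) v ≡ true
    hasColor-intro {v} v∈ rewrite VecP.[]=⇒lookup v∈ =
      trans (isYes≗does (φ v FinP.≟ φ v)) (dec-true (φ v FinP.≟ φ v) refl)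

    hasColor-elim : ∀ {v col} → hasColor col v ≡ true → v ∈ S × φ v ≡ col
    hasColor-elim {v} {col} e with lookup S v in eq | φ v FinP.≟ col
    ... | true | yes q = VecP.lookup⇒[]= v S eq , q

    or-tabulate : ∀ {k} (g : Fin k → Bool) v → g v ≡ true →
      Data.Vec.foldr (λ _ → Bool) (λ b acc → if b then true else acc) false (tabulate g) ≡ true
    or-tabulate g zero    e rewrite e = refl
    or-tabulate g (suc v) e with g zero
    ... | true  = refl
    ... | false = or-tabulate (λ i → g (suc i)) v e

  color∈colorsOn : ∀ {v} → v ∈ S → φ v ∈ colorsOn φ S
  color∈colorsOn {v} v∈ = VecP.lookup⇒[]= (φ v) _
    (trans (VecP.lookup∘tabulate _ (φ v)) (or-tabulate (hasColor (φ v)) v (hasColor-intro v∈)))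

  uniqueColor : ∀ {v} → v ∈ S → (∀ u → u ∈ S → φ u ≡ φ v → u ≡ v) → ∃ λ col → ∣ colorClass φ S col ∣ ≡ 1
  uniqueColor {v} v∈ uniq = φ v , trans (cong ∣_∣ (SubP.⊆-antisym to from)) (SubP.∣⁅x⁆∣≡1 v)
    where
    to : ∀ {u} → u ∈ colorClass φ S (φ v) → u ∈ ⁅ v ⁆
    to {u} u∈ with hasColor-elim (trans (sym (VecP.lookup∘tabulate (hasColor (φ v)) u)) (VecP.[]=⇒lookup u∈))
    ... | u∈S , e rewrite uniq u u∈S e = SubP.x∈⁅x⁆ v
    from : ∀ {u} → u ∈ ⁅ v ⁆ → u ∈ colorClass φ S (φ v)
    from {u} u∈ with SubP.x∈⁅y⁆⇒x≡y v u∈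
    ... | refl = VecP.lookup⇒[]= v _ (trans (VecP.lookup∘tabulate (hasColor (φ v)) v) (hasColor-intro v∈))

  manyColors : ∀ p (f : ℕ → Fin m) → (∀ i → i ≤ p → f i ∈ S) →
    (∀ i j → i < j → j ≤ p → φ (f i) ≢ φ (f j)) → p < ∣ colorsOn φ S ∣
  manyColors p f f∈ dist = inj⇒≤card {suc p} (colorsOn φ S) (λ i → φ (f (toℕ i)))
    (λ i → color∈colorsOn (f∈ (toℕ i) (ℕ.s≤s⁻¹ (FinP.toℕ<n i)))) inj
    where
    inj : ∀ (i j : Fin (suc p)) → φ (f (toℕ i)) ≡ φ (f (toℕ j)) → i ≡ j
    inj i j e with FinP.<-cmp i j
    ... | tri≈ _ q _ = q
    ... | tri< lt _ _ = contradiction e (dist _ _ lt (ℕ.s≤s⁻¹ (FinP.toℕ<n j)))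
    ... | tri> _ _ lt = contradiction (sym e) (dist _ _ lt (ℕ.s≤s⁻¹ (FinP.toℕ<n i)))

-- Nested regions and their layers

-- Letters are appended on the right, so the latest subdivision is the outermost constructor;
-- `w ⊑ u` says that the region of `u` lies inside that of `w`.
data Word : Set where
  ε   : Word
  _∙_ : Word → Fin 3 → Word

data _⊑_ (w : Word) : Word → Set where
  here  : w ⊑ w
  there : ∀ {u i} → w ⊑ u → w ⊑ (u ∙ i)

_≟ʷ_ : (u w : Word) → Dec (u ≡ w)
ε ≟ʷ ε = yes refl
ε ≟ʷ (w ∙ i) = no λ ()
(u ∙ i) ≟ʷ ε = no λ ()
(u ∙ i) ≟ʷ (w ∙ j) with u ≟ʷ w | i Fin.≟ j
... | yes refl | yes refl = yes refl
... | no ne    | _        = no λ { refl → ne refl }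
... | yes _    | no ne    = no λ { refl → ne refl }

len : Word → ℕ
len ε       = 0
len (w ∙ _) = suc (len w)

⊑-len : ∀ {w u} → w ⊑ u → len w ≤ len u
⊑-len here      = ≤-refl
⊑-len (there p) = m≤n⇒m≤1+n (⊑-len p)

ε⊑ : ∀ w → ε ⊑ w
ε⊑ ε       = here
ε⊑ (w ∙ i) = there (ε⊑ w)

⊑-trans : ∀ {u v w} → u ⊑ v → v ⊑ w → u ⊑ w
⊑-trans p here      = p
⊑-trans p (there q) = there (⊑-trans p q)

-- A word names a region of a nested subdivision together with the part chosen inside
-- it; ∂ lists the three parts around the region.  Child i of a region replaces
-- boundary part i by the new part; `nothing` stands for the outer boundary.
∂ : Word → Fin 3 → Maybe Word
∂ ε       _ = nothing
∂ (w ∙ i) k with k Fin.≟ i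
... | yes _ = just w
... | no  _ = ∂ w k

∂-view : ∀ w i k {x} → ∂ (w ∙ i) k ≡ just x → (k ≡ i × x ≡ w) ⊎ (k ≢ i × ∂ w k ≡ just x)
∂-view w i k e with k Fin.≟ i
∂-view w i k refl | yes q = inj₁ (q , refl)
∂-view w i k e    | no  q = inj₂ (q , e)

∂-new : ∀ w i → ∂ (w ∙ i) i ≡ just w
∂-new w i with i Fin.≟ i
... | yes _ = refl
... | no ne = contradiction refl ne

∂-old : ∀ w i k → k ≢ i → ∂ (w ∙ i) k ≡ ∂ w k
∂-old w i k ne with k Fin.≟ i
... | yes e = contradiction e ne
... | no  _ = refl

∂-len : ∀ w k {x} → ∂ w k ≡ just x → len x < len w
∂-len (w ∙ i) k e with ∂-view w i k e
... | inj₁ (_ , refl) = ≤-refl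
... | inj₂ (_ , e′)   = m≤n⇒m≤1+n (∂-len w k e′)

-- The remaining index when the arguments differ; the values on the diagonal are dummies.
third : Fin 3 → Fin 3 → Fin 3
third zero          zero             = zero
third zero          1F       = 2F
third zero          2F = 1F
third 1F    zero             = 2F
third 1F    1F       = zero
third 1F    2F = zero
third 2F zero          = 1F
third 2F 1F    = zero
third 2F 2F = zero

third-other : ∀ c i k → i ≢ c → k ≢ third c i → k ≢ i → k ≡ c
third-other = toWitness {a? = FinP.all? λ c → FinP.all? λ i → FinP.all? λ k →
  ¬? (i Fin.≟ c) →-dec (¬? (k Fin.≟ third c i) →-dec (¬? (k Fin.≟ i) →-dec (k Fin.≟ c)))} tt

third-≢ : ∀ c i → i ≢ c → third c i ≢ c × third c i ≢ i
third-≢ c i ne = l c i ne , r c i ne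
  where
  l : ∀ c i → i ≢ c → third c i ≢ c
  l = toWitness {a? = FinP.all? λ c → FinP.all? λ i → ¬? (i Fin.≟ c) →-dec ¬? (third c i Fin.≟ c)} tt
  r : ∀ c i → i ≢ c → third c i ≢ i
  r = toWitness {a? = FinP.all? λ c → FinP.all? λ i → ¬? (i Fin.≟ c) →-dec ¬? (third c i Fin.≟ i)} tt

mod-distinct : ∀ p a b → a < b → b ≤ a + p → a % suc p ≢ b % suc p
mod-distinct p a b a<b b≤ e = contradiction (<⇒≱ lt2) (λ f → f gap)
  where
  qa = a / suc p
  qb = b / suc p
  lt1 : qa * suc p < qb * suc p
  lt1 = +-cancelˡ-< (b % suc p) _ _ (subst₂ _<_ (trans (m≡m%n+[m/n]*n a (suc p)) (cong (_+ qa * suc p) e)) (m≡m%n+[m/n]*n b (suc p)) a<b)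
  lt2 : b < a + suc p
  lt2 = ≤-trans (s≤s b≤) (≤-reflexive (sym (+-suc a p)))
  gap : a + suc p ≤ b
  gap = subst₂ _≤_
    (trans (sym (+-assoc (b % suc p) (qa * suc p) (suc p))) (cong (_+ suc p) (sym (trans (m≡m%n+[m/n]*n a (suc p)) (cong (_+ qa * suc p) e)))))
    (sym (m≡m%n+[m/n]*n b (suc p)))
    (+-monoʳ-≤ (b % suc p) (≤-trans (≤-reflexive (+-comm (qa * suc p) (suc p))) (*-monoˡ-≤ (suc p) (*-cancelʳ-< (suc p) qa qb lt1))))

module Layers (p : ℕ) where

  -- dN, the nesting layer, is the distance of the new part from the outer boundary.
  -- A region is of type T3 if its three boundary parts lie in the same layer m, of
  -- type T2 if two lie in layer m and part c in layer m+1, and of type T1 if part a lies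
  -- in layer m and the other two in layer m+1.  Inside a layer, eN is the distance from
  -- the first part of the layer; T1= and T1< tell whether the two upper parts have
  -- equal distance or part c is further out by one.  The parts at fixed
  -- (dN , eN) reached by repeatedly replacing part c form a path, an arm, with positions qN.
  data State : Set where
    T3  : (m : ℕ) → State
    T2  : (c : Fin 3) (m e : ℕ) (anc : List ℕ) → State
    T1= : (a : Fin 3) (m j g : ℕ) (anc : List ℕ) → State
    T1< : (a c : Fin 3) (m j q γ : ℕ) (anc arm : List ℕ) → State

  dN eN qN : State → ℕ
  dN (T3 m)                 = suc m
  dN (T2 c m e anc)         = suc m
  dN (T1= a m j g anc)      = suc m
  dN (T1< a c m j q γ anc arm) = suc m
  eN (T3 m)                 = 0
  eN (T2 c m e anc)         = suc e
  eN (T1= a m j g anc)      = suc j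
  eN (T1< a c m j q γ anc arm) = suc j
  qN (T3 m)                 = 0
  qN (T2 c m e anc)         = 0
  qN (T1= a m j g anc)      = 0
  qN (T1< a c m j q γ anc arm) = suc q

  -- One entry for each smaller value of eN in the layer, the nearest first: the greedy
  -- colour of the odd-position part through which the region was entered (0 if there is none).
  ancs : State → List ℕ
  ancs (T3 m)                 = []
  ancs (T2 c m e anc)         = anc
  ancs (T1= a m j g anc)      = g ∷ anc
  ancs (T1< a c m j q γ anc arm) = anc

  arms : State → List ℕ
  arms (T1< a c m j q γ anc arm) = arm
  arms _ = []

  -- At most 2p colours are forbidden, whence the 2p+1 greedy colours. Windows of length p suffice,
  -- since p+1 parts with pairwise different colours are already too many.
  avoid : State → List ℕ
  avoid s = take p (ancs s) ++ take p (arms s)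

  γN : State → ℕ
  γN s = proj₁ (fresh (avoid s))

  γN≤ : ∀ s → γN s ≤ p + p
  γN≤ s = ≤-trans (proj₁ (proj₂ (fresh (avoid s))))
    (≤-trans (≤-reflexive (ListP.length-++ (take p (ancs s)))) (+-mono-≤ (length-take≤ p (ancs s)) (length-take≤ p (arms s))))

  γN∉ancs : ∀ s → ¬ (γN s LM.∈ take p (ancs s))
  γN∉ancs s h = proj₂ (proj₂ (fresh (avoid s))) (LMP.∈-++⁺ˡ h)

  γN∉arms : ∀ s → ¬ (γN s LM.∈ take p (arms s))
  γN∉arms s h = proj₂ (proj₂ (fresh (avoid s))) (LMP.∈-++⁺ʳ (take p (ancs s)) h)

  -- The new part touches the whole border, so its `D`, and its `E` if the border already has parts
  -- of its layer, is one more than the least value there. In `T1<`, replacing `a` opens the next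
  -- layer, replacing the nearer upper part advances `E`, and replacing `c` does neither and extends
  -- the arm.
  step : State → Fin 3 → State
  step (T3 m) i = T2 i m 0 (0 ∷ [])
  step (T2 c m e anc) i with i Fin.≟ c
  ... | yes _ = T2 c m (suc e) (0 ∷ anc)
  ... | no  _ = T1< (third c i) i m e 0 0 anc []
  step (T1= a m j g anc) i with i Fin.≟ a
  ... | yes _ = T3 (suc m)
  ... | no  _ = T1< a i m j 0 0 (g ∷ anc) []
  step s@(T1< a c m j q γ anc arm) i with i Fin.≟ a
  ... | yes _ = T3 (suc m)
  ... | no  _ with i Fin.≟ c
  ...   | yes _ = T1< a c m j (suc q) (γN s) anc (if odd (suc q) then γN s ∷ arm else arm)
  -- Part `c` and the new part hold the consecutive arm positions q and q+1, so exactly one of the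
  -- two upper parts is odd and one entry serves for both.
  ...   | no  _ = T1= a m (suc j) (if odd q then γ else γN s) anc

  st : Word → State
  st ε       = T3 0
  st (w ∙ i) = step (st w) i

  D E Q Γ : Word → ℕ
  D u = dN (st u)
  E u = eN (st u)
  Q u = qN (st u)
  Γ u = γN (st u)

  OddOK : Word → ℕ → List ℕ → Set
  OddOK x g anc = odd (Q x) ≡ true → Γ x ≡ g × ¬ (Γ x LM.∈ take p anc)

  -- What the state of a region records about its boundary parts.
  Inv : Word → State → Set
  Inv u (T3 m) = ∀ i x → ∂ u i ≡ just x → D x ≡ m
  Inv u (T2 c m e anc) =
    (∀ i x → i ≢ c → ∂ u i ≡ just x → D x ≡ m) ×
    (∀ x → ∂ u c ≡ just x → D x ≡ suc m × E x ≡ e × Q x ≡ 0)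
  Inv u (T1= a m j g anc) =
    (∀ x → ∂ u a ≡ just x → D x ≡ m) ×
    (∀ i x → i ≢ a → ∂ u i ≡ just x → D x ≡ suc m × E x ≡ j × OddOK x g anc)
  Inv u (T1< a c m j q γ anc arm) =
    (∀ x → ∂ u a ≡ just x → D x ≡ m) ×
    (∀ x → ∂ u c ≡ just x → D x ≡ suc m × E x ≡ suc j × Q x ≡ q × (odd q ≡ true → Γ x ≡ γ)) ×
    (∀ i x → i ≢ a → i ≢ c → ∂ u i ≡ just x → D x ≡ suc m × E x ≡ j) ×
    (odd q ≡ true → ¬ (γ LM.∈ take p anc)) × a ≢ c

  inv-step : ∀ u i s → st u ≡ s → Inv u s → Inv (u ∙ i) (step s i)
  inv-step u i (T3 m) eq inv = f , g
    where
    f : ∀ k x → k ≢ i → ∂ (u ∙ i) k ≡ just x → D x ≡ m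
    f k x ne e with ∂-view u i k e
    ... | inj₁ (q , _)  = contradiction q ne
    ... | inj₂ (_ , e′) = inv k x e′
    g : ∀ x → ∂ (u ∙ i) i ≡ just x → D x ≡ suc m × E x ≡ 0 × Q x ≡ 0
    g x e with just-injective (trans (sym (∂-new u i)) e)
    ... | refl = cong dN eq , cong eN eq , cong qN eq
  inv-step u i (T2 c m e anc) eq (lo , hi) with i Fin.≟ c
  ... | yes refl = f , g
    where
    f : ∀ k x → k ≢ i → ∂ (u ∙ i) k ≡ just x → D x ≡ m
    f k x ne b with ∂-view u i k b
    ... | inj₁ (q , _)  = contradiction q ne
    ... | inj₂ (_ , b′) = lo k x ne b′
    g : ∀ x → ∂ (u ∙ i) i ≡ just x → D x ≡ suc m × E x ≡ suc e × Q x ≡ 0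
    g x b with just-injective (trans (sym (∂-new u i)) b)
    ... | refl = cong dN eq , cong eN eq , cong qN eq
  ... | no i≢c = f , g , h , (λ ()) , proj₂ (third-≢ c i i≢c)
    where
    f : ∀ x → ∂ (u ∙ i) (third c i) ≡ just x → D x ≡ m
    f x b with ∂-view u i (third c i) b
    ... | inj₁ (q , _)  = contradiction q (proj₂ (third-≢ c i i≢c))
    ... | inj₂ (_ , b′) = lo (third c i) x (proj₁ (third-≢ c i i≢c)) b′
    g : ∀ x → ∂ (u ∙ i) i ≡ just x → D x ≡ suc m × E x ≡ suc e × Q x ≡ 0 × (false ≡ true → Γ x ≡ 0)
    g x b with just-injective (trans (sym (∂-new u i)) b)
    ... | refl = cong dN eq , cong eN eq , cong qN eq , λ ()
    h : ∀ k x → k ≢ third c i → k ≢ i → ∂ (u ∙ i) k ≡ just x → D x ≡ suc m × E x ≡ e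
    h k x n₁ n₂ b with ∂-view u i k b
    ... | inj₁ (q , _)  = contradiction q n₂
    ... | inj₂ (_ , b′) with third-other c i k i≢c n₁ n₂
    ...   | refl = proj₁ (hi x b′) , proj₁ (proj₂ (hi x b′))
  inv-step u i (T1= a m j g anc) eq (lo , hi) with i Fin.≟ a
  ... | yes refl = f
    where
    f : ∀ k x → ∂ (u ∙ i) k ≡ just x → D x ≡ suc m
    f k x b with ∂-view u i k b
    ... | inj₁ (_ , refl) = cong dN eq
    ... | inj₂ (ne , b′)  = proj₁ (hi k x ne b′)
  ... | no i≢a = f , h , l , (λ ()) , (λ q → i≢a (sym q))
    where
    f : ∀ x → ∂ (u ∙ i) a ≡ just x → D x ≡ m
    f x b with ∂-view u i a b
    ... | inj₁ (q , _)  = contradiction (sym q) i≢a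
    ... | inj₂ (_ , b′) = lo x b′
    h : ∀ x → ∂ (u ∙ i) i ≡ just x → D x ≡ suc m × E x ≡ suc j × Q x ≡ 0 × (false ≡ true → Γ x ≡ 0)
    h x b with just-injective (trans (sym (∂-new u i)) b)
    ... | refl = cong dN eq , cong eN eq , cong qN eq , λ ()
    l : ∀ k x → k ≢ a → k ≢ i → ∂ (u ∙ i) k ≡ just x → D x ≡ suc m × E x ≡ j
    l k x n₁ n₂ b with ∂-view u i k b
    ... | inj₁ (q , _)  = contradiction q n₂
    ... | inj₂ (_ , b′) = proj₁ (hi k x n₁ b′) , proj₁ (proj₂ (hi k x n₁ b′))
  inv-step u i s@(T1< a c m j q γ anc arm) eq (lo , hi , mid , γ∉ , a≢c) with i Fin.≟ a
  ... | yes refl = f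
    where
    f : ∀ k x → ∂ (u ∙ i) k ≡ just x → D x ≡ suc m
    f k x b with ∂-view u i k b
    ... | inj₁ (_ , refl) = cong dN eq
    ... | inj₂ (ne , b′) with k Fin.≟ c
    ...   | yes refl = proj₁ (hi x b′)
    ...   | no k≢c   = proj₁ (mid k x ne k≢c b′)
  ... | no i≢a with i Fin.≟ c
  ...   | yes refl = f , h , l , (λ _ → γN∉ancs s) , a≢c
    where
    f : ∀ x → ∂ (u ∙ i) a ≡ just x → D x ≡ m
    f x b with ∂-view u i a b
    ... | inj₁ (e , _)  = contradiction (sym e) i≢a
    ... | inj₂ (_ , b′) = lo x b′
    h : ∀ x → ∂ (u ∙ i) i ≡ just x → D x ≡ suc m × E x ≡ suc j × Q x ≡ suc q × (odd (suc q) ≡ true → Γ x ≡ γN s)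
    h x b with just-injective (trans (sym (∂-new u i)) b)
    ... | refl = cong dN eq , cong eN eq , cong qN eq , λ _ → cong γN eq
    l : ∀ k x → k ≢ a → k ≢ i → ∂ (u ∙ i) k ≡ just x → D x ≡ suc m × E x ≡ j
    l k x n₁ n₂ b with ∂-view u i k b
    ... | inj₁ (e , _)  = contradiction e n₂
    ... | inj₂ (_ , b′) = mid k x n₁ n₂ b′
  ...   | no i≢c = f , h
    where
    f : ∀ x → ∂ (u ∙ i) a ≡ just x → D x ≡ m
    f x b with ∂-view u i a b
    ... | inj₁ (e , _)  = contradiction (sym e) i≢a
    ... | inj₂ (_ , b′) = lo x b′
    h : ∀ k x → k ≢ a → ∂ (u ∙ i) k ≡ just x →
        D x ≡ suc m × E x ≡ suc j × OddOK x (if odd q then γ else γN s) anc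
    h k x n₁ b with ∂-view u i k b
    h k x n₁ b | inj₁ (_ , refl) = cong dN eq , cong eN eq , ok
      where
      ok : OddOK u (if odd q then γ else γN s) anc
      ok o with trans (sym (cong (λ z → odd (qN z)) eq)) o
      ... | o′ with odd q
      ...   | false = cong γN eq , subst (λ z → ¬ (z LM.∈ take p anc)) (sym (cong γN eq)) (γN∉ancs s)
    h k x n₁ b | inj₂ (k≢i , b′) with k Fin.≟ c
    ... | no k≢c = contradiction (third-other i c k (λ e → i≢c (sym e)) (λ e → n₁ (trans e (sym (third-other′ e)))) k≢c) k≢i
      where
      third-other′ : k ≡ third i c → a ≡ third i c
      third-other′ e with a Fin.≟ third i c
      ... | yes r = r
      ... | no ne = contradiction (third-other i c a (λ e₁ → i≢c (sym e₁)) ne a≢c) (λ e₁ → i≢a (sym e₁))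
    ... | yes refl with hi x b′
    ...   | d , e , r , γx = d , e , ok
      where
      ok : OddOK x (if odd q then γ else γN s) anc
      ok o with subst (λ z → odd z ≡ true) r o
      ... | o′ rewrite o′ = γx refl , subst (λ z → ¬ (z LM.∈ take p anc)) (sym (γx refl)) (γ∉ refl)

  inv : ∀ u → Inv u (st u)
  inv ε       i x ()
  inv (u ∙ i) = inv-step u i (st u) refl (inv u)

  -- The interface to the uniqueness argument. When `D` grows, all border parts of the new region
  -- have the old `D`; when `E` grows, those of the current layer have the old `E`. A connected set
  -- that enters the region contains a border part, so it skips no value. The case `same` is a move
  -- along an arm.
  data Trans (u : Word) (i : Fin 3) : Set where
    newD : D (u ∙ i) ≡ suc (D u) → (∀ k x → ∂ (u ∙ i) k ≡ just x → D x ≡ D u) → Trans u i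
    newE : ∀ g → D (u ∙ i) ≡ D u → E (u ∙ i) ≡ suc (E u) → ancs (st (u ∙ i)) ≡ g ∷ ancs (st u) →
      (∀ k x → ∂ (u ∙ i) k ≡ just x →
        D x < D u ⊎ (D x ≡ D u × E x ≡ E u × OddOK x g (ancs (st u)))) → Trans u i
    same : D (u ∙ i) ≡ D u → E (u ∙ i) ≡ E u → ancs (st (u ∙ i)) ≡ ancs (st u) → 0 < Q (u ∙ i) → Trans u i

  private
    zeroOK : ∀ {x g anc} → Q x ≡ 0 → OddOK x g anc
    zeroOK e o = contradiction (trans (sym (cong odd e)) o) λ ()

    trans-step : ∀ u i s → st u ≡ s → Inv (u ∙ i) (step s i) → Trans u i
    trans-step u i (T3 m) eq (lo , hi) = newE 0 (trans (cong dN eq′) (sym (cong dN eq)))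
        (trans (cong eN eq′) (cong suc (sym (cong eN eq)))) (trans (cong ancs eq′) (cong (0 ∷_) (sym (cong ancs eq)))) b
      where
      eq′ = cong (λ z → step z i) eq
      b : ∀ k x → ∂ (u ∙ i) k ≡ just x → D x < D u ⊎ (D x ≡ D u × E x ≡ E u × OddOK x 0 (ancs (st u)))
      b k x e with ∂-view u i k e
      ... | inj₂ (ne , _) = inj₁ (≤-reflexive (trans (cong suc (lo k x ne e)) (sym (cong dN eq))))
      ... | inj₁ (refl , _) with hi x e
      ...   | d , l , q = inj₂ (trans d (sym (cong dN eq)) , trans l (sym (cong eN eq)) , zeroOK {x} q)
    trans-step u i (T2 c m e anc) eq iv with i Fin.≟ c | cong (λ z → step z i) eq
    trans-step u i (T2 c m e anc) eq (lo , hi) | yes refl | eq′ = newE 0 (trans (cong dN eq′) (sym (cong dN eq)))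
        (trans (cong eN eq′) (cong suc (sym (cong eN eq)))) (trans (cong ancs eq′) (cong (0 ∷_) (sym (cong ancs eq)))) b
      where
      b : ∀ k x → ∂ (u ∙ i) k ≡ just x → D x < D u ⊎ (D x ≡ D u × E x ≡ E u × OddOK x 0 (ancs (st u)))
      b k x w with ∂-view u i k w
      ... | inj₂ (ne , _) = inj₁ (≤-reflexive (trans (cong suc (lo k x ne w)) (sym (cong dN eq))))
      ... | inj₁ (refl , _) with hi x w
      ...   | d , l , q = inj₂ (trans d (sym (cong dN eq)) , trans l (sym (cong eN eq)) , zeroOK {x} q)
    trans-step u i (T2 c m e anc) eq iv | no ne | eq′ = same (trans (cong dN eq′) (sym (cong dN eq)))
        (trans (cong eN eq′) (sym (cong eN eq))) (trans (cong ancs eq′) (sym (cong ancs eq))) (subst (0 <_) (sym (cong qN eq′)) (s≤s z≤n))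
    trans-step u i (T1= a m j g anc) eq iv with i Fin.≟ a | cong (λ z → step z i) eq
    ... | yes refl | eq′ = newD (trans (cong dN eq′) (cong suc (sym (cong dN eq)))) λ k x e → trans (iv k x e) (sym (cong dN eq))
    ... | no ne | eq′ = same (trans (cong dN eq′) (sym (cong dN eq)))
        (trans (cong eN eq′) (sym (cong eN eq))) (trans (cong ancs eq′) (sym (cong ancs eq))) (subst (0 <_) (sym (cong qN eq′)) (s≤s z≤n))
    trans-step u i (T1< a c m j q γ anc arm) eq iv with i Fin.≟ a | cong (λ z → step z i) eq
    ... | yes refl | eq′ = newD (trans (cong dN eq′) (cong suc (sym (cong dN eq)))) λ k x e → trans (iv k x e) (sym (cong dN eq))
    ... | no i≢a | eq′ with i Fin.≟ c
    ...   | yes refl = same (trans (cong dN eq′) (sym (cong dN eq)))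
        (trans (cong eN eq′) (sym (cong eN eq))) (trans (cong ancs eq′) (sym (cong ancs eq))) (subst (0 <_) (sym (cong qN eq′)) (s≤s z≤n))
    ...   | no i≢c with iv
    ...     | lo , hi = newE _ (trans (cong dN eq′) (sym (cong dN eq)))
        (trans (cong eN eq′) (cong suc (sym (cong eN eq)))) (trans (cong ancs eq′) (cong (_ ∷_) (sym (cong ancs eq)))) b
      where
      b : ∀ k x → ∂ (u ∙ i) k ≡ just x → _
      b k x w with k Fin.≟ a
      ... | yes refl = inj₁ (≤-reflexive (trans (cong suc (lo x w)) (sym (cong dN eq))))
      ... | no ne with hi k x ne w
      ...   | d , l , ok = inj₂ (trans d (sym (cong dN eq)) , trans l (sym (cong eN eq)) ,
                subst (OddOK x _) (sym (cong ancs eq)) ok)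

  transition : ∀ u i → Trans u i
  transition u i = trans-step u i (st u) refl (inv (u ∙ i))

-- A part with a unique colour

-- The colour of a part in terms of (eN , qN , γN), besides dN modulo p+1.
module Keys (p cap : ℕ) where

  open Layers p

  -- The value 0 marks position zero: even positive positions have a ruler value of at least 1, and
  -- odd positions are coloured greedily.
  keyPos : ℕ → ℕ
  keyPos zero    = 0
  keyPos (suc q) = ruler (suc cap) (suc q)

  -- An odd part stores neither `E` nor its position; the 2p+1 greedy colours stand in for both.
  keyOf : Bool → ℕ → ℕ → ℕ → ℕ × ℕ ⊎ ℕ
  keyOf true  e q γ = inj₂ γ
  keyOf false e q γ = inj₁ (e % suc p , keyPos q)

  key : Word → ℕ × ℕ ⊎ ℕ
  key u = keyOf (odd (Q u)) (E u) (Q u) (Γ u)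

  SameColor : Word → Word → Set
  SameColor u w = D u % suc p ≡ D w % suc p × key u ≡ key w

  keyOf-odd : ∀ b b′ {e q γ e′ q′ γ′} → keyOf b e q γ ≡ keyOf b′ e′ q′ γ′ → b ≡ true → b′ ≡ true × γ ≡ γ′
  keyOf-odd true true refl refl = refl , refl

  keyOf-even : ∀ b b′ {e q γ e′ q′ γ′} → keyOf b e q γ ≡ keyOf b′ e′ q′ γ′ → b ≡ false →
    b′ ≡ false × e % suc p ≡ e′ % suc p × keyPos q ≡ keyPos q′
  keyOf-even false false eq refl with SumP.inj₁-injective eq
  ... | eq′ = refl , cong proj₁ eq′ , cong proj₂ eq′

  key-odd : ∀ u w → key u ≡ key w → odd (Q u) ≡ true → odd (Q w) ≡ true × Γ u ≡ Γ w
  key-odd u w = keyOf-odd (odd (Q u)) (odd (Q w))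

  key-even : ∀ u w → key u ≡ key w → odd (Q u) ≡ false →
    odd (Q w) ≡ false × E u % suc p ≡ E w % suc p × keyPos (Q u) ≡ keyPos (Q w)
  key-even u w = keyOf-even (odd (Q u)) (odd (Q w))

  keyPos-zero : ∀ q → odd q ≡ false → keyPos q ≡ 0 → q ≡ 0
  keyPos-zero zero    _ _ = refl
  keyPos-zero (suc q) o e = contradiction (trans (sym e) (proj₂ (ruler-evenSuc cap (suc q) o))) λ ()

  keyPos-pos : ∀ {q} → 0 < q → keyPos q ≡ ruler (suc cap) q
  keyPos-pos {suc q} _ = refl

module Center (p cap : ℕ) (p<2^cap : p < 2 ^ cap) {N : ℕ} (wd : Fin N → Word) (S : Subset N) where

  open Layers p
  open Keys p cap

  Vis : Word → Set
  Vis u = ∃ λ v → v ∈ S × u ⊑ wd v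

  -- Here `w` is the outermost part of the set, `ext` and `cross` are what its connectivity
  -- provides, and `few` denies it more than p colours.
  module _ (w : Word) (w∈ : ∃ λ v → v ∈ S × wd v ≡ w) (ext : ∀ v → v ∈ S → w ⊑ wd v)
           (cross : ∀ u i → w ⊑ u → Vis (u ∙ i) → ∃ λ k → ∃ λ v → v ∈ S × ∂ (u ∙ i) k ≡ just (wd v))
           (few : (f : ℕ → Fin N) → (∀ i → i ≤ p → f i ∈ S) →
                  ¬ (∀ i j → i < j → j ≤ p → ¬ SameColor (wd (f i)) (wd (f j)))) where

    Vis-pre : ∀ {u i} → Vis (u ∙ i) → Vis u
    Vis-pre (v , v∈ , l) = v , v∈ , ⊑-trans (there here) l

    D-mono : ∀ {u} → w ⊑ u → D w ≤ D u
    D-mono here = ≤-refl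
    D-mono {u ∙ i} (there l) with transition u i
    ... | newD d _         = ≤-trans (D-mono l) (≤-trans (n≤1+n _) (≤-reflexive (sym d)))
    ... | newE _ d _ _ _   = ≤-trans (D-mono l) (≤-reflexive (sym d))
    ... | same d _ _ _     = ≤-trans (D-mono l) (≤-reflexive (sym d))

    D-S : ∀ {v} → v ∈ S → D w ≤ D (wd v)
    D-S v∈ = D-mono (ext _ v∈)

    record DFam (u : Word) : Set where
      field
        vs  : ℕ → Fin N
        vs∈ : ∀ δ → D w ≤ δ → δ < D u → vs δ ∈ S × D (wd (vs δ)) ≡ δ

    -- Whenever `D` grows on the way from `w` to `u`, `cross` yields a part of the set on the new
    -- border, and this part has the old `D`. So every value passed is attained.
    dfam : ∀ {u} → w ⊑ u → Vis u → DFam u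
    dfam here _ = record { vs = λ _ → proj₁ w∈ ; vs∈ = λ δ a b → contradiction a (<⇒≱ b) }
    dfam {u ∙ i} (there l) vis with transition u i | dfam l (Vis-pre vis)
    ... | newE _ d _ _ _ | F = record { vs = DFam.vs F ; vs∈ = λ δ a b → DFam.vs∈ F δ a (subst (δ <_) d b) }
    ... | same d _ _ _   | F = record { vs = DFam.vs F ; vs∈ = λ δ a b → DFam.vs∈ F δ a (subst (δ <_) d b) }
    ... | newD d bd      | F with cross u i l vis
    ...   | k , x , x∈ , e = record { vs = vs′ ; vs∈ = vs∈′ }
      where
      vs′ : ℕ → Fin N
      vs′ δ with δ ℕ.≟ D u
      ... | yes _ = x
      ... | no  _ = DFam.vs F δ
      vs∈′ : ∀ δ → D w ≤ δ → δ < D (u ∙ i) → vs′ δ ∈ S × D (wd (vs′ δ)) ≡ δ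
      vs∈′ δ a b with δ ℕ.≟ D u
      ... | yes refl = x∈ , bd k (wd x) e
      ... | no  ne   = DFam.vs∈ F δ a (≤∧≢⇒< (ℕ.s≤s⁻¹ (subst (δ <_) d b)) ne)

    D-bound : ∀ {v} → v ∈ S → D (wd v) < D w + suc p
    D-bound {v} v∈ with D (wd v) <? D w + suc p
    ... | yes lt = lt
    ... | no  ge = ⊥-elim (few f (λ i i≤ → proj₁ (f∈ i i≤)) dist)
      where
      F = dfam (ext v v∈) (v , v∈ , here)
      f : ℕ → Fin N
      f i = DFam.vs F (D w + i)
      f∈ : ∀ i → i ≤ p → f i ∈ S × D (wd (f i)) ≡ D w + i
      f∈ i i≤ = DFam.vs∈ F (D w + i) (m≤m+n _ _) (<-≤-trans (+-monoʳ-< (D w) (s≤s i≤)) (≮⇒≥ ge))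
      dist : ∀ i j → i < j → j ≤ p → ¬ SameColor (wd (f i)) (wd (f j))
      dist i j i<j j≤ (e , _) = mod-distinct p (D w + i) (D w + j) (+-monoʳ-< (D w) i<j)
        (≤-trans (+-monoʳ-≤ (D w) (≤-trans j≤ (m≤n+m p i))) (≤-reflexive (sym (+-assoc (D w) i p))))
        (subst₂ (λ a b → a % suc p ≡ b % suc p) (proj₂ (f∈ i (≤-trans (<⇒≤ i<j) j≤))) (proj₂ (f∈ j j≤)) e)

    D-eq : ∀ {v} → v ∈ S → D (wd v) % suc p ≡ D w % suc p → D (wd v) ≡ D w
    D-eq {v} v∈ e with m≤n⇒m<n∨m≡n (D-S v∈)
    ... | inj₂ q  = sym q
    ... | inj₁ lt = contradiction (sym e) (mod-distinct p _ _ lt (ℕ.s≤s⁻¹ (≤-trans (D-bound v∈) (≤-reflexive (+-suc (D w) p)))))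

    record EFam (u : Word) : Set where
      field
        vs   : ℕ → Fin N
        vs∈  : ∀ η → E w ≤ η → η < E u → vs η ∈ S × D (wd (vs η)) ≡ D w × E (wd (vs η)) ≡ η
        gate : ∀ η → E w ≤ η → η < E u → odd (Q (wd (vs η))) ≡ true →
               At (ancs (st u)) (E u ∸ suc η) (Γ (wd (vs η)))
        dist : ∀ η η′ → E w ≤ η → η < η′ → η′ < E u → η′ ≤ η + p → odd (Q (wd (vs η))) ≡ true →
               odd (Q (wd (vs η′))) ≡ true → Γ (wd (vs η)) ≢ Γ (wd (vs η′))

    E-mono : ∀ {u} → w ⊑ u → D u ≡ D w → E w ≤ E u
    E-mono here _ = ≤-refl
    E-mono {u ∙ i} (there l) q with transition u i
    ... | newD d _       = contradiction (≤-trans (≤-reflexive (trans (sym d) q)) (D-mono l)) 1+n≰n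
    ... | newE _ d e _ _ = ≤-trans (E-mono l (trans (sym d) q)) (≤-trans (n≤1+n _) (≤-reflexive (sym e)))
    ... | same d e _ _   = ≤-trans (E-mono l (trans (sym d) q)) (≤-reflexive (sym e))

    -- As in `dfam`, the border part found has the old `E`. If it is odd, its greedy colour is the
    -- entry just pushed on `ancs` and avoids the p entries before it; `gate` and `dist` preserve
    -- these two facts.
    efam : ∀ {u} → w ⊑ u → D u ≡ D w → Vis u → EFam u
    efam here _ _ = record
      { vs = λ _ → proj₁ w∈
      ; vs∈ = λ η a b → contradiction a (<⇒≱ b)
      ; gate = λ η a b → contradiction a (<⇒≱ b)
      ; dist = λ η η′ a b c → contradiction a (<⇒≱ (<-trans b c)) }
    efam {u ∙ i} (there l) q vis with transition u i
    ... | newD d _ = contradiction (≤-trans (≤-reflexive (trans (sym d) q)) (D-mono l)) 1+n≰n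
    ... | same d e a _ = record
      { vs = EFam.vs F
      ; vs∈ = λ η x y → EFam.vs∈ F η x (subst (η <_) e y)
      ; gate = λ η x y o → subst₂ (λ as m → At as (m ∸ suc η) (Γ (wd (EFam.vs F η)))) (sym a) (sym e)
          (EFam.gate F η x (subst (η <_) e y) o)
      ; dist = λ η η′ x y z → EFam.dist F η η′ x y (subst (η′ <_) e z) }
      where F = efam l (trans (sym d) q) (Vis-pre vis)
    ... | newE g d e a bd with cross u i l vis
    ...   | k , x , x∈ , b with bd k (wd x) b
    -- A border part of a lower layer is not in the set, all of whose parts extend `w`.
    ...     | inj₁ lt = contradiction (D-S x∈) (<⇒≱ (<-≤-trans lt (≤-reflexive (trans (sym d) q))))
    ...     | inj₂ (dx , ex , ok) = record { vs = vs′ ; vs∈ = vs∈′ ; gate = gate′ ; dist = dist′ }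
      where
      F = efam l (trans (sym d) q) (Vis-pre vis)
      vs′ : ℕ → Fin N
      vs′ η with η ℕ.≟ E u
      ... | yes _ = x
      ... | no  _ = EFam.vs F η
      below : ∀ {η} → η < E (u ∙ i) → η ≢ E u → η < E u
      below {η} y ne = ≤∧≢⇒< (ℕ.s≤s⁻¹ (subst (η <_) e y)) ne
      vs∈′ : ∀ η → E w ≤ η → η < E (u ∙ i) → vs′ η ∈ S × D (wd (vs′ η)) ≡ D w × E (wd (vs′ η)) ≡ η
      vs∈′ η y z with η ℕ.≟ E u
      ... | yes refl = x∈ , trans dx (trans (sym d) q) , ex
      ... | no  ne   = EFam.vs∈ F η y (below z ne)
      gate′ : ∀ η → E w ≤ η → η < E (u ∙ i) → odd (Q (wd (vs′ η))) ≡ true →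
              At (ancs (st (u ∙ i))) (E (u ∙ i) ∸ suc η) (Γ (wd (vs′ η)))
      gate′ η y z o with η ℕ.≟ E u
      ... | yes refl = subst₂ (λ as m → At as (m ∸ suc η) (Γ (wd x))) (sym a) (sym e)
              (subst₂ (At (g ∷ ancs (st u))) (sym (n∸n≡0 η)) (sym (proj₁ (ok o))) hd)
      ... | no  ne   = subst₂ (λ as m → At as (m ∸ suc η) (Γ (wd (EFam.vs F η)))) (sym a) (sym e)
              (subst (λ m → At (g ∷ ancs (st u)) m (Γ (wd (EFam.vs F η)))) (suc-∸ (below z ne)) (tl (EFam.gate F η y (below z ne) o)))
        where
        suc-∸ : ∀ {a b} → a < b → suc (b ∸ suc a) ≡ suc b ∸ suc a
        suc-∸ lt = sym (+-∸-assoc 1 lt)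
      dist′ : ∀ η η′ → E w ≤ η → η < η′ → η′ < E (u ∙ i) → η′ ≤ η + p → odd (Q (wd (vs′ η))) ≡ true →
               odd (Q (wd (vs′ η′))) ≡ true → Γ (wd (vs′ η)) ≢ Γ (wd (vs′ η′))
      dist′ η η′ y y′ z z′ o o′ with η ℕ.≟ E u | η′ ℕ.≟ E u
      ... | yes refl | yes refl = contradiction y′ (<-irrefl refl)
      ... | yes refl | no ne    = contradiction (below z ne) (<⇒≯ y′)
      ... | no ne    | no ne′   = EFam.dist F η η′ y y′ (below z ne′) z′ o o′
      ... | no ne    | yes refl = λ eq → proj₂ (ok o′) (subst (λ c → c LM.∈ take p (ancs (st u))) eq
              (At-take p (EFam.gate F η y y′ o) (≤-trans (≤-reflexive (trans (sym (+-∸-assoc 1 y′)) refl))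
                (≤-trans (∸-monoˡ-≤ η z′) (≤-reflexive (m+n∸m≡n η p))))))

    -- Otherwise the set has a part at each of p+1 consecutive values of `E`. Even ones differ by
    -- `E` modulo p+1, odd ones by their greedy colours, and an even and an odd part never share a
    -- key.
    E-bound : ∀ {v} → v ∈ S → D (wd v) ≡ D w → E (wd v) < E w + suc p
    E-bound {v} v∈ q with E (wd v) <? E w + suc p
    ... | yes lt = lt
    ... | no  ge = ⊥-elim (few f (λ i i≤ → proj₁ (f∈ i i≤)) dst)
      where
      F = efam (ext v v∈) q (v , v∈ , here)
      f : ℕ → Fin N
      f i = EFam.vs F (E w + i)
      lt : ∀ {i} → i ≤ p → E w + i < E (wd v)
      lt i≤ = <-≤-trans (+-monoʳ-< (E w) (s≤s i≤)) (≮⇒≥ ge)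
      f∈ : ∀ i → i ≤ p → f i ∈ S × D (wd (f i)) ≡ D w × E (wd (f i)) ≡ E w + i
      f∈ i i≤ = EFam.vs∈ F (E w + i) (m≤m+n _ _) (lt i≤)
      dst : ∀ i j → i < j → j ≤ p → ¬ SameColor (wd (f i)) (wd (f j))
      dst i j i<j j≤ (_ , e) = go (odd (Q (wd (f i)))) refl
        where
        i≤ = ≤-trans (<⇒≤ i<j) j≤
        near : E w + j ≤ E w + i + p
        near = ≤-trans (+-monoʳ-≤ (E w) (≤-trans j≤ (m≤n+m p i))) (≤-reflexive (sym (+-assoc (E w) i p)))
        go : ∀ b → odd (Q (wd (f i))) ≡ b → ⊥
        go true o with key-odd (wd (f i)) (wd (f j)) e o
        ... | o′ , γ = EFam.dist F _ _ (m≤m+n _ _) (+-monoʳ-< (E w) i<j) (lt j≤) near o o′ γ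
        go false o with key-even (wd (f i)) (wd (f j)) e o
        ... | _ , m , _ = mod-distinct p (E w + i) (E w + j) (+-monoʳ-< (E w) i<j) near
          (subst₂ (λ a b → a % suc p ≡ b % suc p) (proj₂ (proj₂ (f∈ i i≤))) (proj₂ (proj₂ (f∈ j j≤))) m)

    E-eq : ∀ {v} → v ∈ S → D (wd v) ≡ D w → E (wd v) % suc p ≡ E w % suc p → E (wd v) ≡ E w
    E-eq {v} v∈ q e with m≤n⇒m<n∨m≡n (E-mono (ext v v∈) q)
    ... | inj₂ r  = sym r
    ... | inj₁ lt = contradiction (sym e) (mod-distinct p _ _ lt (ℕ.s≤s⁻¹ (≤-trans (E-bound v∈ q) (≤-reflexive (+-suc (E w) p)))))

    Result : Set
    Result = ∃ λ v → v ∈ S × (∀ u → u ∈ S → SameColor (wd u) (wd v) → wd u ≡ wd v)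

    -- Any other part with the `D` and `E` of `w` is entered by a `same` move and has a positive
    -- position, which `keyPos` tells from zero.
    start : Q w ≡ 0 → Result
    start q0 = v , proj₁ (proj₂ w∈) , λ u u∈ sc → trans (uniq u u∈ sc) (sym wv)
      where
      v = proj₁ w∈
      wv : wd v ≡ w
      wv = proj₂ (proj₂ w∈)
      Qv : Q (wd v) ≡ 0
      Qv = trans (cong Q wv) q0
      uniq : ∀ u → u ∈ S → SameColor (wd u) (wd v) → wd u ≡ w
      uniq u u∈ (d , k) with key-even (wd v) (wd u) (sym k) (cong odd Qv)
      ... | o , e , kp = go (ext u u∈) refl
        where
        deq = D-eq u∈ (trans d (cong (λ z → D z % suc p) wv))
        eeq = E-eq u∈ deq (trans (sym e) (cong (λ z → E z % suc p) wv))
        q0′ : Q (wd u) ≡ 0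
        q0′ = keyPos-zero (Q (wd u)) o (trans (sym kp) (cong keyPos Qv))
        go : ∀ {x} → w ⊑ x → wd u ≡ x → x ≡ w
        go here _ = refl
        go {x ∙ i} (there l) eq with transition x i
        ... | newD d′ _ = contradiction (≤-trans (≤-reflexive (trans (sym d′) (trans (cong D (sym eq)) deq))) (D-mono l)) 1+n≰n
        ... | newE _ d′ e′ _ _ = contradiction (≤-trans (≤-reflexive (trans (sym e′) (trans (cong E (sym eq)) eeq)))
                (E-mono l (trans (sym d′) (trans (cong D (sym eq)) deq)))) 1+n≰n
        ... | same _ _ _ pos = contradiction (subst (0 <_) (trans (cong Q (sym eq)) q0′) pos) λ ()

    module Arm (a c : Fin 3) (m j q γ : ℕ) (anc arm : List ℕ) (eq : st w ≡ T1< a c m j q γ anc arm) where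

      arm-word : ℕ → Word
      arm-word zero    = w
      arm-word (suc n) = arm-word n ∙ c

      a≢c : a ≢ c
      a≢c = proj₂ (proj₂ (proj₂ (proj₂ (subst (Inv w) eq (inv w)))))

      ArmState : ℕ → Set
      ArmState n = ∃ λ γ′ → ∃ λ arm′ → st (arm-word n) ≡ T1< a c m j (n + q) γ′ anc arm′

      arm-step : ∀ n q′ γ′ arm′ → st (arm-word n) ≡ T1< a c m j q′ γ′ anc arm′ →
        st (arm-word (suc n)) ≡ T1< a c m j (suc q′) (Γ (arm-word n)) anc
          (if odd (suc q′) then Γ (arm-word n) ∷ arm′ else arm′)
      arm-step n q′ γ′ arm′ e rewrite e with c Fin.≟ a
      ... | yes r = contradiction (sym r) a≢c
      ... | no  _ with c Fin.≟ c
      ...   | yes _ = refl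
      ...   | no ne = contradiction refl ne

      arm-state : ∀ n → ArmState n
      arm-state zero    = γ , arm , eq
      arm-state (suc n) with arm-state n
      ... | γ′ , arm′ , e = _ , _ , arm-step n (n + q) γ′ arm′ e

      arm-Q : ∀ n → Q (arm-word n) ≡ n + suc q
      arm-Q n with arm-state n
      ... | _ , _ , e = trans (cong qN e) (sym (+-suc n q))

      arm-D : ∀ n → D (arm-word n) ≡ D w
      arm-D n with arm-state n
      ... | _ , _ , e = trans (cong dN e) (sym (cong dN eq))

      arm-E : ∀ n → E (arm-word n) ≡ E w
      arm-E n with arm-state n
      ... | _ , _ , e = trans (cong eN e) (sym (cong eN eq))

      arm-⊑ : ∀ n → w ⊑ arm-word n
      arm-⊑ zero    = here
      arm-⊑ (suc n) = there (arm-⊑ n)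

      -- Letter `a` raises `D` and the third letter raises `E`; only `c` keeps both.
      on-arm : ∀ {u} → w ⊑ u → D u ≡ D w → E u ≡ E w → ∃ λ n → u ≡ arm-word n
      on-arm here _ _ = 0 , refl
      on-arm {u ∙ i} (there l) d e with transition u i
      ... | newD d′ _ = contradiction (≤-trans (≤-reflexive (trans (sym d′) d)) (D-mono l)) 1+n≰n
      ... | newE _ d′ e′ _ _ = contradiction (≤-trans (≤-reflexive (trans (sym e′) e)) (E-mono l (trans (sym d′) d))) 1+n≰n
      ... | same d′ e′ _ _ with on-arm l (trans (sym d′) d) (trans (sym e′) e)
      ...   | n , refl with arm-state n
      ...     | γ′ , arm′ , s with i Fin.≟ a | cong (λ z → step z i) s
      ...       | yes refl | s′ = contradiction (trans (trans (sym (cong dN s′)) d′) (cong dN s)) 1+n≢n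
      ...       | no _ | s″ with i Fin.≟ c | s″
      ...         | yes refl | _ = suc n , refl
      ...         | no _ | s′ = contradiction (trans (trans (sym (cong eN s′)) e′) (cong eN s)) 1+n≢n

      arm-odd : ∀ n t → odd (Q (arm-word n)) ≡ true → odd (Q (arm-word (n + (t + t)))) ≡ true
      arm-odd n t o = trans (cong odd (trans (arm-Q (n + (t + t))) (trans (cong (_+ suc q) (+-comm n (t + t))) (+-assoc (t + t) n (suc q)))))
        (trans (odd-double-+ t (n + suc q)) (trans (cong odd (sym (arm-Q n))) o))

      arms-push : ∀ n → odd (Q (arm-word n)) ≡ true → arms (st (arm-word (suc (suc n)))) ≡ Γ (arm-word n) ∷ arms (st (arm-word n))
      arms-push n o with arm-state n
      ... | γ′ , arm′ , e with arm-step n (n + q) γ′ arm′ e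
      ...   | e₁ with arm-step (suc n) (suc (n + q)) _ _ e₁
      ...     | e₂ = trans (cong arms e₂) (trans (cong₂ (λ b₁ b₂ → if b₁ then Γ (arm-word (suc n)) ∷ (if b₂ then Γ (arm-word n) ∷ arm′ else arm′)
                        else (if b₂ then Γ (arm-word n) ∷ arm′ else arm′)) (cong not o′) o′)
                        (cong (Γ (arm-word n) ∷_) (sym (cong arms e))))
        where
        o′ : odd (suc (n + q)) ≡ true
        o′ = trans (sym (cong (λ z → odd (qN z)) e)) o

      -- Only odd positions are pushed, so after 2(t+1) steps along the arm a colour has t later
      -- ones above it.
      Γ-arms : ∀ n t → odd (Q (arm-word n)) ≡ true →
        At (arms (st (arm-word (n + suc (t + t + 1))))) t (Γ (arm-word n))
      Γ-arms n t o = go t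
        where
        ix : ∀ t → n + suc (t + t + 1) ≡ suc (suc (n + (t + t)))
        ix t rewrite +-comm (t + t) 1 | +-suc n (suc (t + t)) | +-suc n (t + t) = refl
        top : ∀ t → arms (st (arm-word (n + suc (t + t + 1)))) ≡ Γ (arm-word (n + (t + t))) ∷ arms (st (arm-word (n + (t + t))))
        top t rewrite ix t = arms-push (n + (t + t)) (arm-odd n t o)
        go : ∀ t → At (arms (st (arm-word (n + suc (t + t + 1))))) t (Γ (arm-word n))
        go zero rewrite top 0 | +-identityʳ n = hd
        go (suc t) rewrite top (suc t) = tl (subst (λ m → At (arms (st (arm-word m))) t (Γ (arm-word n)))
          (cong (n +_) (cong suc (trans (+-comm (t + t) 1) (sym (+-suc t t))))) (go t))

      Has : ℕ → Set
      Has n = ∃ λ v → v ∈ S × wd v ≡ arm-word n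

      has? : ∀ n → Dec (Has n)
      has? n = FinP.any? λ v → (v SubP.∈? S) ×-dec (wd v ≟ʷ arm-word n)

      -- Entering the region behind position n+1 of the arm is only possible through
      -- position n, since the two other boundary parts lie outside the region of w.
      has-pred : ∀ n → Has (suc n) → Has n
      has-pred n (v , v∈ , e) with cross (arm-word n) c (arm-⊑ n) (v , v∈ , subst (arm-word (suc n) ⊑_) (sym e) here)
      ... | k , x , x∈ , b with ∂-view (arm-word n) c k b
      ...   | inj₁ (_ , e′) = x , x∈ , e′
      ...   | inj₂ (ne , b₁) = contradiction (⊑-len (ext x x∈)) (<⇒≱ (∂-len w k (outer n b₁)))
        where
        outer : ∀ n → ∂ (arm-word n) k ≡ just (wd x) → ∂ w k ≡ just (wd x)
        outer zero    b = b
        outer (suc n) b with ∂-view (arm-word n) c k b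
        ... | inj₁ (r , _)  = contradiction r ne
        ... | inj₂ (_ , b′) = outer n b′

      has-≤ : ∀ {n n′} → n′ ≤ n → Has n → Has n′
      has-≤ {n} {n′} le h with m≤n⇒m<n∨m≡n le
      ... | inj₂ refl = h
      has-≤ {suc n} le h | inj₁ (s≤s lt) = has-≤ lt (has-pred n h)

      -- By `has-pred` the set would contain all earlier arm positions as well, among them p+1 odd
      -- ones, and each odd part avoids the colours of the p odd parts before it.
      ¬long : ¬ Has (suc (p + p))
      ¬long h = few f f∈ dst
        where
        -- Indices count from `w`, whose position may be even: the first odd position has index 0 or
        -- 1, and 2p further steps stay within 2p+1.
        o₀ : ∃ λ n → n ≤ 1 × odd (Q (arm-word n)) ≡ true
        o₀ with odd (Q w) in e
        ... | true  = 0 , z≤n , e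
        ... | false = 1 , s≤s z≤n , trans (cong odd (arm-Q 1)) (trans (cong (λ z → not (odd z)) (sym (arm-Q 0))) (cong not e))
        n₀ = proj₁ o₀
        g : ∀ i → i ≤ p → Has (n₀ + (i + i))
        g i i≤ = has-≤ (+-mono-≤ (proj₁ (proj₂ o₀)) (+-mono-≤ i≤ i≤)) h
        f : ℕ → Fin N
        f i with i ≤? p
        ... | yes i≤ = proj₁ (g i i≤)
        ... | no  _  = proj₁ w∈
        f≡ : ∀ i (i≤ : i ≤ p) → wd (f i) ≡ arm-word (n₀ + (i + i))
        f≡ i i≤ with i ≤? p
        ... | yes i≤′ = proj₂ (proj₂ (g i i≤′))
        ... | no  ne  = contradiction i≤ ne
        f∈ : ∀ i → i ≤ p → f i ∈ S
        f∈ i i≤ with i ≤? p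
        ... | yes i≤′ = proj₁ (proj₂ (g i i≤′))
        ... | no  ne  = contradiction i≤ ne
        oddAt : ∀ i → odd (Q (arm-word (n₀ + (i + i)))) ≡ true
        oddAt i = arm-odd n₀ i (proj₂ (proj₂ o₀))
        dst : ∀ i j → i < j → j ≤ p → ¬ SameColor (wd (f i)) (wd (f j))
        dst i j i<j j≤ (_ , k) with key-odd (wd (f i)) (wd (f j)) k (trans (cong (λ z → odd (Q z)) (f≡ i (≤-trans (<⇒≤ i<j) j≤))) (oddAt i))
        ... | _ , γe = γN∉arms (st (arm-word (n₀ + (j + j)))) (subst (λ z → z LM.∈ take p (arms (st (arm-word (n₀ + (j + j))))))
                (trans (cong Γ (sym (f≡ i (≤-trans (<⇒≤ i<j) j≤)))) (trans γe (cong Γ (f≡ j j≤))))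
                (At-take p at lt))
          where
          t = j ∸ suc i
          j≡ : j ≡ suc (i + t)
          j≡ = sym (m+[n∸m]≡n i<j)
          lt : t < p
          lt = <-≤-trans (≤-trans (s≤s (m≤n+m t i)) (≤-reflexive (sym j≡))) j≤
          ix : n₀ + (i + i) + suc (t + t + 1) ≡ n₀ + (j + j)
          ix = trans (+-assoc n₀ (i + i) _) (cong (n₀ +_) (trans e₁ (sym (cong₂ _+_ j≡ j≡))))
            where
            e₁ : i + i + suc (t + t + 1) ≡ suc (i + t) + suc (i + t)
            e₁ = solve 2 (λ i t → i :+ i :+ (con 1 :+ (t :+ t :+ con 1)) := (con 1 :+ (i :+ t)) :+ (con 1 :+ (i :+ t))) refl i t
              where
              open +-*-Solver
          at : At (arms (st (arm-word (n₀ + (j + j))))) t (Γ (arm-word (n₀ + (i + i))))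
          at = subst (λ k → At (arms (st (arm-word k))) t (Γ (arm-word (n₀ + (i + i))))) ix (Γ-arms (n₀ + (i + i)) t (oddAt i))

      longest : ∀ b → ¬ Has (suc b) → ∃ λ l → l ≤ b × Has l × (∀ n → Has n → n ≤ l)
      longest b ¬h with has? b
      ... | yes h = b , ≤-refl , h , λ n hn → ≮⇒≥ λ lt → ¬h (has-≤ lt hn)
      longest zero    ¬h | no ne = contradiction w∈ ne
      longest (suc b) ¬h | no ne with longest b ne
      ... | l , a₁ , a₂ , a₃ = l , m≤n⇒m≤1+n a₁ , a₂ , a₃

      on-S : ∀ {u} → u ∈ S → D (wd u) ≡ D w → E (wd u) ≡ E w → ∃ λ n → wd u ≡ arm-word n × Has n
      on-S {u} u∈ d e with on-arm (ext u u∈) d e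
      ... | n , eq′ = n , eq′ , u , u∈ , eq′

      -- The set occupies an initial stretch of at most 2p+1 parts of the arm, short enough for
      -- `ruler-unique`. If the position found is even, `D`, `E` and the ruler value determine it.
      -- If it is odd, the stretch is `w` alone; its colour does not show `E`, and a competitor with
      -- larger `E` is excluded by `ancs`.
      result : Result
      result with longest (p + p) ¬long
      ... | l , l≤ , hl , max with ruler-unique (suc cap) (suc q) l
              (≤-<-trans l≤ (≤-trans (+-mono-< p<2^cap p<2^cap) (≤-reflexive (cong (2 ^ cap +_) (sym (+-identityʳ (2 ^ cap)))))))
      ...   | y , y≥ , y≤ , y-odd , y-uniq = proj₁ h , proj₁ (proj₂ h) , λ u u∈ sc → uniq u u∈ sc
        where
        n : ℕ
        n = y ∸ suc q
        n+q : n + suc q ≡ y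
        n+q = m∸n+n≡m y≥
        h : Has n
        h = has-≤ (≤-trans (∸-monoˡ-≤ (suc q) y≤) (≤-reflexive (m+n∸m≡n (suc q) l))) hl
        v = proj₁ h
        wv : wd v ≡ arm-word n
        wv = proj₂ (proj₂ h)
        Qv : Q (wd v) ≡ y
        Qv = trans (cong Q wv) (trans (arm-Q n) n+q)
        uniq : ∀ u → u ∈ S → SameColor (wd u) (wd v) → wd u ≡ wd v
        uniq u u∈ (d , k) = go (odd y) refl
          where
          deq : D (wd u) ≡ D w
          deq = D-eq u∈ (trans d (cong (_% suc p) (trans (cong D wv) (arm-D n))))
          go : ∀ b → odd y ≡ b → wd u ≡ wd v
          go false oy with key-even (wd v) (wd u) (sym k) (trans (cong odd Qv) oy)
          ... | o , e , kp with on-S u∈ deq (E-eq u∈ deq (trans (sym e) (cong (_% suc p) (trans (cong E wv) (arm-E n)))))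
          ...   | n′ , wu , hn′ = trans wu (trans (cong arm-word n′≡n) (sym wv))
            where
            Qu : Q (wd u) ≡ n′ + suc q
            Qu = trans (cong Q wu) (arm-Q n′)
            pos : ∀ m → 0 < m + suc q
            pos m = ≤-trans (s≤s z≤n) (m≤n+m (suc q) m)
            r : ruler (suc cap) (n′ + suc q) ≡ ruler (suc cap) y
            r = trans (sym (keyPos-pos (pos n′))) (trans (trans (cong keyPos (sym Qu)) (trans (sym kp) (cong keyPos Qv)))
                  (keyPos-pos (subst (0 <_) n+q (pos n))))
            n′≡n : n′ ≡ n
            n′≡n = +-cancelʳ-≡ (suc q) n′ n (trans (y-uniq (n′ + suc q) (m≤n+m (suc q) n′)
                     (≤-trans (≤-reflexive (+-comm n′ (suc q))) (+-monoʳ-≤ (suc q) (max n′ hn′))) r) (sym n+q))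
          go true oy with key-odd (wd v) (wd u) (sym k) (trans (cong odd Qv) oy)
          ... | _ , γe = split (m≤n⇒m<n∨m≡n (E-mono (ext u u∈) deq))
            where
            n≡0 : n ≡ 0
            n≡0 = n≤0⇒n≡0 (≤-trans (∸-monoˡ-≤ (suc q) (≤-trans y≤ (≤-reflexive (trans (cong (suc q +_) (y-odd oy)) (+-identityʳ (suc q))))))
                    (≤-reflexive (n∸n≡0 (suc q))))
            wv′ : wd v ≡ w
            wv′ = trans wv (cong arm-word n≡0)
            only : ∀ {x} → x ∈ S → D (wd x) ≡ D w → E (wd x) ≡ E w → wd x ≡ w
            only x∈ dx ex with on-S x∈ dx ex
            ... | n′ , wx , hx = trans wx (cong arm-word (n≤0⇒n≡0 (≤-trans (max n′ hx) (≤-reflexive (y-odd oy)))))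
            split : E w < E (wd u) ⊎ E w ≡ E (wd u) → wd u ≡ wd v
            split (inj₂ e)  = trans (only u∈ deq (sym e)) (sym wv′)
            -- The level of `u` can be reached only past `w`, the sole part of the set with this `D`
            -- and `E`, so the greedy colour of `w` is among the p entries that `u` avoids.
            split (inj₁ lt) = contradiction γ∈ (γN∉ancs (st (wd u)))
              where
              F = efam (ext u u∈) deq (u , u∈ , here)
              x = EFam.vs F (E w)
              xs = EFam.vs∈ F (E w) ≤-refl lt
              wx : wd x ≡ w
              wx = only (proj₁ xs) (proj₁ (proj₂ xs)) (proj₂ (proj₂ xs))
              γ∈ : Γ (wd u) LM.∈ take p (ancs (st (wd u)))
              γ∈ = subst (LM._∈ take p (ancs (st (wd u)))) (trans (cong Γ (trans wx (sym wv′))) γe)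
                (At-take p (EFam.gate F (E w) ≤-refl lt (trans (cong (λ z → odd (Q z)) (trans wx (sym wv′))) (trans (cong odd Qv) oy)))
                  (≤-trans (≤-reflexive (sym (+-∸-assoc 1 lt)))
                    (≤-trans (∸-monoˡ-≤ (E w) (ℕ.s≤s⁻¹ (≤-trans (E-bound u∈ deq) (≤-reflexive (+-suc (E w) p)))))
                      (≤-reflexive (m+n∸m≡n (E w) p)))))

    center : Result
    center = go (st w) refl
      where
      go : ∀ s → st w ≡ s → Result
      go (T3 m) e = start (cong qN e)
      go (T2 c m l anc) e = start (cong qN e)
      go (T1= a m j g anc) e = start (cong qN e)
      go (T1< a c m j q γ anc arm) e = Arm.result a c m j q γ anc arm e

-- The colouring

-- A vertex is either on one of q exceptional paths or in one of the three legs of the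
-- part named by a word.  By `nested`, an edge can leave the region of a word only through
-- the three parts around it.
record Layout (G : Graph) (q : ℕ) : Set where
  field
    layer     : Fin (order G) → ℕ
    layer-adj : ∀ {u v} → adj G u v ≡ true → layer v ≤ suc (layer u)
    comp      : Fin (order G) → ℕ
    comp-adj  : ∀ {u v} → adj G u v ≡ true → comp u ≡ comp v
    zone      : Fin (order G) → Fin q ⊎ (Word × Fin 3)
    zone-inj  : ∀ {u v} → comp u ≡ comp v → layer u ≡ layer v → zone u ≡ zone v → u ≡ v
    nested    : ∀ {u v wu wv lu lv} → adj G u v ≡ true → zone u ≡ inj₂ (wu , lu) → zone v ≡ inj₂ (wv , lv) →
                ∀ {w} → w ⊑ wu → w ⊑ wv ⊎ ∃ λ k → ∂ w k ≡ just wv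

join-inj : ∀ {a b} (x y : Fin a ⊎ Fin b) → join a b x ≡ join a b y → x ≡ y
join-inj {a} {b} x y e = trans (sym (FinP.splitAt-join a b x)) (trans (cong (splitAt a) e) (FinP.splitAt-join a b y))

-- The layer modulo p+1, with either a private colour or a leg, `D` modulo p+1 and a key: `E` modulo
-- p+1 with a value of `keyPos` up to cap+1, or a greedy colour up to 2p.
colours : ℕ → ℕ → ℕ → ℕ
colours q p cap = suc p * (q + 3 * (suc p * (suc p * (2 + cap) + suc (p + p))))

module Colouring {G : Graph} {q : ℕ} (L : Layout G q) (p cap : ℕ) (p<2^cap : p < 2 ^ cap)
  {N : ℕ} (enough : colours q p cap ≤ N) where

  open Layout L
  open Layers p
  open Keys p cap

  wordOf : Fin q ⊎ (Word × Fin 3) → Word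
  wordOf (inj₁ _)       = ε
  wordOf (inj₂ (w , _)) = w

  wd : Fin (order G) → Word
  wd v = wordOf (zone v)

  Key = Fin (suc p) × Fin (2 + cap) ⊎ Fin (suc (p + p))

  keyPos≤ : ∀ r → keyPos r ≤ suc cap
  keyPos≤ zero    = z≤n
  keyPos≤ (suc r) = ruler≤ (suc cap) (suc r)

  keyFin : Bool → ∀ e r γ → γ ≤ p + p → Key
  keyFin true  e r γ γ≤ = inj₂ (fromℕ< (s≤s γ≤))
  keyFin false e r γ γ≤ = inj₁ (fromℕ< (m%n<n e (suc p)) , fromℕ< (s≤s (keyPos≤ r)))

  keyFin-inj : ∀ b b′ e e′ r r′ γ γ′ (γ≤ : γ ≤ p + p) (γ′≤ : γ′ ≤ p + p) →
    keyFin b e r γ γ≤ ≡ keyFin b′ e′ r′ γ′ γ′≤ → keyOf b e r γ ≡ keyOf b′ e′ r′ γ′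
  keyFin-inj true true e e′ r r′ γ γ′ γ≤ γ′≤ q = cong inj₂ (FinP.fromℕ<-injective _ _ _ _ (SumP.inj₂-injective q))
  keyFin-inj false false e e′ r r′ γ γ′ γ≤ γ′≤ q with SumP.inj₁-injective q
  ... | q′ = cong inj₁ (cong₂ _,_ (FinP.fromℕ<-injective _ _ _ _ (cong proj₁ q′)) (FinP.fromℕ<-injective _ _ _ _ (cong proj₂ q′)))

  ZoneColour = Fin q ⊎ (Fin 3 × Fin (suc p) × Key)

  zoneColour : Fin q ⊎ (Word × Fin 3) → ZoneColour
  zoneColour (inj₁ z)       = inj₁ z
  zoneColour (inj₂ (w , l)) = inj₂ (l , fromℕ< (m%n<n (D w) (suc p)) , keyFin (odd (Q w)) (E w) (Q w) (Γ w) (γN≤ (st w)))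

  encKey : Key → Fin (suc p * (2 + cap) + suc (p + p))
  encKey (inj₁ (i , j)) = join (suc p * (2 + cap)) (suc (p + p)) (inj₁ (combine i j))
  encKey (inj₂ i)       = join (suc p * (2 + cap)) (suc (p + p)) (inj₂ i)

  encKey-inj : ∀ x y → encKey x ≡ encKey y → x ≡ y
  encKey-inj (inj₁ (i , j)) (inj₁ (k , l)) e with FinP.combine-injective i j k l (SumP.inj₁-injective (join-inj {suc p * (2 + cap)} {suc (p + p)} (inj₁ (combine i j)) (inj₁ (combine k l)) e))
  ... | refl , refl = refl
  encKey-inj (inj₁ (i , j)) (inj₂ k) e with join-inj {suc p * (2 + cap)} {suc (p + p)} (inj₁ (combine i j)) (inj₂ k) e
  ... | ()
  encKey-inj (inj₂ k) (inj₁ (i , j)) e with join-inj {suc p * (2 + cap)} {suc (p + p)} (inj₂ k) (inj₁ (combine i j)) e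
  ... | ()
  encKey-inj (inj₂ i) (inj₂ k) e = cong inj₂ (SumP.inj₂-injective (join-inj {suc p * (2 + cap)} {suc (p + p)} (inj₂ i) (inj₂ k) e))

  encZone : ZoneColour → Fin (q + 3 * (suc p * (suc p * (2 + cap) + suc (p + p))))
  encZone (inj₁ z)           = join q _ (inj₁ z)
  encZone (inj₂ (l , d , k)) = join q _ (inj₂ (combine l (combine d (encKey k))))

  encZone-inj : ∀ x y → encZone x ≡ encZone y → x ≡ y
  encZone-inj (inj₁ z) (inj₁ z′) e = cong inj₁ (SumP.inj₁-injective (join-inj {q} (inj₁ z) (inj₁ z′) e))
  encZone-inj (inj₁ z) (inj₂ (l , d , k)) e with join-inj {q} (inj₁ z) (inj₂ (combine l (combine d (encKey k)))) e
  ... | ()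
  encZone-inj (inj₂ (l , d , k)) (inj₁ z) e with join-inj {q} (inj₂ (combine l (combine d (encKey k)))) (inj₁ z) e
  ... | ()
  encZone-inj (inj₂ (l , d , k)) (inj₂ (l′ , d′ , k′)) e
    with FinP.combine-injective l _ l′ _ (SumP.inj₂-injective (join-inj {q} (inj₂ (combine l (combine d (encKey k)))) (inj₂ (combine l′ (combine d′ (encKey k′)))) e))
  ... | refl , e₁ with FinP.combine-injective d _ d′ _ e₁
  ...   | refl , e₂ with encKey-inj k k′ e₂
  ...     | refl = refl

  φ : Fin (order G) → Fin N
  φ v = Fin.inject≤ (combine (fromℕ< (m%n<n (layer v) (suc p))) (encZone (zoneColour (zone v)))) enough

  φ-inj : ∀ {u v} → φ u ≡ φ v → layer u % suc p ≡ layer v % suc p × zoneColour (zone u) ≡ zoneColour (zone v)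
  φ-inj {u} {v} e with FinP.combine-injective (fromℕ< (m%n<n (layer u) (suc p))) _ (fromℕ< (m%n<n (layer v) (suc p))) _
                         (FinP.inject≤-injective enough enough _ _ e)
  ... | e₁ , e₂ = FinP.fromℕ<-injective _ _ _ _ e₁ , encZone-inj _ _ e₂

  φ-layer : ∀ {u v} → φ u ≡ φ v → layer u % suc p ≡ layer v % suc p
  φ-layer e = proj₁ (φ-inj e)

  φ-zone : ∀ {u v} → φ u ≡ φ v → zoneColour (zone u) ≡ zoneColour (zone v)
  φ-zone e = proj₂ (φ-inj e)

  zoneColour-inj₁ : ∀ x z → zoneColour x ≡ inj₁ z → x ≡ inj₁ z
  zoneColour-inj₁ (inj₁ z) _ refl = refl

  zoneColour-inj₂ : ∀ w l w′ l′ → zoneColour (inj₂ (w , l)) ≡ zoneColour (inj₂ (w′ , l′)) → l ≡ l′ × SameColor w w′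
  zoneColour-inj₂ w l w′ l′ e with SumP.inj₂-injective e
  ... | e′ = cong proj₁ e′ , FinP.fromℕ<-injective _ _ _ _ (cong (λ z → proj₁ (proj₂ z)) e′) ,
             keyFin-inj _ _ _ _ _ _ _ _ _ _ (cong (λ z → proj₂ (proj₂ z)) e′)

  module _ (S : Subset (order G)) (conn : ConnectedSet G S) (¬many : ¬ p < ∣ colorsOn φ S ∣) where

    few : (f : ℕ → Fin (order G)) → (∀ i → i ≤ p → f i ∈ S) → ¬ (∀ i j → i < j → j ≤ p → φ (f i) ≢ φ (f j))
    few f f∈ d = ¬many (manyColors φ S p f f∈ d)

    path : ∀ {u v} → u ∈ S → v ∈ S → Star (InducedStep G S) u v
    path {u} {v} = proj₂ conn u v

    -- The layer rises by at most one along an edge, so a walk cannot jump over a value.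
    layer-between : ∀ {u v} → u ∈ S → Star (InducedStep G S) u v → ∀ δ → layer u ≤ δ → δ ≤ layer v → ∃ λ x → x ∈ S × layer x ≡ δ
    layer-between {u} u∈ s δ lo hi with m≤n⇒m<n∨m≡n lo
    layer-between {u} u∈ s δ lo hi | inj₂ e = u , u∈ , e
    layer-between u∈ []* δ lo hi | inj₁ lt = contradiction hi (<⇒≱ lt)
    layer-between u∈ ((_ , x∈ , a) ∷* s) δ lo hi | inj₁ lt = layer-between x∈ s δ (≤-trans (layer-adj a) lt) hi

    layer-bound : ∀ {u v} → u ∈ S → v ∈ S → layer v < layer u + suc p
    layer-bound {u} {v} u∈ v∈ with layer v <? layer u + suc p
    ... | yes lt = lt
    ... | no  ge = ⊥-elim (few f f∈ d)
      where
      hit : ∀ i → i ≤ p → ∃ λ x → x ∈ S × layer x ≡ layer u + i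
      hit i i≤ = layer-between u∈ (path u∈ v∈) (layer u + i) (m≤m+n _ _) (≤-trans (+-monoʳ-≤ (layer u) (m≤n⇒m≤1+n i≤)) (≮⇒≥ ge))
      f : ℕ → Fin (order G)
      f i with i ≤? p
      ... | yes i≤ = proj₁ (hit i i≤)
      ... | no  _  = u
      f∈ : ∀ i → i ≤ p → f i ∈ S
      f∈ i i≤ with i ≤? p
      ... | yes i≤′ = proj₁ (proj₂ (hit i i≤′))
      ... | no  ne  = contradiction i≤ ne
      fl : ∀ i → i ≤ p → layer (f i) ≡ layer u + i
      fl i i≤ with i ≤? p
      ... | yes i≤′ = proj₂ (proj₂ (hit i i≤′))
      ... | no  ne  = contradiction i≤ ne
      d : ∀ i j → i < j → j ≤ p → φ (f i) ≢ φ (f j)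
      d i j i<j j≤ e = mod-distinct p _ _ (+-monoʳ-< (layer u) i<j)
        (≤-trans (+-monoʳ-≤ (layer u) (≤-trans j≤ (m≤n+m p i))) (≤-reflexive (sym (+-assoc (layer u) i p))))
        (subst₂ (λ a b → a % suc p ≡ b % suc p) (fl i (≤-trans (<⇒≤ i<j) j≤)) (fl j j≤) (φ-layer e))

    layer-eq : ∀ {u v} → u ∈ S → v ∈ S → φ u ≡ φ v → layer u ≡ layer v
    layer-eq {u} {v} u∈ v∈ e with <-cmp (layer u) (layer v)

    ... | tri≈ _ r _ = r
    ... | tri< lt _ _ = contradiction (φ-layer e) (mod-distinct p _ _ lt
            (ℕ.s≤s⁻¹ (≤-trans (layer-bound u∈ v∈) (≤-reflexive (+-suc (layer u) p)))))
    ... | tri> _ _ lt = contradiction (sym (φ-layer e)) (mod-distinct p _ _ lt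
            (ℕ.s≤s⁻¹ (≤-trans (layer-bound v∈ u∈) (≤-reflexive (+-suc (layer v) p)))))

    comp-eq : ∀ {u v} → Star (InducedStep G S) u v → comp u ≡ comp v
    comp-eq []*                 = refl
    comp-eq ((_ , _ , a) ∷* s) = trans (comp-adj a) (comp-eq s)

    isExc : ∀ v → Dec (∃ λ z → zone v ≡ inj₁ z)
    isExc v with zone v
    ... | inj₁ z = yes (z , refl)
    ... | inj₂ _ = no λ ()

    Unique : Set
    Unique = ∃ λ v → v ∈ S × (∀ u → u ∈ S → φ u ≡ φ v → u ≡ v)

    exceptional : (∃ λ v → v ∈ S × ∃ λ z → zone v ≡ inj₁ z) → Unique
    exceptional (v , v∈ , z , e) = v , v∈ , λ u u∈ e′ →
      zone-inj (comp-eq (path u∈ v∈)) (layer-eq u∈ v∈ e′)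
        (trans (zoneColour-inj₁ (zone u) z (trans (φ-zone e′) (cong zoneColour e))) (sym e))

    module _ (none : ¬ ∃ λ v → v ∈ S × ∃ λ z → zone v ≡ inj₁ z) where

      legged : ∀ {v} → v ∈ S → ∃ λ l → zone v ≡ inj₂ (wd v , l)
      legged {v} v∈ with zone v in e
      ... | inj₁ z       = contradiction (v , v∈ , z , e) none
      ... | inj₂ (w , l) = l , refl

      same-parts : ∀ {u v} (u∈ : u ∈ S) (v∈ : v ∈ S) → φ u ≡ φ v → proj₁ (legged u∈) ≡ proj₁ (legged v∈) × SameColor (wd u) (wd v)
      same-parts {u} {v} u∈ v∈ e = zoneColour-inj₂ (wd u) _ (wd v) _
        (trans (sym (cong zoneColour (proj₂ (legged u∈)))) (trans (φ-zone e) (cong zoneColour (proj₂ (legged v∈)))))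

      shortest : ∀ m v → v ∈ S → len (wd v) ≤ m → ∃ λ x → x ∈ S × (∀ y → y ∈ S → len (wd x) ≤ len (wd y))
      shortest m v v∈ le with FinP.any? (λ y → (y SubP.∈? S) ×-dec (len (wd y) <? len (wd v)))
      ... | no ne = v , v∈ , λ y y∈ → ≮⇒≥ λ lt → ne (y , y∈ , lt)
      shortest zero v v∈ le | yes (y , y∈ , lt) = contradiction (<-≤-trans lt le) λ ()
      shortest (suc m) v v∈ le | yes (y , y∈ , lt) = shortest m y y∈ (ℕ.s≤s⁻¹ (≤-trans lt le))

      nestedS : ∀ {u v} → InducedStep G S u v → ∀ {w} → w ⊑ wd u → w ⊑ wd v ⊎ ∃ λ k → ∂ w k ≡ just (wd v)
      nestedS (u∈ , v∈ , a) = nested a (proj₂ (legged u∈)) (proj₂ (legged v∈))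

      -- All words extend a shortest one: leaving its region would lead through a border part, whose
      -- word is shorter by `∂-len`. The part found by `center` may hold several vertices of the
      -- set, but the colour also fixes the leg and, within the set, the layer.
      ordinary : Unique
      ordinary with shortest _ (proj₁ (proj₁ conn)) (proj₂ (proj₁ conn)) ≤-refl
      ... | s , s∈ , short with Center.center p cap p<2^cap wd S (wd s) (s , s∈ , refl) (λ v v∈ → ext here (path s∈ v∈)) cross few′
        where
        ext : ∀ {u v} → wd s ⊑ wd u → Star (InducedStep G S) u v → wd s ⊑ wd v
        ext l []* = l
        ext l (st@(_ , y∈ , _) ∷* p′) with nestedS st l
        ... | inj₁ l′      = ext l′ p′
        ... | inj₂ (k , e) = contradiction (short _ y∈) (<⇒≱ (∂-len (wd s) k e))
        leave : ∀ {x y w} → w ⊑ wd x → ¬ (w ⊑ wd y) → Star (InducedStep G S) x y → ∃ λ k → ∃ λ v → v ∈ S × ∂ w k ≡ just (wd v)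
        leave l ¬l []* = contradiction l ¬l
        leave l ¬l (_∷*_ {j = z} st@(_ , z∈ , _) p′) with nestedS st l
        ... | inj₁ l′      = leave l′ ¬l p′
        ... | inj₂ (k , e) = k , z , z∈ , e
        cross : ∀ u i → wd s ⊑ u → (∃ λ v → v ∈ S × (u ∙ i) ⊑ wd v) → ∃ λ k → ∃ λ v → v ∈ S × ∂ (u ∙ i) k ≡ just (wd v)
        cross u i l (v , v∈ , l′) = leave l′ (λ b → contradiction (≤-trans (⊑-len b) (⊑-len l)) 1+n≰n) (path v∈ s∈)
        few′ : (f : ℕ → Fin (order G)) → (∀ i → i ≤ p → f i ∈ S) → ¬ (∀ i j → i < j → j ≤ p → ¬ SameColor (wd (f i)) (wd (f j)))
        few′ f f∈ d = few f f∈ λ i j i<j j≤ e → d i j i<j j≤ (proj₂ (same-parts (f∈ i (≤-trans (<⇒≤ i<j) j≤)) (f∈ j j≤) e))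
      ...   | v , v∈ , uniq = v , v∈ , λ u u∈ e → zone-inj (comp-eq (path u∈ v∈)) (layer-eq u∈ v∈ e)
              (trans (proj₂ (legged u∈)) (trans (cong₂ (λ a b → inj₂ (a , b)) (uniq u u∈ (proj₂ (same-parts u∈ v∈ e))) (proj₁ (same-parts u∈ v∈ e)))
                (sym (proj₂ (legged v∈)))))

    unique : Unique
    unique with FinP.any? (λ v → (v SubP.∈? S) ×-dec isExc v)
    ... | yes h = exceptional h
    ... | no  h = ordinary h

  centered : IsCentered G p φ
  centered S conn with p <? ∣ colorsOn φ S ∣
  ... | yes many = inj₁ many
  ... | no ¬many with unique S conn ¬many
  ...   | v , v∈ , u = inj₂ (uniqueColor φ S v∈ u)

-- Triangulated polygons and rooted forests

-- A triangulated polygon with corners among the positions i, …, j: tri k l r has the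
-- triangle (i , k , j) behind the side (i , j).
data Tri : ℕ → ℕ → Set where
  leaf : ∀ {i j} → Tri i j
  tri  : ∀ {i j} k → i < k → k < j → Tri i k → Tri k j → Tri i j

Corner : ∀ {i j} → ℕ → Tri i j → Set
Corner {i} {j} p leaf   = p ≡ i ⊎ p ≡ j
Corner p (tri k _ _ l r) = Corner p l ⊎ Corner p r

Vertex : ℕ → ℕ → ℕ → ℕ → Set
Vertex p i k j = p ≡ i ⊎ p ≡ k ⊎ p ≡ j

Linked : ∀ {i j} → ℕ → ℕ → Tri i j → Set
Linked p q leaf = ⊥
Linked {i} {j} p q (tri k _ _ l r) = (Vertex p i k j × Vertex q i k j) ⊎ Linked p q l ⊎ Linked p q r

NonLeaf : ∀ {i j} → Tri i j → Set
NonLeaf leaf = ⊥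
NonLeaf (tri _ _ _ _ _) = ⊤

size : ∀ {i j} → Tri i j → ℕ
size leaf = 0
size (tri k _ _ l r) = suc (size l + size r)

corner-left : ∀ {i j} (t : Tri i j) → Corner i t
corner-left leaf = inj₁ refl
corner-left (tri k _ _ l r) = inj₁ (corner-left l)

corner-right : ∀ {i j} (t : Tri i j) → Corner j t
corner-right leaf = inj₂ refl
corner-right (tri k _ _ l r) = inj₂ (corner-right r)

corner-bounds : ∀ {i j p} (t : Tri i j) → i ≤ j → Corner p t → i ≤ p × p ≤ j
corner-bounds leaf le (inj₁ refl) = ≤-refl , le
corner-bounds leaf le (inj₂ refl) = le , ≤-refl
corner-bounds (tri k a b l r) le (inj₁ c) with corner-bounds l (<⇒≤ a) c
... | x , y = x , ≤-trans y (<⇒≤ b)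
corner-bounds (tri k a b l r) le (inj₂ c) with corner-bounds r (<⇒≤ b) c
... | x , y = ≤-trans (<⇒≤ a) x , y

linked-corner : ∀ {i j p q} (t : Tri i j) → Linked p q t → Corner p t × Corner q t
linked-corner {i} {j} (tri k a b l r) (inj₁ (vp , vq)) = f vp , f vq
  where
  f : ∀ {x} → Vertex x i k j → Corner x l ⊎ Corner x r
  f (inj₁ refl) = inj₁ (corner-left l)
  f (inj₂ (inj₁ refl)) = inj₁ (corner-right l)
  f (inj₂ (inj₂ refl)) = inj₂ (corner-right r)
linked-corner (tri k a b l r) (inj₂ (inj₁ x)) with linked-corner l x
... | y , z = inj₁ y , inj₁ z
linked-corner (tri k a b l r) (inj₂ (inj₂ x)) with linked-corner r x
... | y , z = inj₂ y , inj₂ z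

-- Removing a triangle (a , k , b) leaves the two pieces behind it and the rest u.
data Split : ∀ {i j} → Tri i j → ∀ a k b → Tri a k → Tri k b → Tri i j → Set where
  here : ∀ {i j k x y} {l : Tri i k} {r : Tri k j} → Split (tri k x y l r) i k j l r leaf
  inL  : ∀ {i j k x y} {l : Tri i k} {r : Tri k j} {a m b l′ r′ u} →
         Split l a m b l′ r′ u → Split (tri k x y l r) a m b l′ r′ (tri k x y u r)
  inR  : ∀ {i j k x y} {l : Tri i k} {r : Tri k j} {a m b l′ r′ u} →
         Split r a m b l′ r′ u → Split (tri k x y l r) a m b l′ r′ (tri k x y l u)

module _ where
  private
    variable
      i j a k b p q : ℕ
      t u : Tri i j
      l : Tri a k
      r : Tri k b

  split-order : Split t a k b l r u → a < k × k < b
  split-order (here {x = x} {y}) = x , y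
  split-order (inL s) = split-order s
  split-order (inR s) = split-order s

  split-bounds : {t : Tri i j} → Split t a k b l r u → i ≤ a × b ≤ j
  split-bounds here = ≤-refl , ≤-refl
  split-bounds (inL {y = y} s) with split-bounds s
  ... | c , d = c , ≤-trans d (<⇒≤ y)
  split-bounds (inR {x = x} s) with split-bounds s
  ... | c , d = ≤-trans (<⇒≤ x) c , d

  split-leaf : {t : Tri i j} {u : Tri i j} → Split t a k b l r u → u ≡ leaf → i ≡ a × j ≡ b
  split-leaf here _ = refl , refl
  split-leaf (inL s) ()
  split-leaf (inR s) ()

  split-size : {t : Tri i j} {l : Tri a k} {r : Tri k b} {u : Tri i j} →
    Split t a k b l r u → size l < size t × size r < size t × size u < size t
  split-size {l = l} {r} here = s≤s (m≤m+n _ _) , s≤s (m≤n+m _ _) , s≤s z≤n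
  split-size (inL {r = r} s) with split-size s
  ... | x , y , z = ≤-trans x (≤-trans (m≤m+n _ _) (n≤1+n _)) , ≤-trans y (≤-trans (m≤m+n _ _) (n≤1+n _)) , s≤s (+-monoˡ-< (size r) z)
  split-size (inR {l = l} s) with split-size s
  ... | x , y , z = ≤-trans x (≤-trans (m≤n+m _ _) (n≤1+n _)) , ≤-trans y (≤-trans (m≤n+m _ _) (n≤1+n _)) , s≤s (+-monoʳ-< (size l) z)

  corner-l : Split t a k b l r u → Corner p l → Corner p t
  corner-l here c = inj₁ c
  corner-l (inL s) c = inj₁ (corner-l s c)
  corner-l (inR s) c = inj₂ (corner-l s c)

  corner-r : Split t a k b l r u → Corner p r → Corner p t
  corner-r here c = inj₂ c
  corner-r (inL s) c = inj₁ (corner-r s c)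
  corner-r (inR s) c = inj₂ (corner-r s c)

  corner-u : {t : Tri i j} → Split t a k b l r u → Corner p u → Corner p t
  corner-u (here {l = l}) (inj₁ refl) = inj₁ (corner-left l)
  corner-u (here {r = r}) (inj₂ refl) = inj₂ (corner-right r)
  corner-u (inL s) (inj₁ c) = inj₁ (corner-u s c)
  corner-u (inL s) (inj₂ c) = inj₂ c
  corner-u (inR s) (inj₁ c) = inj₁ c
  corner-u (inR s) (inj₂ c) = inj₂ (corner-u s c)

  corner-u-out : {t : Tri i j} → i ≤ j → Split t a k b l r u → Corner p u → p ≤ a ⊎ b ≤ p
  corner-u-out le here (inj₁ refl) = inj₁ ≤-refl
  corner-u-out le here (inj₂ refl) = inj₂ ≤-refl
  corner-u-out le (inL {x = x} s) (inj₁ c) = corner-u-out (<⇒≤ x) s c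
  corner-u-out le (inL {y = y} {r = r} s) (inj₂ c) = inj₂ (≤-trans (proj₂ (split-bounds s)) (proj₁ (corner-bounds r (<⇒≤ y) c)))
  corner-u-out le (inR {x = x} {l = l} s) (inj₁ c) = inj₁ (≤-trans (proj₂ (corner-bounds l (<⇒≤ x) c)) (proj₁ (split-bounds s)))
  corner-u-out le (inR {y = y} s) (inj₂ c) = corner-u-out (<⇒≤ y) s c

  corner-split : Split t a k b l r u → Corner p t → Corner p l ⊎ Corner p r ⊎ Corner p u
  corner-split here (inj₁ c) = inj₁ c
  corner-split here (inj₂ c) = inj₂ (inj₁ c)
  corner-split (inL s) (inj₂ c) = inj₂ (inj₂ (inj₂ c))
  corner-split (inL s) (inj₁ c) with corner-split s c
  ... | inj₁ d = inj₁ d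
  ... | inj₂ (inj₁ d) = inj₂ (inj₁ d)
  ... | inj₂ (inj₂ d) = inj₂ (inj₂ (inj₁ d))
  corner-split (inR s) (inj₁ c) = inj₂ (inj₂ (inj₁ c))
  corner-split (inR s) (inj₂ c) with corner-split s c
  ... | inj₁ d = inj₁ d
  ... | inj₂ (inj₁ d) = inj₂ (inj₁ d)
  ... | inj₂ (inj₂ d) = inj₂ (inj₂ (inj₂ d))

  linked-split : Split t a k b l r u → Linked p q t → Vertex q a k b ⊎ Linked p q l ⊎ Linked p q r ⊎ Linked p q u
  linked-split here (inj₁ (_ , v)) = inj₁ v
  linked-split here (inj₂ (inj₁ c)) = inj₂ (inj₁ c)
  linked-split here (inj₂ (inj₂ c)) = inj₂ (inj₂ (inj₁ c))
  linked-split (inL s) (inj₁ v) = inj₂ (inj₂ (inj₂ (inj₁ v)))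
  linked-split (inL s) (inj₂ (inj₂ c)) = inj₂ (inj₂ (inj₂ (inj₂ (inj₂ c))))
  linked-split (inL s) (inj₂ (inj₁ c)) with linked-split s c
  ... | inj₁ d = inj₁ d
  ... | inj₂ (inj₁ d) = inj₂ (inj₁ d)
  ... | inj₂ (inj₂ (inj₁ d)) = inj₂ (inj₂ (inj₁ d))
  ... | inj₂ (inj₂ (inj₂ d)) = inj₂ (inj₂ (inj₂ (inj₂ (inj₁ d))))
  linked-split (inR s) (inj₁ v) = inj₂ (inj₂ (inj₂ (inj₁ v)))
  linked-split (inR s) (inj₂ (inj₁ c)) = inj₂ (inj₂ (inj₂ (inj₂ (inj₁ c))))
  linked-split (inR s) (inj₂ (inj₂ c)) with linked-split s c
  ... | inj₁ d = inj₁ d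
  ... | inj₂ (inj₁ d) = inj₂ (inj₁ d)
  ... | inj₂ (inj₂ (inj₁ d)) = inj₂ (inj₂ (inj₁ d))
  ... | inj₂ (inj₂ (inj₂ d)) = inj₂ (inj₂ (inj₂ (inj₂ (inj₂ d))))

leaf-or : ∀ {i j} (t : Tri i j) → t ≡ leaf ⊎ NonLeaf t
leaf-or leaf = inj₁ refl
leaf-or (tri _ _ _ _ _) = inj₂ tt

-- With cls a monotone labelling of the corners by 0, …, 3, one looks for a triangle none
-- of whose three pieces contains two of the three jumps of cls.
module Find (cls : ℕ → ℕ) where

  record Found {i j} (t : Tri i j) : Set where
    constructor found
    field
      {a k b} : ℕ
      {l} : Tri a k
      {r} : Tri k b
      {u} : Tri i j
      split : Split t a k b l r u
      okL   : NonLeaf l → cls k ≤ suc (cls a)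
      okR   : NonLeaf r → cls b ≤ suc (cls k)

  private
    test : ∀ {a b} (t : Tri a b) → (NonLeaf t × 2 + cls a ≤ cls b) ⊎ (NonLeaf t → cls b ≤ suc (cls a))
    test {a} {b} leaf = inj₂ λ ()
    test {a} {b} (tri _ _ _ _ _) with 2 + cls a ≤? cls b
    ... | yes le = inj₁ (tt , le)
    ... | no nle = inj₂ λ _ → ℕ.s≤s⁻¹ (≰⇒> nle)

  -- The descent enters a piece only while it holds at least two jumps. Where it stops, the inner
  -- pieces that are not leaves hold at most one each, and the gap between a and b takes two of the
  -- three jumps away from the outer rest.
  find : ∀ {i j} (t : Tri i j) → NonLeaf t → 2 + cls i ≤ cls j → Σ (Found t) λ F → 2 + cls (Found.a F) ≤ cls (Found.b F)
  find (tri k x y l r) _ h with test l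
  find (tri k x y l r) _ h | inj₁ (nl , le) with find l nl le
  ... | found s o₁ o₂ , le′ = found (inL s) o₁ o₂ , le′
  find (tri k x y l r) _ h | inj₂ o₁ with test r
  ... | inj₂ o₂ = found here o₁ o₂ , h
  ... | inj₁ (nr , le) with find r nr le
  ...   | found s o₃ o₂ , le′ = found (inR s) o₃ o₂ , le′

  -- For the whole polygon no gap can be assumed; if the search stops there at once, the rest
  -- outside the triangle is a leaf.
  findTop : ∀ {i j} (t : Tri i j) → NonLeaf t →
    Σ (Found t) λ F → Found.u F ≡ leaf ⊎ 2 + cls (Found.a F) ≤ cls (Found.b F)
  findTop (tri k x y l r) _ with test l
  findTop (tri k x y l r) _ | inj₁ (nl , le) with find l nl le
  ... | found s o₁ o₂ , le′ = found (inL s) o₁ o₂ , inj₂ le′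
  findTop (tri k x y l r) _ | inj₂ o₁ with test r
  ... | inj₂ o₂ = found here o₁ o₂ , inj₁ refl
  ... | inj₁ (nr , le) with find r nr le
  ...   | found s o₃ o₂ , le′ = found (inR s) o₃ o₂ , inj₂ le′

module Forest {V : ℕ} (par : Fin V → Fin V) (lev : Fin V → ℕ) (lev-par : ∀ v m → lev v ≡ suc m → lev (par v) ≡ m) where

  up : ℕ → Fin V → Fin V
  up zero    v = v
  up (suc m) v = up m (par v)

  -- Ancestry as one equation is decidable at once and makes two ancestors of equal level coincide.
  -- At most `lev v` steps are taken, so the arbitrary value of `par` at level 0 does not enter.
  Anc : Fin V → Fin V → Set
  Anc y v = up (lev v ∸ lev y) v ≡ y

  anc? : ∀ y v → Dec (Anc y v)
  anc? y v = up (lev v ∸ lev y) v Fin.≟ y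

  anc-refl : ∀ v → Anc v v
  anc-refl v rewrite n∸n≡0 (lev v) = refl

  anc-lev : ∀ {y v} → Anc y v → lev y ≤ lev v
  anc-lev {y} {v} a with lev y ≤? lev v
  ... | yes le = le
  ... | no nle = ≤-reflexive (cong lev (trans (sym a) (cong (λ d → up d v) (m≤n⇒m∸n≡0 (<⇒≤ (≰⇒> nle))))))

  anc-par : ∀ {y v} → Anc y v → y ≢ v → ∃ λ m → lev v ≡ suc m × Anc y (par v)
  anc-par {y} {v} a ne = go (lev v ∸ lev y) refl a
    where
    shift : ∀ m n d → suc m ∸ n ≡ suc d → m ∸ n ≡ d
    shift m       zero    d e = suc-injective e
    shift zero    (suc n) d e = contradiction (trans (sym (0∸n≡0 n)) e) λ ()
    shift (suc m) (suc n) d e = shift m n d e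
    go : ∀ d → lev v ∸ lev y ≡ d → up d v ≡ y → ∃ λ m → lev v ≡ suc m × Anc y (par v)
    go zero    _ b = contradiction (sym b) ne
    go (suc d) e b = at (lev v) refl
      where
      at : ∀ l → lev v ≡ l → ∃ λ m → lev v ≡ suc m × Anc y (par v)
      at zero    q = contradiction (trans (sym (0∸n≡0 (lev y))) (trans (cong (_∸ lev y) (sym q)) e)) λ ()
      at (suc m) q = m , q , trans (cong (λ x → up x (par v)) (trans (cong (_∸ lev y) (lev-par v m q))
                       (shift m (lev y) d (trans (cong (_∸ lev y) (sym q)) e)))) b

  anc-step : ∀ {y v m} → lev v ≡ suc m → Anc y (par v) → Anc y v
  anc-step {y} {v} {m} e a = trans (cong (λ d → up d v)
    (trans (cong (_∸ lev y) (trans e (cong suc (sym (lev-par v m e))))) (+-∸-assoc 1 (anc-lev a)))) a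

  anc-parent : ∀ {v m} → lev v ≡ suc m → Anc (par v) v
  anc-parent {v} e = anc-step e (anc-refl (par v))

  anc-trans : ∀ {x y v} → Anc x y → Anc y v → Anc x v
  anc-trans {x} {y} {v} a b = go (lev v) v ≤-refl b
    where
    go : ∀ m v → lev v ≤ m → Anc y v → Anc x v
    go m v le b with y Fin.≟ v
    ... | yes refl = a
    ... | no ne with anc-par b ne
    go zero v le b | no ne | l , e , b′ = contradiction (≤-trans (≤-reflexive (sym e)) le) λ ()
    go (suc m) v le b | no ne | l , e , b′ =
      anc-step e (go m (par v) (≤-trans (≤-reflexive (lev-par v l e)) (ℕ.s≤s⁻¹ (≤-trans (≤-reflexive (sym e)) le))) b′)

  anc-unique : ∀ {x y v} → Anc x v → Anc y v → lev x ≡ lev y → x ≡ y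
  anc-unique {x} {y} {v} a b e = trans (sym a) (trans (cong (λ l → up (lev v ∸ l) v) e) b)

-- Splitting a polygon into nested regions

⊑-compare : ∀ {x y z} → x ⊑ z → y ⊑ z → len x ≤ len y → x ⊑ y
⊑-compare here here _ = here
⊑-compare here (there q) le = contradiction (≤-trans le (⊑-len q)) 1+n≰n
⊑-compare (there p) here _ = there p
⊑-compare (there p) (there q) le = ⊑-compare p q le

⊑-letter : ∀ {w i j z} → (w ∙ i) ⊑ z → (w ∙ j) ⊑ z → i ≡ j
⊑-letter p q with ⊑-compare p q ≤-refl
... | here    = refl
... | there r = contradiction (⊑-len r) 1+n≰n

⊑-strict : ∀ {w v} → w ⊑ v → w ≢ v → len w < len v
⊑-strict here ne = contradiction refl ne
⊑-strict (there p) ne = s≤s (⊑-len p)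

-- The classes 0, 1, 2, 3 of a cyclic sequence with at most three changes of label;
-- the first and the last class carry the same label.
base : Fin 4 → Fin 3
base zero = zero
base 1F = 1F
base 2F = 2F
base 3F = zero

nxt prv : Fin 3 → Fin 3
nxt zero = 1F
nxt 1F = 2F
nxt 2F = zero
prv zero = 2F
prv 1F = zero
prv 2F = 1F

-- The label opposite to the outer piece of a triangle with classes c ≤ d ≤ e: the
-- class d, clamped between c+1 and e−1 whenever these two are in order.
mid : Fin 4 → Fin 4 → Fin 4 → Fin 3
mid zero d 2F = 1F
mid zero zero 3F = 1F
mid zero 1F 3F = 1F
mid zero 2F 3F = 2F
mid zero 3F 3F = 2F
mid 1F d 3F = 2F
mid c d e = base d

-- For the new part to take the place of an old one, each piece must miss a label: the left piece
-- misses `nxt`, the right one `prv`, and the outer rest the clamped label itself. These labels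
-- differ, so the pieces receive different letters. All cases are checked by evaluation.
mid-l : ∀ c d e → toℕ c ≤ toℕ d → toℕ d ≤ toℕ e → toℕ d ≤ suc (toℕ c) →
  ∀ x → toℕ c ≤ toℕ x → toℕ x ≤ toℕ d → base x ≢ nxt (mid c d e)
mid-l = toWitness {a? = FinP.all? λ c → FinP.all? λ d → FinP.all? λ e → (toℕ c ≤? toℕ d) →-dec ((toℕ d ≤? toℕ e) →-dec
  ((toℕ d ≤? suc (toℕ c)) →-dec (FinP.all? λ x → (toℕ c ≤? toℕ x) →-dec ((toℕ x ≤? toℕ d) →-dec ¬? (base x Fin.≟ nxt (mid c d e))))))} tt

mid-r : ∀ c d e → toℕ c ≤ toℕ d → toℕ d ≤ toℕ e → toℕ e ≤ suc (toℕ d) →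
  ∀ x → toℕ d ≤ toℕ x → toℕ x ≤ toℕ e → base x ≢ prv (mid c d e)
mid-r = toWitness {a? = FinP.all? λ c → FinP.all? λ d → FinP.all? λ e → (toℕ c ≤? toℕ d) →-dec ((toℕ d ≤? toℕ e) →-dec
  ((toℕ e ≤? suc (toℕ d)) →-dec (FinP.all? λ x → (toℕ d ≤? toℕ x) →-dec ((toℕ x ≤? toℕ e) →-dec ¬? (base x Fin.≟ prv (mid c d e))))))} tt

mid-u : ∀ c d e → toℕ c ≤ toℕ d → toℕ d ≤ toℕ e → 2 + toℕ c ≤ toℕ e →
  ∀ x → (toℕ x ≤ toℕ c ⊎ toℕ e ≤ toℕ x) → base x ≢ mid c d e
mid-u = toWitness {a? = FinP.all? λ c → FinP.all? λ d → FinP.all? λ e → (toℕ c ≤? toℕ d) →-dec ((toℕ d ≤? toℕ e) →-dec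
  ((2 + toℕ c ≤? toℕ e) →-dec (FinP.all? λ x → ((toℕ x ≤? toℕ c) ⊎-dec (toℕ e ≤? toℕ x)) →-dec ¬? (base x Fin.≟ mid c d e))))} tt

third-unique : ∀ x y k → x ≢ y → k ≢ x → k ≢ y → k ≡ third x y
third-unique = toWitness {a? = FinP.all? λ x → FinP.all? λ y → FinP.all? λ k →
  ¬? (x Fin.≟ y) →-dec (¬? (k Fin.≟ x) →-dec (¬? (k Fin.≟ y) →-dec (k Fin.≟ third x y)))} tt

third-≢₁ : ∀ x y → x ≢ y → third x y ≢ x
third-≢₁ x y ne = proj₁ (third-≢ x y (≢-sym ne))

third-≢₂ : ∀ x y → x ≢ y → third x y ≢ y
third-≢₂ x y ne = proj₂ (third-≢ x y (≢-sym ne))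

base-suc : ∀ x y → toℕ y ≡ suc (toℕ x) → base y ≢ base x
base-suc = toWitness {a? = FinP.all? λ x → FinP.all? λ y → (toℕ y ℕ.≟ suc (toℕ x)) →-dec ¬? (base y Fin.≟ base x)} tt

perm : Fin 3 → Fin 3 → Fin 3 → Fin 3 → Fin 3
perm x y z zero = x
perm x y z 1F = y
perm x y z 2F = z

perm-inj : ∀ {x y z} → x ≢ y → y ≢ z → x ≢ z → ∀ {i j} → perm x y z i ≡ perm x y z j → i ≡ j
perm-inj a b c {zero} {zero} e = refl
perm-inj a b c {zero} {1F} e = contradiction e a
perm-inj a b c {zero} {2F} e = contradiction e c
perm-inj a b c {1F} {zero} e = contradiction (sym e) a
perm-inj a b c {1F} {1F} e = refl
perm-inj a b c {1F} {2F} e = contradiction e b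
perm-inj a b c {2F} {zero} e = contradiction (sym e) c
perm-inj a b c {2F} {1F} e = contradiction (sym e) b
perm-inj a b c {2F} {2F} e = refl

data Piece : Set where
  L R U : Piece

slot : Fin 3 → Piece → Fin 3
slot m L = nxt m
slot m R = prv m
slot m U = m

slot-inj : ∀ m {c d} → slot m c ≡ slot m d → c ≡ d
slot-inj m {L} {L} e = refl
slot-inj m {R} {R} e = refl
slot-inj m {U} {U} e = refl
slot-inj m {L} {R} e = ⊥-elim (ne m e)
  where ne : ∀ m → nxt m ≢ prv m
        ne = toWitness {a? = FinP.all? λ m → ¬? (nxt m Fin.≟ prv m)} tt
slot-inj m {R} {L} e = ⊥-elim (ne m e)
  where ne : ∀ m → prv m ≢ nxt m
        ne = toWitness {a? = FinP.all? λ m → ¬? (prv m Fin.≟ nxt m)} tt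
slot-inj m {L} {U} e = ⊥-elim (ne m e)
  where ne : ∀ m → nxt m ≢ m
        ne = toWitness {a? = FinP.all? λ m → ¬? (nxt m Fin.≟ m)} tt
slot-inj m {U} {L} e = ⊥-elim (ne m e)
  where ne : ∀ m → m ≢ nxt m
        ne = toWitness {a? = FinP.all? λ m → ¬? (m Fin.≟ nxt m)} tt
slot-inj m {R} {U} e = ⊥-elim (ne m e)
  where ne : ∀ m → prv m ≢ m
        ne = toWitness {a? = FinP.all? λ m → ¬? (prv m Fin.≟ m)} tt
slot-inj m {U} {R} e = ⊥-elim (ne m e)
  where ne : ∀ m → m ≢ prv m
        ne = toWitness {a? = FinP.all? λ m → ¬? (m Fin.≟ prv m)} tt

module Region {V : ℕ} (par : Fin V → Fin V) (lev : Fin V → ℕ) (lev-par : ∀ v m → lev v ≡ suc m → lev (par v) ≡ m)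
  (s : ℕ → Fin V) (last : ℕ) (Z : Fin V → Bool)
  (interval : ∀ {y p q r} → Z y ≡ false → p ≤ q → q ≤ r → r ≤ last →
    Forest.Anc par lev lev-par y (s p) → Forest.Anc par lev lev-par y (s r) → Forest.Anc par lev lev-par y (s q)) where

  open Forest par lev lev-par

  -- `nothing` is a free vertex, `just nothing` one on the outer border, `just (just w)` one in the
  -- part `w`.
  Taken : Set
  Taken = Fin V → Maybe (Maybe Word)

  -- The Sperner label of a corner: the part at which its path to the root first arrives. A path
  -- that meets no taken vertex counts as arriving at the outer border.
  footN : Taken → ℕ → Fin V → Maybe Word
  footN A m v with A v
  footN A m       v | just P  = P
  footN A zero    v | nothing = nothing
  footN A (suc m) v | nothing = footN A m (par v)

  foot : Taken → Fin V → Maybe Word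
  foot A v = footN A (lev v) v

  full : Taken → (ℕ → Word × Fin 3) → ℕ → Maybe Word
  full A f p with A (s p)
  ... | just P  = P
  ... | nothing = just (proj₁ (f p))

  full-taken : ∀ A f p {P} → A (s p) ≡ just P → full A f p ≡ P
  full-taken A f p e rewrite e = refl

  full-free : ∀ A f p → A (s p) ≡ nothing → full A f p ≡ just (proj₁ (f p))
  full-free A f p e rewrite e = refl

  footN-taken : ∀ A m v {P} → A v ≡ just P → footN A m v ≡ P
  footN-taken A zero    v e rewrite e = refl
  footN-taken A (suc m) v e rewrite e = refl

  footN-zero : ∀ A v → A v ≡ nothing → footN A zero v ≡ nothing
  footN-zero A v e rewrite e = refl

  footN-suc : ∀ A m v → A v ≡ nothing → footN A (suc m) v ≡ footN A m (par v)
  footN-suc A m v e rewrite e = refl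

  -- By `closed` descendants of free vertices are free, and by `clear` exceptional vertices are
  -- taken, so `interval` applies to every free vertex. A monotone `cls` with `lab` says that the
  -- labels along the polygon change at most three times; `σ` assigns them to the slots of `∂ w`.
  record Inv {i j} (t : Tri i j) (w : Word) (A : Taken) : Set where
    field
      closed : ∀ v m → lev v ≡ suc m → A (par v) ≡ nothing → A v ≡ nothing
      clear  : ∀ y → A y ≡ nothing → Z y ≡ false
      σ      : Fin 3 → Fin 3
      σ-inj  : ∀ {x y} → σ x ≡ σ y → x ≡ y
      cls    : ℕ → Fin 4
      mono   : ∀ p q → Corner p t → Corner q t → p ≤ q → toℕ (cls p) ≤ toℕ (cls q)
      lab    : ∀ p → Corner p t → foot A (s p) ≡ ∂ w (σ (base (cls p)))

  -- Here `f` has meaning at free corners only. The walk may visit a vertex repeatedly, hence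
  -- `cons`; `compat` is the form of `nested` that survives gluing.
  record Res {i j} (t : Tri i j) (w : Word) (A : Taken) : Set where
    field
      f      : ℕ → Word × Fin 3
      ext    : ∀ p → Corner p t → A (s p) ≡ nothing → w ⊑ proj₁ (f p)
      cons   : ∀ p q → Corner p t → Corner q t → A (s p) ≡ nothing → s p ≡ s q → f p ≡ f q
      inj    : ∀ p q → Corner p t → Corner q t → A (s p) ≡ nothing → A (s q) ≡ nothing →
               f p ≡ f q → lev (s p) ≡ lev (s q) → s p ≡ s q
      compat : ∀ p q → Linked p q t → A (s q) ≡ nothing → ∀ {w′} → w ⊑ w′ → w′ ⊑ proj₁ (f q) →
               (A (s p) ≡ nothing × w′ ⊑ proj₁ (f p)) ⊎ ∃ λ x → ∂ w′ x ≡ full A f p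

  res-leaf : ∀ {i j} {t : Tri i j} {w A} → t ≡ leaf → A (s i) ≢ nothing → A (s j) ≢ nothing → Res t w A
  res-leaf {i} {j} {t} {w} {A} refl ti tj = record
    { f = λ _ → w , zero
    ; ext = λ p c e → contradiction e (taken c)
    ; cons = λ p q c _ e → contradiction e (taken c)
    ; inj = λ p q c _ e → contradiction e (taken c)
    ; compat = λ p q () }
    where
    taken : ∀ {p} → Corner p (leaf {i} {j}) → A (s p) ≢ nothing
    taken (inj₁ refl) = ti
    taken (inj₂ refl) = tj

  module Step {i j} {t : Tri i j} {w : Word} {A : Taken} (I : Inv t w A) (i≤j : i ≤ j) (j≤ : j ≤ last)
    {a k b} {l : Tri a k} {r : Tri k b} {u : Tri i j} (S : Split t a k b l r u) where

    open Inv I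

    a<k : a < k
    a<k = proj₁ (split-order S)
    k<b : k < b
    k<b = proj₂ (split-order S)
    b≤j : b ≤ j
    b≤j = proj₂ (split-bounds S)
    b≤last : b ≤ last
    b≤last = ≤-trans b≤j j≤
    k≤last : k ≤ last
    k≤last = ≤-trans (<⇒≤ k<b) b≤last

    M : Fin V → Set
    M x = Anc x (s a) ⊎ Anc x (s k) ⊎ Anc x (s b)

    M? : ∀ x → Dec (M x)
    M? x = anc? x (s a) ⊎-dec (anc? x (s k) ⊎-dec anc? x (s b))

    M-vertex : ∀ {x p} → Vertex p a k b → Anc x (s p) → M x
    M-vertex (inj₁ refl) z = inj₁ z
    M-vertex (inj₂ (inj₁ refl)) z = inj₂ (inj₁ z)
    M-vertex (inj₂ (inj₂ refl)) z = inj₂ (inj₂ z)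

    M-up : ∀ {x y} → Anc x y → M y → M x
    M-up a (inj₁ z) = inj₁ (anc-trans a z)
    M-up a (inj₂ (inj₁ z)) = inj₂ (inj₁ (anc-trans a z))
    M-up a (inj₂ (inj₂ z)) = inj₂ (inj₂ (anc-trans a z))

    abstract
      A′ : Taken
      A′ x with A x | M? x
      ... | just P  | _     = just P
      ... | nothing | yes _ = just (just w)
      ... | nothing | no _  = nothing

      A′-free : ∀ x → A′ x ≡ nothing → A x ≡ nothing × ¬ M x
      A′-free x e with A x | M? x
      ... | nothing | no ¬m = refl , ¬m

      A′-intro : ∀ x → A x ≡ nothing → ¬ M x → A′ x ≡ nothing
      A′-intro x e ¬m with A x | M? x
      ... | nothing | no _  = refl
      ... | nothing | yes m = contradiction m ¬m

      A′-old : ∀ x {P} → A x ≡ just P → A′ x ≡ just P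
      A′-old x e with A x | M? x
      A′-old x refl | just P | _ = refl

      A′-new : ∀ x → A x ≡ nothing → M x → A′ x ≡ just (just w)
      A′-new x e m with A x | M? x
      ... | nothing | yes _ = refl
      ... | nothing | no ¬m = contradiction m ¬m

    vertex-taken : ∀ {p} → Vertex p a k b → A′ (s p) ≢ nothing
    vertex-taken {p} v e = proj₂ (A′-free (s p) e) (M-vertex v (anc-refl (s p)))

    closed′ : ∀ v m → lev v ≡ suc m → A′ (par v) ≡ nothing → A′ v ≡ nothing
    closed′ v m e h with A′-free (par v) h
    ... | x , ¬m = A′-intro v (closed v m e x) λ mv → ¬m (M-up (anc-parent e) mv)

    clear′ : ∀ y → A′ y ≡ nothing → Z y ≡ false
    clear′ y e = clear y (proj₁ (A′-free y e))

    closed-anc : ∀ {z v} → Anc z v → A z ≡ nothing → A v ≡ nothing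
    closed-anc {z} {v} an e = go (lev v) v ≤-refl an
      where
      go : ∀ m v → lev v ≤ m → Anc z v → A v ≡ nothing
      go m v le b with z Fin.≟ v
      ... | yes refl = e
      ... | no ne with anc-par b ne
      go zero v le b | no ne | x , q , b′ = contradiction (≤-trans (≤-reflexive (sym q)) le) λ ()
      go (suc m) v le b | no ne | x , q , b′ =
        closed v x q (go m (par v) (≤-trans (≤-reflexive (lev-par v x q)) (ℕ.s≤s⁻¹ (≤-trans (≤-reflexive (sym q)) le))) b′)

    New : Fin V → Set
    New v = ∃ λ z → Anc z v × M z × A z ≡ nothing

    foot-new : ∀ v → New v → foot A′ v ≡ just w
    foot-new v nv = go (lev v) v refl nv
      where
      go : ∀ m v → lev v ≡ m → New v → footN A′ m v ≡ just w
      go m v q (z , an , mz , ez) with M? v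
      ... | yes mv = footN-taken A′ m v (A′-new v (closed-anc an ez) mv)
      ... | no ¬mv with z Fin.≟ v
      ...   | yes refl = contradiction mz ¬mv
      ...   | no ne with anc-par an ne
      go zero v q (z , an , mz , ez) | no ¬mv | no ne | x , q′ , an′ = contradiction (trans (sym q) q′) λ ()
      go (suc m) v q (z , an , mz , ez) | no ¬mv | no ne | x , q′ , an′ =
        trans (footN-suc A′ m v (A′-intro v (closed-anc an ez) ¬mv)) (go m (par v) (lev-par v m q) (z , an′ , mz , ez))

    foot-old : ∀ v → ¬ New v → foot A′ v ≡ foot A v
    foot-old v nv = go (lev v) v refl nv
      where
      go : ∀ m v → lev v ≡ m → ¬ New v → footN A′ m v ≡ footN A m v
      byA : ∀ m v → lev v ≡ m → ¬ New v → ∀ x → A v ≡ x → footN A′ m v ≡ footN A m v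
      byA m v q ¬n (just P) e = trans (footN-taken A′ m v (A′-old v e)) (sym (footN-taken A m v e))
      byA zero v q ¬n nothing e = trans (footN-zero A′ v (A′-intro v e λ mv → ¬n (v , anc-refl v , mv , e))) (sym (footN-zero A v e))
      byA (suc m) v q ¬n nothing e = trans (footN-suc A′ m v (A′-intro v e λ mv → ¬n (v , anc-refl v , mv , e)))
        (trans (go m (par v) (lev-par v m q) λ { (z , an , mz , ez) → ¬n (z , anc-step q an , mz , ez) }) (sym (footN-suc A m v e)))
      go m v q ¬n = byA m v q ¬n (A v) refl

    -- The paths from the corners `p` and `c` meet at a free vertex; for a corner `c` of the
    -- triangle this is when `p` acquires the new part as its label.
    E : ℕ → ℕ → Set
    E c p = ∃ λ z → Anc z (s p) × Anc z (s c) × A z ≡ nothing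

    E? : ∀ c p → Dec (E c p)
    E? c p = FinP.any? λ z → anc? z (s p) ×-dec (anc? z (s c) ×-dec free? z)
      where
      free? : ∀ z → Dec (A z ≡ nothing)
      free? z with A z
      ... | just _  = no λ ()
      ... | nothing = yes refl

    E-new : ∀ {c p} → Vertex c a k b → E c p → New (s p)
    E-new v (z , x , y , e) = z , x , M-vertex v y , e

    new-E : ∀ {p} → New (s p) → E a p ⊎ E k p ⊎ E b p
    new-E (z , x , inj₁ m , e) = inj₁ (z , x , m , e)
    new-E (z , x , inj₂ (inj₁ m) , e) = inj₂ (inj₁ (z , x , m , e))
    new-E (z , x , inj₂ (inj₂ m) , e) = inj₂ (inj₂ (z , x , m , e))

    -- By `interval`, everything visited between two corners below a free vertex is also below it.
    -- So the corners attached to a leg form a block next to its end, which keeps the new classes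
    -- monotone.
    E-up : ∀ {c p q} → p ≤ q → q ≤ c → c ≤ last → E c p → E c q × E q p
    E-up pq qc cl (z , x , y , e) = (z , m , y , e) , (z , x , m , e)
      where m = interval (clear z e) pq qc cl x y

    E-down : ∀ {c p q} → c ≤ q → q ≤ p → p ≤ last → E c p → E c q × E q p
    E-down cq qp pl (z , x , y , e) = (z , m , y , e) , (z , x , m , e)
      where m = interval (clear z e) cq qp pl y x

    module Arc {c d} (t′ : Tri c d) (sub : ∀ {p} → Corner p t′ → Corner p t) (vc : Vertex c a k b) (vd : Vertex d a k b)
      (c<d : c < d) (d≤ : d ≤ last) (third-out : ∀ {p} → c ≤ p → p ≤ d → E a p ⊎ E k p ⊎ E b p → E c p ⊎ E d p)
      (few : toℕ (cls d) ≤ suc (toℕ (cls c))) (ρ₀ : Fin 3)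
      (avoids : ∀ x → toℕ (cls c) ≤ toℕ x → toℕ x ≤ toℕ (cls d) → base x ≢ ρ₀) where

      ρ P Q : Fin 3
      ρ = σ ρ₀
      P = σ (base (cls c))
      Q = third ρ P

      cls≤ : ∀ {p} → Corner p t′ → toℕ (cls c) ≤ toℕ (cls p) × toℕ (cls p) ≤ toℕ (cls d)
      cls≤ h with corner-bounds t′ (<⇒≤ c<d) h
      ... | x , y = mono _ _ (sub (corner-left t′)) (sub h) x , mono _ _ (sub h) (sub (corner-right t′)) y

      ρ≢P : ρ ≢ P
      ρ≢P e = avoids (cls c) ≤-refl (mono _ _ (sub (corner-left t′)) (sub (corner-right t′)) (<⇒≤ c<d)) (sym (σ-inj e))

      -- From `c` to `d` one meets the new part through the leg of `c`, then the old labels `P` and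
      -- `Q`, then the new part through the leg of `d`; `few` excludes a third old label.
      cls′ : ℕ → Fin 4
      cls′ p with E? c p | E? d p | cls p Fin.≟ cls c
      ... | yes _ | _     | _     = zero
      ... | no _  | yes _ | _     = 3F
      ... | no _  | no _  | yes _ = 1F
      ... | no _  | no _  | no _  = 2F

      old-lab : ∀ p → Corner p t′ → ¬ E c p → ¬ E d p → foot A′ (s p) ≡ ∂ w (σ (base (cls p)))
      old-lab p h ¬c ¬d = trans (foot-old (s p) old) (lab p (sub h))
        where
        old : ¬ New (s p)
        old nw with third-out (proj₁ (corner-bounds t′ (<⇒≤ c<d) h)) (proj₂ (corner-bounds t′ (<⇒≤ c<d) h)) (new-E nw)
        ... | inj₁ e = ¬c e
        ... | inj₂ e = ¬d e

      is-Q : ∀ p → Corner p t′ → cls p ≢ cls c → σ (base (cls p)) ≡ Q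
      is-Q p h ne = third-unique ρ P _ ρ≢P
            (λ e → avoids (cls p) (proj₁ (cls≤ h)) (proj₂ (cls≤ h)) (σ-inj e)) λ e → base-suc (cls c) (cls p) sc (σ-inj e)
        where
        sc : toℕ (cls p) ≡ suc (toℕ (cls c))
        sc = ≤-antisym (≤-trans (proj₂ (cls≤ h)) few) (≤∧≢⇒< (proj₁ (cls≤ h)) λ e → ne (FinP.toℕ-injective (sym e)))

      lab′ : ∀ p → Corner p t′ → foot A′ (s p) ≡ ∂ (w ∙ ρ) (perm ρ P Q (base (cls′ p)))
      lab′ p h with E? c p | E? d p | cls p Fin.≟ cls c
      ... | yes e | _ | _ = trans (foot-new (s p) (E-new vc e)) (sym (∂-new w ρ))
      ... | no _ | yes e | _ = trans (foot-new (s p) (E-new vd e)) (sym (∂-new w ρ))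
      ... | no ¬c | no ¬d | yes e = trans (old-lab p h ¬c ¬d)
              (trans (cong (λ x → ∂ w (σ (base x))) e) (sym (∂-old w ρ P (≢-sym ρ≢P))))
      ... | no ¬c | no ¬d | no ne = trans (old-lab p h ¬c ¬d)
              (trans (cong (∂ w) (is-Q p h ne)) (sym (∂-old w ρ Q (third-≢₁ ρ P ρ≢P))))

      mono′ : ∀ p q → Corner p t′ → Corner q t′ → p ≤ q → toℕ (cls′ p) ≤ toℕ (cls′ q)
      mono′ p q hp hq pq with corner-bounds t′ (<⇒≤ c<d) hp | corner-bounds t′ (<⇒≤ c<d) hq
      ... | cp , pd | cq , qd with E? c p | E? d p | cls p Fin.≟ cls c | E? c q | E? d q | cls q Fin.≟ cls c
      ... | yes _ | _ | _ | _ | _ | _ = z≤n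
      ... | no ¬c | _ | _ | yes e | _ | _ = contradiction (proj₁ (E-down cp pq (≤-trans qd d≤) e)) ¬c
      ... | no _ | _ | _ | no _ | yes _ | dq = top _
        where
        top : ∀ (x : Fin 4) → toℕ x ≤ 3
        top x = ℕ.s≤s⁻¹ (FinP.toℕ<n x)
      ... | no _ | yes e | _ | no _ | no ¬d | _ = contradiction (proj₁ (E-up pq qd d≤ e)) ¬d
      ... | no _ | no _ | yes _ | no _ | no _ | yes _ = ≤-refl
      ... | no _ | no _ | yes _ | no _ | no _ | no _ = s≤s z≤n
      ... | no _ | no _ | no _ | no _ | no _ | no _ = ≤-refl
      ... | no _ | no _ | no ne | no _ | no _ | yes e = contradiction
              (FinP.toℕ-injective (≤-antisym (≤-trans (mono p q (sub hp) (sub hq) pq) (≤-reflexive (cong toℕ e))) (proj₁ (cls≤ hp)))) ne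

      arcInv : Inv t′ (w ∙ ρ) A′
      arcInv = record
        { closed = closed′ ; clear = clear′ ; σ = perm ρ P Q
        ; σ-inj = perm-inj ρ≢P (≢-sym (third-≢₂ ρ P ρ≢P)) (≢-sym (third-≢₁ ρ P ρ≢P))
        ; cls = cls′ ; mono = mono′ ; lab = lab′ }

    module Outer (gap : 2 + toℕ (cls a) ≤ toℕ (cls b)) where

      ρ₀ ρ O X : Fin 3
      ρ₀ = mid (cls a) (cls k) (cls b)
      ρ = σ ρ₀
      O = σ zero
      X = third O ρ

      cornerOf : ∀ {p} → Vertex p a k b → Corner p t
      cornerOf (inj₁ refl) = corner-l S (corner-left l)
      cornerOf (inj₂ (inj₁ refl)) = corner-l S (corner-right l)
      cornerOf (inj₂ (inj₂ refl)) = corner-r S (corner-right r)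

      avoids : ∀ {p} → Corner p u → base (cls p) ≢ ρ₀
      avoids {p} h = mid-u (cls a) (cls k) (cls b)
        (mono a k (cornerOf (inj₁ refl)) (cornerOf (inj₂ (inj₁ refl))) (<⇒≤ a<k))
        (mono k b (cornerOf (inj₂ (inj₁ refl))) (cornerOf (inj₂ (inj₂ refl))) (<⇒≤ k<b)) gap (cls p) (out (corner-u-out i≤j S h))
        where
        out : p ≤ a ⊎ b ≤ p → toℕ (cls p) ≤ toℕ (cls a) ⊎ toℕ (cls b) ≤ toℕ (cls p)
        out (inj₁ le) = inj₁ (mono p a (corner-u S h) (cornerOf (inj₁ refl)) le)
        out (inj₂ le) = inj₂ (mono b p (cornerOf (inj₂ (inj₂ refl))) (corner-u S h) le)

      before : ∀ {p} → Corner p u → p ≤ a → toℕ (cls p) ≤ toℕ (cls a)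
      before h le = mono _ a (corner-u S h) (cornerOf (inj₁ refl)) le

      after : ∀ {p} → Corner p u → ¬ p ≤ a → toℕ (cls b) ≤ toℕ (cls p)
      after {p} h nle with corner-u-out i≤j S h
      ... | inj₁ le = contradiction le nle
      ... | inj₂ le = mono b p (cornerOf (inj₂ (inj₂ refl))) (corner-u S h) le

      b≤ : ∀ {p} → Corner p u → ¬ p ≤ a → b ≤ p
      b≤ {p} h nle with corner-u-out i≤j S h
      ... | inj₁ le = contradiction le nle
      ... | inj₂ le = le

      p≤last : ∀ {p} → Corner p u → p ≤ last
      p≤last h = ≤-trans (proj₂ (corner-bounds u i≤j h)) j≤

      old-before : ∀ p → Corner p u → p ≤ a → ¬ E a p → foot A′ (s p) ≡ ∂ w (σ (base (cls p)))
      old-before p h le ¬e = trans (foot-old (s p) old) (lab p (corner-u S h))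
        where
        old : ¬ New (s p)
        old nw with new-E nw
        ... | inj₁ e = ¬e e
        ... | inj₂ (inj₁ e) = ¬e (proj₂ (E-up le (<⇒≤ a<k) k≤last e))
        ... | inj₂ (inj₂ e) = ¬e (proj₂ (E-up le (<⇒≤ (<-trans a<k k<b)) b≤last e))

      old-after : ∀ p → Corner p u → ¬ p ≤ a → ¬ E b p → foot A′ (s p) ≡ ∂ w (σ (base (cls p)))
      old-after p h nle ¬e = trans (foot-old (s p) old) (lab p (corner-u S h))
        where
        old : ¬ New (s p)
        old nw with new-E nw
        ... | inj₁ e = ¬e (proj₂ (E-down (<⇒≤ (<-trans a<k k<b)) (b≤ h nle) (p≤last h) e))
        ... | inj₂ (inj₁ e) = ¬e (proj₂ (E-down (<⇒≤ k<b) (b≤ h nle) (p≤last h) e))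
        ... | inj₂ (inj₂ e) = ¬e e

      keepO : O ≢ ρ → ∀ p → cls p ≡ zero ⊎ cls p ≡ 3F → ∂ w (σ (base (cls p))) ≡ ∂ (w ∙ ρ) O
      keepO ne p (inj₁ e) = trans (cong (λ x → ∂ w (σ (base x))) e) (sym (∂-old w ρ O ne))
      keepO ne p (inj₂ e) = trans (cong (λ x → ∂ w (σ (base x))) e) (sym (∂-old w ρ O ne))

      keepX : O ≢ ρ → ∀ p → Corner p u → base (cls p) ≢ zero → ∂ w (σ (base (cls p))) ≡ ∂ (w ∙ ρ) X
      keepX ne p h nz = trans (cong (∂ w) (third-unique O ρ _ ne (λ e → nz (σ-inj e)) λ e → avoids h (σ-inj e)))
        (sym (∂-old w ρ X (third-≢₂ O ρ ne)))

      -- The corners beyond `b` have class 3 and those before `a` class at most 1; with the block of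
      -- the new part inserted, the order is `O`, `X`, new, `O`.
      module Low (three : toℕ (cls b) ≡ 3) where

        O≢ρ : O ≢ ρ
        O≢ρ e = mid-u (cls a) (cls k) (cls b)
          (mono a k (cornerOf (inj₁ refl)) (cornerOf (inj₂ (inj₁ refl))) (<⇒≤ a<k))
          (mono k b (cornerOf (inj₂ (inj₁ refl))) (cornerOf (inj₂ (inj₂ refl))) (<⇒≤ k<b)) gap 3F
          (inj₂ (≤-reflexive three)) (σ-inj e)

        cls′ : ℕ → Fin 4
        cls′ p with p ≤? a | E? a p | cls p Fin.≟ zero | E? b p
        ... | yes _ | yes _ | _     | _     = 2F
        ... | yes _ | no _  | yes _ | _     = zero
        ... | yes _ | no _  | no _  | _     = 1F
        ... | no _  | _     | _     | yes _ = 2F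
        ... | no _  | _     | _     | no _  = 3F

        one : ∀ x → x ≢ zero → toℕ x ≤ 1 → base x ≢ zero
        one zero ne _ = contradiction refl ne
        one 1F _ _ ()
        one (suc (suc x)) _ (s≤s ())

        a≤1 : toℕ (cls a) ≤ 1
        a≤1 = ℕ.s≤s⁻¹ (ℕ.s≤s⁻¹ (≤-trans gap (≤-reflexive three)))

        lab′ : ∀ p → Corner p u → foot A′ (s p) ≡ ∂ (w ∙ ρ) (perm O X ρ (base (cls′ p)))
        lab′ p h with p ≤? a | E? a p | cls p Fin.≟ zero | E? b p
        ... | yes _ | yes e | _ | _ = trans (foot-new (s p) (E-new (inj₁ refl) e)) (sym (∂-new w ρ))
        ... | yes le | no ¬e | yes z | _ = trans (old-before p h le ¬e) (keepO O≢ρ p (inj₁ z))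
        ... | yes le | no ¬e | no nz | _ = trans (old-before p h le ¬e) (keepX O≢ρ p h (one (cls p) nz (≤-trans (before h le) a≤1)))
        ... | no _ | _ | _ | yes e = trans (foot-new (s p) (E-new (inj₂ (inj₂ refl)) e)) (sym (∂-new w ρ))
        ... | no nle | _ | _ | no ¬e = trans (old-after p h nle ¬e) (keepO O≢ρ p (inj₂ (FinP.toℕ-injective
                (≤-antisym (ℕ.s≤s⁻¹ (FinP.toℕ<n (cls p))) (≤-trans (≤-reflexive (sym three)) (after h nle))))))

        mono′ : ∀ p q → Corner p u → Corner q u → p ≤ q → toℕ (cls′ p) ≤ toℕ (cls′ q)
        mono′ p q hp hq pq with p ≤? a | E? a p | cls p Fin.≟ zero | E? b p | q ≤? a | E? a q | cls q Fin.≟ zero | E? b q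
        ... | yes _ | yes _ | _ | _ | yes _ | yes _ | _ | _ = ≤-refl
        ... | yes _ | yes e | _ | _ | yes qa | no ¬e | _ | _ = contradiction (proj₁ (E-up pq qa (≤-trans (<⇒≤ a<k) k≤last) e)) ¬e
        ... | yes _ | yes _ | _ | _ | no _ | _ | _ | yes _ = ≤-refl
        ... | yes _ | yes _ | _ | _ | no _ | _ | _ | no _ = s≤s (s≤s z≤n)
        ... | yes _ | no _ | yes _ | _ | _ | _ | _ | _ = z≤n
        ... | yes _ | no _ | no _ | _ | yes _ | yes _ | _ | _ = s≤s z≤n
        ... | yes _ | no _ | no nz | _ | yes _ | no _ | yes z | _ = contradiction
                (FinP.toℕ-injective (n≤0⇒n≡0 (≤-trans (mono p q (corner-u S hp) (corner-u S hq) pq) (≤-reflexive (cong toℕ z))))) nz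
        ... | yes _ | no _ | no _ | _ | yes _ | no _ | no _ | _ = ≤-refl
        ... | yes _ | no _ | no _ | _ | no _ | _ | _ | yes _ = s≤s z≤n
        ... | yes _ | no _ | no _ | _ | no _ | _ | _ | no _ = s≤s z≤n
        ... | no np | _ | _ | _ | yes qa | _ | _ | _ = contradiction (≤-trans pq qa) np
        ... | no _ | _ | _ | yes _ | no _ | _ | _ | yes _ = ≤-refl
        ... | no _ | _ | _ | yes _ | no _ | _ | _ | no _ = s≤s (s≤s z≤n)
        ... | no np | _ | _ | no ¬e | no _ | _ | _ | yes e = contradiction (proj₁ (E-down (b≤ hp np) pq (p≤last hq) e)) ¬e
        ... | no _ | _ | _ | no _ | no _ | _ | _ | no _ = ≤-refl

        outerInv : Inv u (w ∙ ρ) A′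
        outerInv = record
          { closed = closed′ ; clear = clear′ ; σ = perm O X ρ
          ; σ-inj = perm-inj (≢-sym (third-≢₁ O ρ O≢ρ)) (third-≢₂ O ρ O≢ρ) O≢ρ
          ; cls = cls′ ; mono = mono′ ; lab = lab′ }

      -- When `cls b` is not 3, the gap forces class 0 at `a` and 2 at `b`; the new part follows
      -- directly after the first block, in the order `O`, new, `X`, `O`.
      module High (first : toℕ (cls a) ≡ 0) (two : toℕ (cls b) ≡ 2) where

        O≢ρ : O ≢ ρ
        O≢ρ e = mid-u (cls a) (cls k) (cls b)
          (mono a k (cornerOf (inj₁ refl)) (cornerOf (inj₂ (inj₁ refl))) (<⇒≤ a<k))
          (mono k b (cornerOf (inj₂ (inj₁ refl))) (cornerOf (inj₂ (inj₂ refl))) (<⇒≤ k<b)) gap zero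
          (inj₁ z≤n) (σ-inj e)

        three : Fin 4
        three = 3F

        cls′ : ℕ → Fin 4
        cls′ p with p ≤? a | E? a p | cls p Fin.≟ three | E? b p
        ... | yes _ | yes _ | _     | _     = 1F
        ... | yes _ | no _  | _     | _     = zero
        ... | no _  | _     | _     | yes _ = 1F
        ... | no _  | _     | no _  | no _  = 2F
        ... | no _  | _     | yes _ | no _  = 3F

        two-base : ∀ x → x ≢ three → 2 ≤ toℕ x → base x ≢ zero
        two-base 1F _ (s≤s ())
        two-base 2F _ _ ()
        two-base 3F ne _ = contradiction refl ne

        lab′ : ∀ p → Corner p u → foot A′ (s p) ≡ ∂ (w ∙ ρ) (perm O ρ X (base (cls′ p)))
        lab′ p h with p ≤? a | E? a p | cls p Fin.≟ three | E? b p
        ... | yes _ | yes e | _ | _ = trans (foot-new (s p) (E-new (inj₁ refl) e)) (sym (∂-new w ρ))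
        ... | yes le | no ¬e | _ | _ = trans (old-before p h le ¬e) (keepO O≢ρ p (inj₁ (FinP.toℕ-injective
                (n≤0⇒n≡0 (≤-trans (before h le) (≤-reflexive first))))))
        ... | no _ | _ | _ | yes e = trans (foot-new (s p) (E-new (inj₂ (inj₂ refl)) e)) (sym (∂-new w ρ))
        ... | no nle | _ | no ne | no ¬e = trans (old-after p h nle ¬e)
                (keepX O≢ρ p h (two-base (cls p) ne (≤-trans (≤-reflexive (sym two)) (after h nle))))
        ... | no nle | _ | yes e₃ | no ¬e = trans (old-after p h nle ¬e) (keepO O≢ρ p (inj₂ e₃))

        mono′ : ∀ p q → Corner p u → Corner q u → p ≤ q → toℕ (cls′ p) ≤ toℕ (cls′ q)
        mono′ p q hp hq pq with p ≤? a | E? a p | cls p Fin.≟ three | E? b p | q ≤? a | E? a q | cls q Fin.≟ three | E? b q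
        ... | yes _ | no _ | _ | _ | _ | _ | _ | _ = z≤n
        ... | yes _ | yes _ | _ | _ | yes _ | yes _ | _ | _ = ≤-refl
        ... | yes _ | yes e | _ | _ | yes qa | no ¬e | _ | _ = contradiction (proj₁ (E-up pq qa (≤-trans (<⇒≤ a<k) k≤last) e)) ¬e
        ... | yes _ | yes _ | _ | _ | no _ | _ | _ | yes _ = ≤-refl
        ... | yes _ | yes _ | _ | _ | no _ | _ | no _ | no _ = s≤s z≤n
        ... | yes _ | yes _ | _ | _ | no _ | _ | yes _ | no _ = s≤s z≤n
        ... | no np | _ | _ | _ | yes qa | _ | _ | _ = contradiction (≤-trans pq qa) np
        ... | no _ | _ | _ | yes _ | no _ | _ | _ | yes _ = ≤-refl
        ... | no _ | _ | _ | yes _ | no _ | _ | no _ | no _ = s≤s z≤n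
        ... | no _ | _ | _ | yes _ | no _ | _ | yes _ | no _ = s≤s z≤n
        ... | no np | _ | _ | no ¬e | no _ | _ | _ | yes e = contradiction (proj₁ (E-down (b≤ hp np) pq (p≤last hq) e)) ¬e
        ... | no _ | _ | no _ | no _ | no _ | _ | no _ | no _ = ≤-refl
        ... | no _ | _ | no _ | no _ | no _ | _ | yes _ | no _ = s≤s (s≤s z≤n)
        ... | no _ | _ | yes _ | no _ | no _ | _ | yes _ | no _ = ≤-refl
        ... | no _ | _ | yes e | no _ | no _ | _ | no ne | no _ = contradiction (FinP.toℕ-injective (≤-antisym
                (ℕ.s≤s⁻¹ (FinP.toℕ<n (cls q))) (≤-trans (≤-reflexive (cong toℕ (sym e))) (mono p q (corner-u S hp) (corner-u S hq) pq)))) ne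

        outerInv : Inv u (w ∙ ρ) A′
        outerInv = record
          { closed = closed′ ; clear = clear′ ; σ = perm O ρ X
          ; σ-inj = perm-inj O≢ρ (≢-sym (third-≢₂ O ρ O≢ρ)) (≢-sym (third-≢₁ O ρ O≢ρ))
          ; cls = cls′ ; mono = mono′ ; lab = lab′ }

      outer : Inv u (w ∙ ρ) A′
      outer with toℕ (cls b) ℕ.≟ 3
      ... | yes e = Low.outerInv e
      ... | no ne = High.outerInv (n≤0⇒n≡0 (ℕ.s≤s⁻¹ (ℕ.s≤s⁻¹ (≤-trans gap b≤2)))) (≤-antisym b≤2 (≤-trans (s≤s (s≤s z≤n)) gap))
        where
        b≤2 : toℕ (cls b) ≤ 2
        b≤2 = ℕ.s≤s⁻¹ (≤∧≢⇒< (ℕ.s≤s⁻¹ (FinP.toℕ<n (cls b))) ne)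

    leg : Fin V → Fin 3
    leg x with anc? x (s a) | anc? x (s k)
    ... | yes _ | _     = zero
    ... | no _  | yes _ = 1F
    ... | no _  | no _  = 2F

    -- A leg lies on a tree path, which has one vertex on each level.
    leg-inj : ∀ x y → M x → M y → leg x ≡ leg y → lev x ≡ lev y → x ≡ y
    leg-inj x y mx my e q with anc? x (s a) | anc? x (s k) | anc? y (s a) | anc? y (s k)
    leg-inj x y mx my e q | yes ax | _ | yes ay | _ = anc-unique ax ay q
    leg-inj x y mx my e q | no _ | yes ax | no _ | yes ay = anc-unique ax ay q
    leg-inj x y (inj₁ ax) my e q | no nx | _ | _ | _ = contradiction ax nx
    leg-inj x y (inj₂ (inj₁ ax)) my e q | _ | no nx | _ | _ = contradiction ax nx
    leg-inj x y mx (inj₁ ay) e q | _ | _ | no ny | _ = contradiction ay ny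
    leg-inj x y mx (inj₂ (inj₁ ay)) e q | _ | _ | _ | no ny = contradiction ay ny
    leg-inj x y (inj₂ (inj₂ ax)) (inj₂ (inj₂ ay)) e q | no _ | no _ | no _ | no _ = anc-unique ax ay q
    leg-inj x y mx my () q | yes _ | _ | no _ | yes _
    leg-inj x y mx my () q | yes _ | _ | no _ | no _
    leg-inj x y mx my () q | no _ | yes _ | yes _ | _
    leg-inj x y mx my () q | no _ | yes _ | no _ | no _
    leg-inj x y mx my () q | no _ | no _ | yes _ | _
    leg-inj x y mx my () q | no _ | no _ | no _ | yes _

    lo hi : Piece → ℕ
    lo L = a
    lo R = k
    lo U = i
    hi L = k
    hi R = b
    hi U = j

    piece : ∀ c → Tri (lo c) (hi c)
    piece L = l
    piece R = r
    piece U = u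

    lo≤hi : ∀ c → lo c ≤ hi c
    lo≤hi L = <⇒≤ a<k
    lo≤hi R = <⇒≤ k<b
    lo≤hi U = i≤j

    module Glue (ρ : Piece → Fin 3) (ρ-inj : ∀ {c d} → ρ c ≡ ρ d → c ≡ d) (res : ∀ c → Res (piece c) (w ∙ ρ c) A′) where

      locate : ℕ → Piece
      locate p with p <? a | p <? k | p <? b
      ... | yes _ | _     | _     = U
      ... | no _  | yes _ | _     = L
      ... | no _  | no _  | yes _ = R
      ... | no _  | no _  | no _  = U

      free-≢ : ∀ {p x} → Vertex x a k b → A′ (s p) ≡ nothing → p ≢ x
      free-≢ v e refl = vertex-taken v e

      va : Vertex a a k b
      va = inj₁ refl
      vk : Vertex k a k b
      vk = inj₂ (inj₁ refl)
      vb : Vertex b a k b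
      vb = inj₂ (inj₂ refl)

      locate-in : ∀ c {p} → Corner p (piece c) → A′ (s p) ≡ nothing → locate p ≡ c
      locate-in L {p} h e with corner-bounds l (<⇒≤ a<k) h | p <? a | p <? k | p <? b
      ... | x , y | yes lt | _ | _ = contradiction x (<⇒≱ lt)
      ... | x , y | no _ | yes _ | _ = refl
      ... | x , y | no _ | no nlt | _ = contradiction (≤∧≢⇒< y (free-≢ vk e)) nlt
      locate-in R {p} h e with corner-bounds r (<⇒≤ k<b) h | p <? a | p <? k | p <? b
      ... | x , y | yes lt | _ | _ = contradiction (<-≤-trans a<k x) (<⇒≯ lt)
      ... | x , y | no _ | yes lt | _ = contradiction x (<⇒≱ lt)
      ... | x , y | no _ | no _ | yes _ = refl
      ... | x , y | no _ | no _ | no nlt = contradiction (≤∧≢⇒< y (free-≢ vb e)) nlt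
      locate-in U {p} h e with corner-u-out i≤j S h | p <? a | p <? k | p <? b
      ... | _ | yes _ | _ | _ = refl
      ... | inj₁ x | no nlt | _ | _ = contradiction (≤∧≢⇒< x (free-≢ va e)) nlt
      ... | inj₂ x | no _ | yes lt | _ = contradiction x (<⇒≱ (<-trans lt k<b))
      ... | inj₂ x | no _ | no _ | yes lt = contradiction x (<⇒≱ lt)
      ... | inj₂ x | no _ | no _ | no _ = refl

      in-locate : ∀ {p} → Corner p t → A′ (s p) ≡ nothing → Corner p (piece (locate p))
      in-locate {p} h e with corner-split S h
      ... | inj₁ c = subst (λ x → Corner p (piece x)) (sym (locate-in L c e)) c
      ... | inj₂ (inj₁ c) = subst (λ x → Corner p (piece x)) (sym (locate-in R c e)) c
      ... | inj₂ (inj₂ c) = subst (λ x → Corner p (piece x)) (sym (locate-in U c e)) c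

      -- A vertex visited on both sides of a triangle corner is, by `interval`, an ancestor of that
      -- corner and so in the new part. Hence all visits of a vertex that remains free fall into one
      -- piece, and `locate` respects vertices.
      separated : ∀ {p q x} → Vertex x a k b → A′ (s p) ≡ nothing → s p ≡ s q → q ≤ last → p ≤ x → ¬ x ≤ q
      separated {p} {q} {x} v e same q≤ px xq = proj₂ (A′-free (s p) e)
        (M-vertex v (interval (clear′ (s p) e) px xq q≤ (anc-refl (s p)) (subst (Anc (s p)) same (anc-refl (s p)))))

      same-side : ∀ {p q x} → Vertex x a k b → A′ (s p) ≡ nothing → s p ≡ s q → p ≤ last → q ≤ last → (p < x → q < x) × (q < x → p < x)
      same-side {p} {q} v e same p≤ q≤ =
        (λ lt → ≰⇒> (separated v e same q≤ (<⇒≤ lt))) ,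
        (λ lt → ≰⇒> (separated v (subst (λ z → A′ z ≡ nothing) same e) (sym same) p≤ (<⇒≤ lt)))

      locate-same : ∀ {p q} → A′ (s p) ≡ nothing → s p ≡ s q → p ≤ last → q ≤ last → locate p ≡ locate q
      locate-same {p} {q} e same p≤ q≤
        with p <? a | q <? a | same-side {x = a} va e same p≤ q≤ | p <? k | q <? k | same-side {x = k} vk e same p≤ q≤ | p <? b | q <? b | same-side {x = b} vb e same p≤ q≤
      ... | yes _ | yes _ | _ | _ | _ | _ | _ | _ | _ = refl
      ... | yes x | no ny | g | _ | _ | _ | _ | _ | _ = contradiction (proj₁ g x) ny
      ... | no nx | yes y | g | _ | _ | _ | _ | _ | _ = contradiction (proj₂ g y) nx
      ... | no _ | no _ | _ | yes _ | yes _ | _ | _ | _ | _ = refl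
      ... | no _ | no _ | _ | yes x | no ny | g | _ | _ | _ = contradiction (proj₁ g x) ny
      ... | no _ | no _ | _ | no nx | yes y | g | _ | _ | _ = contradiction (proj₂ g y) nx
      ... | no _ | no _ | _ | no _ | no _ | _ | yes _ | yes _ | _ = refl
      ... | no _ | no _ | _ | no _ | no _ | _ | yes x | no ny | g = contradiction (proj₁ g x) ny
      ... | no _ | no _ | _ | no _ | no _ | _ | no nx | yes y | g = contradiction (proj₂ g y) nx
      ... | no _ | no _ | _ | no _ | no _ | _ | no _ | no _ | _ = refl

      g : Piece → ℕ → Word × Fin 3
      g c = Res.f (res c)

      choose : ∀ p → Dec (M (s p)) → Word × Fin 3
      choose p (yes _) = w , leg (s p)
      choose p (no _)  = g (locate p) p

      choose-M : ∀ p d → M (s p) → choose p d ≡ (w , leg (s p))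
      choose-M p (yes _) m = refl
      choose-M p (no ¬m) m = contradiction m ¬m

      choose-locate : ∀ p d → ¬ M (s p) → choose p d ≡ g (locate p) p
      choose-locate p (yes m) ¬m = contradiction m ¬m
      choose-locate p (no _)  _  = refl

      abstract
        f : ℕ → Word × Fin 3
        f p = choose p (M? (s p))

        f-M : ∀ p → M (s p) → f p ≡ (w , leg (s p))
        f-M p = choose-M p (M? (s p))

        f-locate : ∀ p → A′ (s p) ≡ nothing → f p ≡ g (locate p) p
        f-locate p e = choose-locate p (M? (s p)) (proj₂ (A′-free (s p) e))

      f-in : ∀ c {p} → Corner p (piece c) → A′ (s p) ≡ nothing → f p ≡ g c p
      f-in c {p} h e = trans (f-locate p e) (cong (λ x → g x p) (locate-in c h e))

      split-A : ∀ x → A x ≡ nothing → M x ⊎ A′ x ≡ nothing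
      split-A x e with M? x
      ... | yes m = inj₁ m
      ... | no ¬m = inj₂ (A′-intro x e ¬m)

      ext-in : ∀ {p} → Corner p t → A′ (s p) ≡ nothing → (w ∙ ρ (locate p)) ⊑ proj₁ (f p)
      ext-in {p} h e = subst (λ x → (w ∙ ρ (locate p)) ⊑ proj₁ x) (sym (f-locate p e)) (Res.ext (res (locate p)) p (in-locate h e) e)

      ext : ∀ p → Corner p t → A (s p) ≡ nothing → w ⊑ proj₁ (f p)
      ext p h e with split-A (s p) e
      ... | inj₁ m  = subst (λ x → w ⊑ proj₁ x) (sym (f-M p m)) here
      ... | inj₂ e′ = ⊑-trans (there here) (ext-in h e′)

      ≤last : ∀ {p} → Corner p t → p ≤ last
      ≤last h = ≤-trans (proj₂ (corner-bounds t i≤j h)) j≤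

      cons : ∀ p q → Corner p t → Corner q t → A (s p) ≡ nothing → s p ≡ s q → f p ≡ f q
      cons p q hp hq e same with split-A (s p) e
      ... | inj₁ m  = trans (f-M p m) (trans (cong (λ x → w , leg x) same) (sym (f-M q (subst M same m))))
      ... | inj₂ e′ = trans (f-locate p e′) (trans
              (Res.cons (res (locate p)) p q (in-locate hp e′) (subst (λ c → Corner q (piece c)) (sym lq) (in-locate hq eq)) e′ same)
              (trans (cong (λ c → g c q) lq) (sym (f-locate q eq))))
        where
        eq : A′ (s q) ≡ nothing
        eq = subst (λ x → A′ x ≡ nothing) same e′
        lq : locate p ≡ locate q
        lq = locate-same e′ same (≤last hp) (≤last hq)

      inj : ∀ p q → Corner p t → Corner q t → A (s p) ≡ nothing → A (s q) ≡ nothing →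
               f p ≡ f q → lev (s p) ≡ lev (s q) → s p ≡ s q
      inj p q hp hq ep eq fe le with split-A (s p) ep | split-A (s q) eq
      ... | inj₁ mp | inj₁ mq = leg-inj (s p) (s q) mp mq (cong proj₂ (trans (sym (f-M p mp)) (trans fe (f-M q mq)))) le
      ... | inj₁ mp | inj₂ fq = contradiction (⊑-len (subst (λ x → (w ∙ ρ (locate q)) ⊑ proj₁ x) (trans (sym fe) (f-M p mp)) (ext-in hq fq))) 1+n≰n
      ... | inj₂ fp | inj₁ mq = contradiction (⊑-len (subst (λ x → (w ∙ ρ (locate p)) ⊑ proj₁ x) (trans fe (f-M q mq)) (ext-in hp fp))) 1+n≰n
      ... | inj₂ fp | inj₂ fq = Res.inj (res (locate p)) p q (in-locate hp fp) (subst (λ c → Corner q (piece c)) (sym lq) (in-locate hq fq)) fp fq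
              (trans (sym (f-locate p fp)) (trans fe (trans (f-locate q fq) (cong (λ c → g c q) (sym lq))))) le
        where
        lq : locate p ≡ locate q
        lq = ρ-inj (⊑-letter (ext-in hp fp) (subst (λ x → (w ∙ ρ (locate q)) ⊑ proj₁ x) (sym fe) (ext-in hq fq)))

      linked-in : ∀ {p q} → Linked p q t → A′ (s q) ≡ nothing → Linked p q (piece (locate q))
      linked-in {p} {q} h e with linked-split S h
      ... | inj₁ v = contradiction e (vertex-taken v)
      ... | inj₂ (inj₁ x) = subst (λ c → Linked p q (piece c)) (sym (locate-in L (proj₂ (linked-corner l x)) e)) x
      ... | inj₂ (inj₂ (inj₁ x)) = subst (λ c → Linked p q (piece c)) (sym (locate-in R (proj₂ (linked-corner r x)) e)) x
      ... | inj₂ (inj₂ (inj₂ x)) = subst (λ c → Linked p q (piece c)) (sym (locate-in U (proj₂ (linked-corner u x)) e)) x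

      full-same : ∀ c {p} → Corner p (piece c) → full A′ (g c) p ≡ full A f p
      full-same c {p} h = go (A (s p)) refl
        where
        go : ∀ x → A (s p) ≡ x → full A′ (g c) p ≡ full A f p
        go (just P) e = trans (full-taken A′ (g c) p (A′-old (s p) e)) (sym (full-taken A f p e))
        go nothing e with split-A (s p) e
        ... | inj₁ m  = trans (full-taken A′ (g c) p (A′-new (s p) e m)) (trans (cong (λ x → just (proj₁ x)) (sym (f-M p m))) (sym (full-free A f p e)))
        ... | inj₂ e′ = trans (full-free A′ (g c) p e′) (trans (cong (λ x → just (proj₁ x)) (sym (f-in c h e′))) (sym (full-free A f p e)))

      -- For `w′` equal to `w`, a taken `p` is its own foot and `lab` places its part on the border
      -- of `w`. For longer `w′`, `q` lies strictly inside a piece, the linking triangle belongs to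
      -- the same piece, and the result for that piece applies.
      compat : ∀ p q → Linked p q t → A (s q) ≡ nothing → ∀ {w′} → w ⊑ w′ → w′ ⊑ proj₁ (f q) →
               (A (s p) ≡ nothing × w′ ⊑ proj₁ (f p)) ⊎ ∃ λ x → ∂ w′ x ≡ full A f p
      compat p q h e {w′} lo′ hi′ with w ≟ʷ w′
      ... | yes refl = go (A (s p)) refl
        where
        hp = proj₁ (linked-corner t h)
        go : ∀ x → A (s p) ≡ x → (A (s p) ≡ nothing × w ⊑ proj₁ (f p)) ⊎ ∃ λ x → ∂ w x ≡ full A f p
        go (just P) ep = inj₂ (_ , trans (sym (lab p hp)) (trans (footN-taken A _ (s p) ep) (sym (full-taken A f p ep))))
        go nothing ep = inj₁ (ep , ext p hp ep)
      ... | no ne with split-A (s q) e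
      ...   | inj₁ m = contradiction (⊑-len (subst (λ x → w′ ⊑ proj₁ x) (f-M q m) hi′)) (<⇒≱ (⊑-strict lo′ ne))
      ...   | inj₂ e′ with Res.compat (res c) p q lk e′ deeper (subst (λ x → w′ ⊑ proj₁ x) (f-locate q e′) hi′)
        where
        c = locate q
        lk : Linked p q (piece c)
        lk = linked-in h e′
        deeper : (w ∙ ρ c) ⊑ w′
        deeper = ⊑-compare (ext-in (proj₂ (linked-corner t h)) e′) hi′ (⊑-strict lo′ ne)
      ...     | inj₁ (ep , x) = inj₁ (proj₁ (A′-free (s p) ep) ,
                  subst (λ z → w′ ⊑ proj₁ z) (sym (f-in (locate q) (proj₁ (linked-corner _ (linked-in h e′))) ep)) x)
      ...     | inj₂ (x , b′) = inj₂ (x , trans b′ (full-same (locate q) (proj₁ (linked-corner _ (linked-in h e′)))))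

      glued : Res t w A
      glued = record { f = f ; ext = ext ; cons = cons ; inj = inj ; compat = compat }

  decompose : ∀ m {i j} (t : Tri i j) → NonLeaf t → size t ≤ m → i ≤ j → j ≤ last → ∀ {w A} → Inv t w A → Res t w A
  decompose zero (tri _ _ _ _ _) _ ()
  decompose (suc m) {i} {j} t nl sz i≤j j≤ {w} {A} I with Find.findTop (λ p → toℕ (Inv.cls I p)) t nl
  ... | F , top = Glue.glued (λ c → σ (slot μ c)) (λ e → slot-inj μ (σ-inj e)) res
    where
    open Inv I
    open Find.Found F
    open Step I i≤j j≤ split
    μ : Fin 3
    μ = mid (cls a) (cls k) (cls b)
    ca : Corner a t
    ca = corner-l split (corner-left l)
    ck : Corner k t
    ck = corner-l split (corner-right l)
    cb : Corner b t
    cb = corner-r split (corner-right r)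
    smaller : ∀ c → size (piece c) ≤ m
    smaller L = ℕ.s≤s⁻¹ (≤-trans (proj₁ (split-size split)) sz)
    smaller R = ℕ.s≤s⁻¹ (≤-trans (proj₁ (proj₂ (split-size split))) sz)
    smaller U = ℕ.s≤s⁻¹ (≤-trans (proj₂ (proj₂ (split-size split))) sz)
    hi≤ : ∀ c → hi c ≤ last
    hi≤ L = k≤last
    hi≤ R = b≤last
    hi≤ U = j≤
    invL : NonLeaf l → Inv l (w ∙ σ (nxt μ)) A′
    invL n = Arc.arcInv l (corner-l split) (inj₁ refl) (inj₂ (inj₁ refl)) a<k k≤last
      -- A corner of the left piece that meets the leg of `b` shares the free ancestor with `k`,
      -- which lies between them, and so meets the leg of `k`.
      (λ { x y (inj₁ e) → inj₁ e ; x y (inj₂ (inj₁ e)) → inj₂ e ; x y (inj₂ (inj₂ e)) → inj₂ (proj₂ (E-up y (<⇒≤ k<b) b≤last e)) })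
      (okL n) (nxt μ) (mid-l (cls a) (cls k) (cls b) (mono a k ca ck (<⇒≤ a<k)) (mono k b ck cb (<⇒≤ k<b)) (okL n))
    invR : NonLeaf r → Inv r (w ∙ σ (prv μ)) A′
    invR n = Arc.arcInv r (corner-r split) (inj₂ (inj₁ refl)) (inj₂ (inj₂ refl)) k<b b≤last
      (λ { x y (inj₁ e) → inj₁ (proj₂ (E-down (<⇒≤ a<k) x (≤-trans y b≤last) e)) ; x y (inj₂ (inj₁ e)) → inj₁ e ; x y (inj₂ (inj₂ e)) → inj₂ e })
      (okR n) (prv μ) (mid-r (cls a) (cls k) (cls b) (mono a k ca ck (<⇒≤ a<k)) (mono k b ck cb (<⇒≤ k<b)) (okR n))
    resL : l ≡ leaf ⊎ NonLeaf l → Res l (w ∙ σ (nxt μ)) A′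
    resL (inj₁ e) = res-leaf e (vertex-taken (inj₁ refl)) (vertex-taken (inj₂ (inj₁ refl)))
    resL (inj₂ n) = decompose m l n (smaller L) (lo≤hi L) (hi≤ L) (invL n)
    resR : r ≡ leaf ⊎ NonLeaf r → Res r (w ∙ σ (prv μ)) A′
    resR (inj₁ e) = res-leaf e (vertex-taken (inj₂ (inj₁ refl))) (vertex-taken (inj₂ (inj₂ refl)))
    resR (inj₂ n) = decompose m r n (smaller R) (lo≤hi R) (hi≤ R) (invR n)
    leafU : u ≡ leaf → Res u (w ∙ σ μ) A′
    leafU e with split-leaf split e
    ... | refl , refl = res-leaf e (vertex-taken (inj₁ refl)) (vertex-taken (inj₂ (inj₂ refl)))
    resU : u ≡ leaf ⊎ 2 + toℕ (cls a) ≤ toℕ (cls b) → Res u (w ∙ σ μ) A′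
    resU (inj₁ e) = leafU e
    resU (inj₂ g) with leaf-or u
    ... | inj₁ e = leafU e
    ... | inj₂ n = decompose m u n (smaller U) (lo≤hi U) (hi≤ U) (Outer.outer g)
    res : ∀ c → Res (piece c) (w ∙ σ (slot μ c)) A′
    res L = resL (leaf-or l)
    res R = resR (leaf-or r)
    res U = resU top

  record Nesting {i j} (t : Tri i j) : Set where
    field
      f      : ℕ → Word × Fin 3
      cons   : ∀ p q → Corner p t → Corner q t → Z (s p) ≡ false → s p ≡ s q → f p ≡ f q
      inj    : ∀ p q → Corner p t → Corner q t → Z (s p) ≡ false → Z (s q) ≡ false →
               f p ≡ f q → lev (s p) ≡ lev (s q) → s p ≡ s q
      compat : ∀ p q → Linked p q t → Z (s p) ≡ false → Z (s q) ≡ false → ∀ {w} → w ⊑ proj₁ (f q) →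
               w ⊑ proj₁ (f p) ⊎ ∃ λ x → ∂ w x ≡ just (proj₁ (f p))

  nesting : (∀ v m → lev v ≡ suc m → Z (par v) ≡ false → Z v ≡ false) →
    (t : Tri 0 last) → NonLeaf t → Nesting t
  nesting closedZ t nl = record
    { f = f
    ; cons = λ p q hp hq zp → Res.cons res p q hp hq (free zp)
    ; inj = λ p q hp hq zp zq → Res.inj res p q hp hq (free zp) (free zq)
    ; compat = λ p q h zp zq l → conv p zp (Res.compat res p q h (free zq) (ε⊑ _) l) }
    where
    A₀ : Taken
    A₀ v = if Z v then just nothing else nothing
    free : ∀ {v} → Z v ≡ false → A₀ v ≡ nothing
    free e rewrite e = refl
    free⁻¹ : ∀ {v} → A₀ v ≡ nothing → Z v ≡ false
    free⁻¹ {v} e with Z v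
    ... | false = refl
    foot₀ : ∀ m v → footN A₀ m v ≡ nothing
    foot₀ m v = go m v (Z v) refl
      where
      go : ∀ m v b → Z v ≡ b → footN A₀ m v ≡ nothing
      go m       v true  e = footN-taken A₀ m v (cong (λ b → if b then just nothing else nothing) e)
      go zero    v false e = footN-zero A₀ v (free e)
      go (suc m) v false e = trans (footN-suc A₀ m v (free e)) (go m (par v) (Z (par v)) refl)
    res : Res t ε A₀
    res = decompose (size t) t nl ≤-refl z≤n ≤-refl record
      { closed = λ v m e h → free (closedZ v m e (free⁻¹ h))
      ; clear = λ y → free⁻¹
      ; σ = λ x → x ; σ-inj = λ e → e
      -- At the start the outer border fills all three slots of `∂ ε`, so one class is enough.
      ; cls = λ _ → zero ; mono = λ _ _ _ _ _ → z≤n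
      ; lab = λ p _ → foot₀ (lev (s p)) (s p) }
    f = Res.f res
    conv : ∀ p {w} → Z (s p) ≡ false → (A₀ (s p) ≡ nothing × w ⊑ proj₁ (f p)) ⊎ (∃ λ x → ∂ w x ≡ full A₀ f p) →
      w ⊑ proj₁ (f p) ⊎ ∃ λ x → ∂ w x ≡ just (proj₁ (f p))
    conv p z (inj₁ (_ , l)) = inj₁ l
    conv p z (inj₂ (x , e)) = inj₂ (x , trans e (full-free A₀ f p (free z)))

-- Search, closure and parity

least : (P : ℕ → Set) → (∀ n → Dec (P n)) → ∀ n → P n → ∃ λ m → P m × (∀ i → i < m → ¬ P i)
least P P? zero h = zero , h , λ _ ()
least P P? (suc n) h with P? zero
... | yes p = zero , p , λ _ ()
... | no ¬p with least (λ i → P (suc i)) (λ i → P? (suc i)) n h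
...   | m , q , min = suc m , q , λ { zero _ → ¬p ; (suc i) (s≤s lt) → min i lt }

bounded : ∀ {N} (f : Fin N → ℕ) → ∃ λ B → ∀ x → f x ≤ B
bounded {zero}  f = 0 , λ ()
bounded {suc N} f with bounded (λ x → f (suc x))
... | B , h = f zero ⊔ B , λ { zero → m≤m⊔n (f zero) B ; (suc x) → ≤-trans (h x) (m≤n⊔m (f zero) B) }

record Enumeration {N : ℕ} (P : Fin N → Set) : Set where
  field
    count    : ℕ
    elem     : Fin count → Fin N
    elem-inj : ∀ {i j} → elem i ≡ elem j → i ≡ j
    elem-P   : ∀ i → P (elem i)
    index    : ∀ x → P x → ∃ λ i → elem i ≡ x

enumerate : ∀ {N} {P : Fin N → Set} → (∀ x → Dec (P x)) → Enumeration P
enumerate {zero} P? = record { count = 0 ; elem = λ () ; elem-inj = λ { {()} } ; elem-P = λ () ; index = λ () }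
enumerate {suc N} {P} P? with enumerate {N} {λ x → P (suc x)} (λ x → P? (suc x)) | P? zero
... | e | no ¬p = record
  { count = count ; elem = λ i → suc (elem i) ; elem-inj = λ q → elem-inj (FinP.suc-injective q) ; elem-P = elem-P
  ; index = λ { zero p → contradiction p ¬p ; (suc x) p → proj₁ (index x p) , cong suc (proj₂ (index x p)) } }
  where open Enumeration e
... | e | yes p₀ = record
  { count = suc count ; elem = el ; elem-inj = el-inj
  ; elem-P = λ { zero → p₀ ; (suc i) → elem-P i }
  ; index = λ { zero p → zero , refl ; (suc x) p → suc (proj₁ (index x p)) , cong suc (proj₂ (index x p)) } }
  where
  open Enumeration e
  el : Fin (suc count) → Fin (suc N)
  el zero    = zero
  el (suc i) = suc (elem i)
  el-inj : ∀ {i j} → el i ≡ el j → i ≡ j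
  el-inj {zero}  {zero}  q = refl
  el-inj {suc i} {suc j} q = cong suc (elem-inj (FinP.suc-injective q))

module BFS {N : ℕ} (Step : Fin N → Fin N → Set) (step? : ∀ u v → Dec (Step u v))
  (Root : Fin N → Set) (root? : ∀ v → Dec (Root v))
  (reach : ∀ v → ∃ λ r → Root r × Star Step r v) where

  Walk : ℕ → Fin N → Set
  Walk zero    v = Root v
  Walk (suc m) v = ∃ λ u → Walk m u × Step u v

  walk? : ∀ m v → Dec (Walk m v)
  walk? zero    v = root? v
  walk? (suc m) v = FinP.any? λ u → walk? m u ×-dec step? u v

  walk : ∀ v → ∃ λ m → Walk m v
  walk v with reach v
  ... | r , root , s = go 0 root s
    where
    go : ∀ m {u} → Walk m u → Star Step u v → ∃ λ m → Walk m v
    go m w []*      = m , w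
    go m w (e ∷* s) = go (suc m) (_ , w , e) s

  abstract
    shortestWalk : ∀ v → ∃ λ m → Walk m v × (∀ i → i < m → ¬ Walk i v)
    shortestWalk v = least (λ m → Walk m v) (λ m → walk? m v) (proj₁ (walk v)) (proj₂ (walk v))

  abstract
    depth : Fin N → ℕ
    depth v = proj₁ (shortestWalk v)

    depth-≤ : ∀ {m v} → Walk m v → depth v ≤ m
    depth-≤ {m} {v} w = ≮⇒≥ λ lt → proj₂ (proj₂ (shortestWalk v)) m lt w

    depth-step : ∀ {u v} → Step u v → depth v ≤ suc (depth u)
    depth-step {u} e = depth-≤ (u , proj₁ (proj₂ (shortestWalk u)) , e)

    depth-zero : ∀ {v} → depth v ≡ 0 → Root v
    depth-zero {v} e = subst (λ m → Walk m v) e (proj₁ (proj₂ (shortestWalk v)))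

    parent : ∀ {v m} → depth v ≡ suc m → ∃ λ u → Step u v × depth u ≡ m
    parent {v} {m} e with subst (λ m → Walk m v) e (proj₁ (proj₂ (shortestWalk v)))
    ... | u , w , st = u , st , ≤-antisym (depth-≤ w) (ℕ.s≤s⁻¹ (≤-trans (≤-reflexive (sym e)) (depth-step st)))

record Closure {N : ℕ} (Step : Fin N → Fin N → Set) (Root : Fin N → Set) : Set where
  field
    B       : Subset N
    root∈   : ∀ {v} → Root v → v ∈ B
    closed  : ∀ {u v} → Step u v → u ∈ B → v ∈ B
    reached : ∀ {v} → v ∈ B → ∃ λ r → Root r × Star Step r v

closure : ∀ {N} {Step : Fin N → Fin N → Set} {Root : Fin N → Set} → (∀ u v → Dec (Step u v)) →
  (∀ v → Dec (Root v)) → Closure Step Root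
closure {N} {Step} {Root} step? root? = go N B₀ (m≤m+n N ∣ B₀ ∣) root₀ λ v∈ → _ , reach₀ v∈ , []*
  where
  B₀ : Subset N
  B₀ = tabulate λ v → does (root? v)
  root₀ : ∀ {v} → Root v → v ∈ B₀
  root₀ {v} r = VecP.lookup⇒[]= v B₀ (trans (VecP.lookup∘tabulate _ v) (dec-true (root? v) r))
  reach₀ : ∀ {v} → v ∈ B₀ → Root v
  reach₀ {v} v∈ with root? v | trans (sym (VecP.lookup∘tabulate (λ v → does (root? v)) v)) (VecP.[]=⇒lookup v∈)
  ... | yes r | _ = r
  go : ∀ fuel (B : Subset N) → N ≤ fuel + ∣ B ∣ → (∀ {v} → Root v → v ∈ B) →
    (∀ {v} → v ∈ B → ∃ λ r → Root r × Star Step r v) → Closure Step Root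
  go fuel B le root∈ reached with FinP.any? (λ u → FinP.any? (λ v → (u SubP.∈? B) ×-dec (¬? (v SubP.∈? B) ×-dec step? u v)))
  ... | no none = record { B = B ; root∈ = root∈ ; reached = reached ; closed = cl }
    where
    cl : ∀ {u v} → Step u v → u ∈ B → v ∈ B
    cl {u} {v} e u∈ with v SubP.∈? B
    ... | yes v∈ = v∈
    ... | no v∉  = contradiction (u , v , u∈ , v∉ , e) none
  go zero B le root∈ reached | yes (u , v , u∈ , v∉ , e) =
    contradiction (subst (v ∈_) (sym (SubP.∣p∣≡n⇒p≡⊤ (≤-antisym (SubP.∣p∣≤n B) le))) SubP.∈⊤) v∉
  go (suc fuel) B le root∈ reached | yes (u , v , u∈ , v∉ , e) = go fuel (B ∪ ⁅ v ⁆)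
    (≤-trans le (≤-trans (≤-reflexive (sym (+-suc fuel ∣ B ∣))) (+-monoʳ-≤ fuel
      (SubP.p⊂q⇒∣p∣<∣q∣ (SubP.p⊆p∪q ⁅ v ⁆ , v , SubP.q⊆p∪q B ⁅ v ⁆ (SubP.x∈⁅x⁆ v) , v∉)))))
    (λ r → SubP.p⊆p∪q ⁅ v ⁆ (root∈ r)) reached′
    where
    reached′ : ∀ {x} → x ∈ B ∪ ⁅ v ⁆ → ∃ λ r → Root r × Star Step r x
    reached′ {x} x∈ with SubP.x∈p∪q⁻ B ⁅ v ⁆ x∈
    ... | inj₁ x∈B = reached x∈B
    ... | inj₂ x∈v with SubP.x∈⁅y⁆⇒x≡y v x∈v
    ...   | refl with reached u∈
    ...     | r , root , s = r , root , s ◅◅ (e ∷* []*)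

-- Sums modulo 2 and crossings of a cut

open Sum (CommutativeRing.+-commutativeMonoid BoolP.xor-∧-commutativeRing) using (sum; ∑-distrib-+; sum-permute; sum-cong-≗; sum-replicate-zero)

xor-equal : ∀ a b → a xor b ≡ false → a ≡ b
xor-equal true  true  _ = refl
xor-equal false false _ = refl

iff-≡ : ∀ {a b} → (a ≡ true → b ≡ true) → (b ≡ true → a ≡ true) → a ≡ b
iff-≡ {true}  {true}  f g = refl
iff-≡ {true}  {false} f g = sym (f refl)
iff-≡ {false} {true}  f g = g refl
iff-≡ {false} {false} f g = refl

sum-false : ∀ {k} (f : Fin k → Bool) → (∀ x → f x ≡ false) → sum f ≡ false
sum-false {k} f h = trans (sum-cong-≗ h) (sum-replicate-zero k)

-- f and f ∘ t agree, so f = f₁ + f₁ ∘ t where f₁ keeps f on the smaller point of each pair.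
sum-involution : ∀ {k} (f : Fin k → Bool) (t : Fin k → Fin k) → (∀ x → t (t x) ≡ x) → (∀ x → t x ≢ x) →
  (∀ x → f (t x) ≡ f x) → sum f ≡ false
sum-involution {k} f t inv fpf same = begin
  sum f                           ≡⟨ sum-cong-≗ split ⟩
  sum (λ x → f₁ x xor f₁ (t x))   ≡⟨ ∑-distrib-+ f₁ (λ x → f₁ (t x)) ⟩
  sum f₁ xor sum (λ x → f₁ (t x)) ≡⟨ cong (sum f₁ xor_) (sym (sum-permute f₁ (permutation t t inv inv))) ⟩
  sum f₁ xor sum f₁               ≡⟨ BoolP.xor-same (sum f₁) ⟩
  false                           ∎
  where
  open ≡-Reasoning
  f₁ : Fin k → Bool
  f₁ x = f x ∧ does (x FinP.<? t x)
  split : ∀ x → f x ≡ f₁ x xor f₁ (t x)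
  split x rewrite same x | inv x with FinP.<-cmp x (t x)
  ... | tri≈ _ e _ = contradiction (sym e) (fpf x)
  ... | tri< lt _ nlt = sym (trans (cong₂ _xor_
          (trans (cong (f x ∧_) (dec-true (x FinP.<? t x) lt)) (BoolP.∧-identityʳ (f x)))
          (trans (cong (f x ∧_) (dec-false (t x FinP.<? x) nlt)) (BoolP.∧-zeroʳ (f x)))) (BoolP.xor-identityʳ (f x)))
  ... | tri> nlt _ lt = sym (trans (cong₂ _xor_
          (trans (cong (f x ∧_) (dec-false (x FinP.<? t x) nlt)) (BoolP.∧-zeroʳ (f x)))
          (trans (cong (f x ∧_) (dec-true (t x FinP.<? x) lt)) (BoolP.∧-identityʳ (f x)))) (BoolP.xor-identityˡ (f x)))

sum-point : ∀ {k} (x₀ : Fin k) b → sum (λ x → does (x Fin.≟ x₀) ∧ b) ≡ b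
sum-point {suc k} zero b = trans (cong (b xor_) (sum-false (λ x → does (suc {k} x Fin.≟ zero) ∧ b) (λ _ → refl))) (BoolP.xor-identityʳ b)
sum-point {suc k} (suc x₀) b = sum-point x₀ b

-- Count modulo 2 the pairs of a triangle in A and a crossing side of it: every triangle has an
-- even number of crossing sides, and the sides other than (s₀ , x₀) occur in pairs.
last-crossing : ∀ {k} (t : Fin 3 → Fin k → Fin k) → (∀ s x → t s (t s x) ≡ x) → (∀ s x → t s x ≢ x) →
  (c : Fin 3 → Fin k → Bool) → (∀ s x → c s (t s x) ≡ c s x) →
  (∀ x → c zero x xor (c 1F x xor c 2F x) ≡ false) →
  (A : Fin k → Bool) → ∀ s₀ x₀ → c s₀ x₀ ≡ true →
  (∀ s x → c s x ≡ true → (s ≡ s₀ × (x ≡ x₀ ⊎ x ≡ t s₀ x₀)) ⊎ A (t s x) ≡ A x) → A (t s₀ x₀) ≡ A x₀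
last-crossing {k} t inv fpf c c-inv c-even A s₀ x₀ c₀ closed = sym (xor-equal _ _ final)
  where
  g : Fin 3 → Fin k → Bool
  g s x = A x ∧ c s x
  total : sum (g zero) xor (sum (g 1F) xor sum (g 2F)) ≡ false
  total = trans (cong (sum (g zero) xor_) (sym (∑-distrib-+ (g 1F) (g 2F))))
    (trans (sym (∑-distrib-+ (g zero) (λ x → g 1F x xor g 2F x)))
      (sum-false _ λ x → trans (factor (A x) (c zero x) (c 1F x) (c 2F x)) (trans (cong (A x ∧_) (c-even x)) (BoolP.∧-zeroʳ (A x)))))
    where
    factor : ∀ a p q r → (a ∧ p) xor ((a ∧ q) xor (a ∧ r)) ≡ a ∧ (p xor (q xor r))
    factor true  p q r = refl
    factor false p q r = refl
  other : ∀ s → s ≢ s₀ → sum (g s) ≡ false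
  other s ne = sum-involution (g s) (t s) (inv s) (fpf s) same
    where
    same : ∀ x → g s (t s x) ≡ g s x
    same x rewrite c-inv s x with c s x in e
    ... | false = trans (BoolP.∧-zeroʳ _) (sym (BoolP.∧-zeroʳ _))
    ... | true with closed s x e
    ...   | inj₁ (q , _) = contradiction q ne
    ...   | inj₂ q       = cong (_∧ true) q
  only : sum (g s₀) ≡ false
  only = pick s₀ other
    where
    pick : ∀ s → (∀ s′ → s′ ≢ s → sum (g s′) ≡ false) → sum (g s) ≡ false
    pick zero o = trans (sym (trans (cong (sum (g zero) xor_) (cong₂ _xor_ (o 1F λ ()) (o 2F λ ()))) (BoolP.xor-identityʳ _))) total
    pick 1F o = trans (sym (trans (cong₂ _xor_ (o zero λ ()) (cong (sum (g 1F) xor_) (o 2F λ ()))) (BoolP.xor-identityʳ _))) total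
    pick 2F o = trans (sym (cong₂ _xor_ (o zero λ ()) (cong (_xor sum (g 2F)) (o 1F λ ())))) total
  x₁ = t s₀ x₀
  δ₀ δ₁ h : Fin k → Bool
  δ₀ x = does (x Fin.≟ x₀) ∧ A x₀
  δ₁ x = does (x Fin.≟ x₁) ∧ A x₁
  h x = (not (does (x Fin.≟ x₀)) ∧ not (does (x Fin.≟ x₁))) ∧ g s₀ x
  decomposed : ∀ x → g s₀ x ≡ h x xor (δ₀ x xor δ₁ x)
  decomposed x with x Fin.≟ x₀ | x Fin.≟ x₁
  ... | yes refl | yes e = contradiction (sym e) (fpf s₀ x₀)
  ... | yes refl | no _  = trans (cong (A x₀ ∧_) c₀) (trans (BoolP.∧-identityʳ (A x₀)) (sym (BoolP.xor-identityʳ (A x₀))))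
  ... | no _  | yes refl = trans (cong (A x₁ ∧_) (trans (c-inv s₀ x₀) c₀)) (BoolP.∧-identityʳ (A x₁))
  ... | no _  | no _     = sym (BoolP.xor-identityʳ _)
  h-zero : sum h ≡ false
  h-zero = sum-involution h (t s₀) (inv s₀) (fpf s₀) same
    where
    free : ∀ x → x ≢ x₀ → x ≢ x₁ → g s₀ (t s₀ x) ≡ g s₀ x
    free x n₀ n₁ rewrite c-inv s₀ x with c s₀ x in e
    ... | false = trans (BoolP.∧-zeroʳ _) (sym (BoolP.∧-zeroʳ _))
    ... | true with closed s₀ x e
    ...   | inj₁ (_ , inj₁ q) = contradiction q n₀
    ...   | inj₁ (_ , inj₂ q) = contradiction q n₁
    ...   | inj₂ q            = cong (_∧ true) q
    same : ∀ x → h (t s₀ x) ≡ h x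
    same x with x Fin.≟ x₀ | x Fin.≟ x₁ | t s₀ x Fin.≟ x₀ | t s₀ x Fin.≟ x₁
    ... | yes refl | _ | _ | no ne = contradiction refl ne
    ... | yes _ | _ | yes _ | yes _ = refl
    ... | yes _ | _ | no _ | yes _ = refl
    ... | no _ | yes refl | no ne | _ = contradiction (inv s₀ x₀) ne
    ... | no _ | yes _ | yes _ | _ = refl
    ... | no _ | no ne | yes e | _ = contradiction (trans (sym (inv s₀ x)) (cong (t s₀) e)) ne
    ... | no ne | no _ | no _ | yes e = contradiction (trans (sym (inv s₀ x)) (trans (cong (t s₀) e) (inv s₀ x₀))) ne
    ... | no p | no q | no _ | no _ = free x p q
  final : A x₀ xor A x₁ ≡ false
  final = trans (sym (cong₂ _xor_ (sum-point x₀ (A x₀)) (sum-point x₁ (A x₁))))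
    (trans (sym (∑-distrib-+ δ₀ δ₁)) (trans (sym (trans (sum-cong-≗ decomposed) (trans (∑-distrib-+ h _) (cong (_xor sum (λ x → δ₀ x xor δ₁ x)) h-zero)))) only))

-- Tree and cotree of a flag map

module Surface (M : FlagMap) {V E F C : ℕ}
  (NV : NumClasses (Star (Gen2 (t1 M) (t2 M))) V) (NE : NumClasses (Star (Gen2 (t0 M) (t2 M))) E)
  (NF : NumClasses (Star (Gen2 (t0 M) (t1 M))) F) (NC : NumClasses (Star (Gen3 (t0 M) (t1 M) (t2 M))) C) where

  K = flagCount M

  τ : Fin 3 → Fin K → Fin K
  τ 0F = t0 M
  τ 1F = t1 M
  τ 2F = t2 M

  τ-inv : ∀ s x → τ s (τ s x) ≡ x
  τ-inv 0F = t0-inv M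
  τ-inv 1F = t1-inv M
  τ-inv 2F = t2-inv M

  τ-fpf : ∀ s x → τ s x ≢ x
  τ-fpf 0F = t0-fpf M
  τ-fpf 1F = t1-fpf M
  τ-fpf 2F = t2-fpf M

  τ-swap : ∀ {s x y} → τ s x ≡ y → x ≡ τ s y
  τ-swap {s} {x} e = trans (sym (τ-inv s x)) (cong (τ s) e)

  oV : Fin K → Fin V
  oV = proj₁ NV
  oE : Fin K → Fin E
  oE = proj₁ NE
  oF : Fin K → Fin F
  oF = proj₁ NF
  oC : Fin K → Fin C
  oC = proj₁ NC

  oV-1 : ∀ x → oV (t1 M x) ≡ oV x
  oV-1 x = sym (Equivalence.from (proj₂ (proj₂ NV) x _) (inj₁ refl ∷* []*))
  oV-2 : ∀ x → oV (t2 M x) ≡ oV x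
  oV-2 x = sym (Equivalence.from (proj₂ (proj₂ NV) x _) (inj₂ refl ∷* []*))
  oE-0 : ∀ x → oE (t0 M x) ≡ oE x
  oE-0 x = sym (Equivalence.from (proj₂ (proj₂ NE) x _) (inj₁ refl ∷* []*))
  oE-2 : ∀ x → oE (t2 M x) ≡ oE x
  oE-2 x = sym (Equivalence.from (proj₂ (proj₂ NE) x _) (inj₂ refl ∷* []*))
  oF-0 : ∀ x → oF (t0 M x) ≡ oF x
  oF-0 x = sym (Equivalence.from (proj₂ (proj₂ NF) x _) (inj₁ refl ∷* []*))
  oF-1 : ∀ x → oF (t1 M x) ≡ oF x
  oF-1 x = sym (Equivalence.from (proj₂ (proj₂ NF) x _) (inj₂ refl ∷* []*))
  oC-τ : ∀ s x → oC (τ s x) ≡ oC x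
  oC-τ 0F x = sym (Equivalence.from (proj₂ (proj₂ NC) x _) (inj₁ refl ∷* []*))
  oC-τ 1F x = sym (Equivalence.from (proj₂ (proj₂ NC) x _) (inj₂ (inj₁ refl) ∷* []*))
  oC-τ 2F x = sym (Equivalence.from (proj₂ (proj₂ NC) x _) (inj₂ (inj₂ refl) ∷* []*))

  oC-V : ∀ {x y} → oV x ≡ oV y → oC x ≡ oC y
  oC-V {x} {y} e = go (Equivalence.to (proj₂ (proj₂ NV) x y) e)
    where
    go : ∀ {x y} → Star (Gen2 (t1 M) (t2 M)) x y → oC x ≡ oC y
    go []* = refl
    go {x} (inj₁ refl ∷* s) = trans (sym (oC-τ 1F x)) (go s)
    go {x} (inj₂ refl ∷* s) = trans (sym (oC-τ 2F x)) (go s)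

  repV : ∀ v → ∃ λ x → oV x ≡ v
  repV = proj₁ (proj₂ NV)

  ϱ : Fin C → Fin K
  ϱ j = proj₁ (proj₁ (proj₂ NC) j)

  oC-ϱ : ∀ j → oC (ϱ j) ≡ j
  oC-ϱ j = proj₂ (proj₁ (proj₂ NC) j)

  connected : ∀ x → Star (Gen3 (t0 M) (t1 M) (t2 M)) (ϱ (oC x)) x
  connected x = Equivalence.to (proj₂ (proj₂ NC) _ x) (oC-ϱ (oC x))

  -- The tree on the vertices: breadth-first search along edges, from one vertex of each component.
  StepV : Fin V → Fin V → Set
  StepV u v = ∃ λ x → oV x ≡ u × oV (t0 M x) ≡ v

  RootV : Fin V → Set
  RootV v = ∃ λ j → oV (ϱ j) ≡ v

  reachV : ∀ v → ∃ λ r → RootV r × Star StepV r v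
  reachV v with repV v
  ... | x , refl = _ , (oC x , refl) , go (connected x)
    where
    go : ∀ {x y} → Star (Gen3 (t0 M) (t1 M) (t2 M)) x y → Star StepV (oV x) (oV y)
    go []* = []*
    go {x} (inj₁ refl ∷* s) = (x , refl , refl) ∷* go s
    go {x} {y} (inj₂ (inj₁ refl) ∷* s) = subst (λ z → Star StepV z (oV y)) (oV-1 x) (go s)
    go {x} {y} (inj₂ (inj₂ refl) ∷* s) = subst (λ z → Star StepV z (oV y)) (oV-2 x) (go s)

  module VBFS = BFS StepV (λ u v → FinP.any? λ x → (oV x Fin.≟ u) ×-dec (oV (t0 M x) Fin.≟ v))
    RootV (λ v → FinP.any? λ j → oV (ϱ j) Fin.≟ v) reachV

  ℓ : Fin V → ℕ
  ℓ = VBFS.depth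

  ℓ-step : ∀ x → ℓ (oV (t0 M x)) ≤ suc (ℓ (oV x))
  ℓ-step x = VBFS.depth-step (x , refl , refl)

  abstract
    xdata : ∀ v → ∃ λ x → oV x ≡ v × (∀ m → ℓ v ≡ suc m → ℓ (oV (t0 M x)) ≡ m)
    xdata v = go (ℓ v) refl
      where
      go : ∀ d → ℓ v ≡ d → ∃ λ x → oV x ≡ v × (∀ m → ℓ v ≡ suc m → ℓ (oV (t0 M x)) ≡ m)
      go zero e = proj₁ (repV v) , proj₂ (repV v) , λ m e′ → contradiction (trans (sym e) e′) λ ()
      go (suc d) e with VBFS.parent e
      ... | u , (x , ex , ex′) , du = t0 M x , ex′ ,
        λ m e′ → trans (cong ℓ (trans (cong oV (t0-inv M x)) ex)) (trans du (suc-injective (trans (sym e) e′)))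

  xv : Fin V → Fin K
  xv v = proj₁ (xdata v)

  oV-xv : ∀ v → oV (xv v) ≡ v
  oV-xv v = proj₁ (proj₂ (xdata v))

  par : Fin V → Fin V
  par v = oV (t0 M (xv v))

  ℓ-par : ∀ v m → ℓ v ≡ suc m → ℓ (par v) ≡ m
  ℓ-par v = proj₂ (proj₂ (xdata v))

  open Forest par ℓ ℓ-par public

  -- Two commuting involutions generate a group of at most four elements.
  orbit : ∀ {x y} → Star (Gen2 (t0 M) (t2 M)) x y → y ≡ x ⊎ y ≡ t0 M x ⊎ y ≡ t2 M x ⊎ y ≡ t0 M (t2 M x)
  orbit []* = inj₁ refl
  orbit {x} (inj₁ refl ∷* s) with orbit s
  ... | inj₁ e = inj₂ (inj₁ e)
  ... | inj₂ (inj₁ e) = inj₁ (trans e (t0-inv M x))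
  ... | inj₂ (inj₂ (inj₁ e)) = inj₂ (inj₂ (inj₂ (trans e (sym (t02-comm M x)))))
  ... | inj₂ (inj₂ (inj₂ e)) = inj₂ (inj₂ (inj₁ (trans e (trans (cong (t0 M) (sym (t02-comm M x))) (t0-inv M _)))))
  orbit {x} (inj₂ refl ∷* s) with orbit s
  ... | inj₁ e = inj₂ (inj₂ (inj₁ e))
  ... | inj₂ (inj₁ e) = inj₂ (inj₂ (inj₂ e))
  ... | inj₂ (inj₂ (inj₁ e)) = inj₁ (trans e (t2-inv M x))
  ... | inj₂ (inj₂ (inj₂ e)) = inj₂ (inj₁ (trans e (cong (t0 M) (t2-inv M x))))

  abstract
    -- The flag is taken at an end of smaller level, so that a tree edge is represented by the
    -- parent.
    edata : ∀ e → ∃ λ x → oE x ≡ e × ℓ (oV x) ≤ ℓ (oV (t0 M x))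
    edata e with proj₁ (proj₂ NE) e
    ... | x , ex with ≤-total (ℓ (oV x)) (ℓ (oV (t0 M x)))
    ...   | inj₁ le = x , ex , le
    ...   | inj₂ le = t0 M x , trans (oE-0 x) ex , ≤-trans le (≤-reflexive (cong (λ z → ℓ (oV z)) (sym (t0-inv M x))))

  xe : Fin E → Fin K
  xe e = proj₁ (edata e)

  oE-xe : ∀ e → oE (xe e) ≡ e
  oE-xe e = proj₁ (proj₂ (edata e))

  xf : Fin F → Fin K
  xf f = proj₁ (proj₁ (proj₂ NF) f)

  oF-xf : ∀ f → oF (xf f) ≡ f
  oF-xf f = proj₂ (proj₁ (proj₂ NF) f)

  -- The vertices assigned to the three corners (vertex, edge, face) of a flag; edges and
  -- faces are represented by one of their vertices.
  φ : Fin 3 → Fin K → Fin V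
  φ 0F x = oV x
  φ 1F x = oV (xe (oE x))
  φ 2F x = oV (xf (oF x))

  φ-τ : ∀ s j x → j ≢ s → φ j (τ s x) ≡ φ j x
  φ-τ 0F 0F x ne = contradiction refl ne
  φ-τ 0F 1F x ne = cong (λ e → oV (xe e)) (oE-0 x)
  φ-τ 0F 2F x ne = cong (λ f → oV (xf f)) (oF-0 x)
  φ-τ 1F 0F x ne = oV-1 x
  φ-τ 1F 1F x ne = contradiction refl ne
  φ-τ 1F 2F x ne = cong (λ f → oV (xf f)) (oF-1 x)
  φ-τ 2F 0F x ne = oV-2 x
  φ-τ 2F 1F x ne = cong (λ e → oV (xe e)) (oE-2 x)
  φ-τ 2F 2F x ne = contradiction refl ne

  φ1-end : ∀ x → (φ 1F x ≡ oV x ⊎ φ 1F x ≡ oV (t0 M x)) × ℓ (φ 1F x) ≤ ℓ (oV x)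
  φ1-end x with orbit (Equivalence.to (proj₂ (proj₂ NE) (xe (oE x)) x) (oE-xe (oE x)))
  ... | inj₁ e = inj₁ (cong oV (sym e)) , ≤-reflexive (cong (λ z → ℓ (oV z)) (sym e))
  ... | inj₂ (inj₁ e) = inj₂ (cong oV (τ-swap {0F} (sym e))) ,
          ≤-trans (proj₂ (proj₂ (edata (oE x)))) (≤-reflexive (cong (λ z → ℓ (oV z)) (sym e)))
  ... | inj₂ (inj₂ (inj₁ e)) = inj₁ (trans (sym (oV-2 _)) (cong oV (sym e))) ,
          ≤-reflexive (cong ℓ (trans (sym (oV-2 _)) (cong oV (sym e))))
  ... | inj₂ (inj₂ (inj₂ e)) = inj₂ (trans (sym (oV-2 _)) (cong oV (τ-swap {0F} (sym e)))) ,
          ≤-trans (proj₂ (proj₂ (edata (oE x)))) (≤-reflexive (cong ℓ (trans (sym (oV-2 _)) (cong oV (trans (sym (t02-comm M _)) (sym e))))))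

  -- Were this edge represented by `v`, the level bound of `φ1-end` at the other end would place `v`
  -- no deeper than its parent.
  φ1-xv : ∀ v m → ℓ v ≡ suc m → φ 1F (xv v) ≡ par v
  φ1-xv v m e with proj₁ (φ1-end (xv v))
  ... | inj₂ q = q
  ... | inj₁ q = contradiction (≤-trans (≤-reflexive (trans (sym e) (cong ℓ (trans (sym (oV-xv v)) (trans (sym q) (sym (φ-τ 0F 1F (xv v) λ ())))))))
                   (≤-trans (proj₂ (φ1-end (t0 M (xv v)))) (≤-reflexive (ℓ-par v m e)))) 1+n≰n

  TV TE TF : Fin K → Set
  TV x = ℓ (oV x) ≢ 0 × (x ≡ xv (oV x) ⊎ x ≡ t2 M (xv (oV x)))
  TE x = x ≡ xe (oE x) ⊎ x ≡ t2 M (xe (oE x))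
  TF x = x ≡ xf (oF x) ⊎ x ≡ t1 M (xf (oF x))

  TV? : ∀ x → Dec (TV x)
  TV? x = ¬? (ℓ (oV x) ℕ.≟ 0) ×-dec ((x Fin.≟ xv (oV x)) ⊎-dec (x Fin.≟ t2 M (xv (oV x))))
  TE? : ∀ x → Dec (TE x)
  TE? x = (x Fin.≟ xe (oE x)) ⊎-dec (x Fin.≟ t2 M (xe (oE x)))
  TF? : ∀ x → Dec (TF x)
  TF? x = (x Fin.≟ xf (oF x)) ⊎-dec (x Fin.≟ t1 M (xf (oF x)))

  -- The sides of flags lying on the tree in the barycentric subdivision: the halves of
  -- edges towards parents, and one segment hanging each edge and each face from a vertex.
  T : Fin 3 → Fin K → Set
  T 0F x = ⊥
  T 1F x = TF x
  T 2F x = TV x ⊎ TE x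

  T? : ∀ s x → Dec (T s x)
  T? 0F x = no λ ()
  T? 1F x = TF? x
  T? 2F x = TV? x ⊎-dec TE? x

  private
    flip : ∀ {s x z z′} → z ≡ z′ → x ≡ z ⊎ x ≡ τ s z → τ s x ≡ z′ ⊎ τ s x ≡ τ s z′
    flip {s} refl (inj₁ e) = inj₂ (cong (τ s) e)
    flip {s} refl (inj₂ e) = inj₁ (trans (cong (τ s) e) (τ-inv s _))

  T-τ : ∀ s x → T s x → T s (τ s x)
  T-τ 1F x t = flip {1F} (cong xf (sym (oF-1 x))) t
  T-τ 2F x (inj₁ (ne , t)) = inj₁ ((λ e → ne (trans (cong ℓ (sym (oV-2 x))) e)) , flip {2F} (cong xv (sym (oV-2 x))) t)
  T-τ 2F x (inj₂ t) = inj₂ (flip {2F} (cong xe (sym (oE-2 x))) t)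

  nonzero : ∀ {v} → ℓ v ≢ 0 → ∃ λ m → ℓ v ≡ suc m
  nonzero {v} ne with ℓ v
  ... | zero  = contradiction refl ne
  ... | suc m = m , refl

  sidePair : (b : Fin 3 → Bool) → Fin 3 → Bool
  sidePair b 0F = b 1F xor b 2F
  sidePair b 1F = b 0F xor b 2F
  sidePair b 2F = b 0F xor b 1F

  sidePair-even : ∀ b → sidePair b 0F xor (sidePair b 1F xor sidePair b 2F) ≡ false
  sidePair-even b with b 0F | b 1F | b 2F
  ... | true  | true  | true  = refl
  ... | true  | true  | false = refl
  ... | true  | false | true  = refl
  ... | true  | false | false = refl
  ... | false | true  | true  = refl
  ... | false | true  | false = refl
  ... | false | false | true  = refl
  ... | false | false | false = refl

  sidePair-cong : ∀ {b b′} s → (∀ j → j ≢ s → b j ≡ b′ j) → sidePair b s ≡ sidePair b′ s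
  sidePair-cong 0F h = cong₂ _xor_ (h 1F λ ()) (h 2F λ ())
  sidePair-cong 1F h = cong₂ _xor_ (h 0F λ ()) (h 2F λ ())
  sidePair-cong 2F h = cong₂ _xor_ (h 0F λ ()) (h 1F λ ())

  below : Fin V → Fin V → Bool
  below y v = does (anc? y v)

  cross : Fin V → Fin 3 → Fin K → Bool
  cross y s x = sidePair (λ j → below y (φ j x)) s

  cross-τ : ∀ y s x → cross y s (τ s x) ≡ cross y s x
  cross-τ y s x = sidePair-cong s λ j ne → cong (below y) (φ-τ s j x ne)

  below-par : ∀ {y v m} → ℓ v ≡ suc m → y ≢ v → below y (par v) ≡ below y v
  below-par {y} {v} e ne with anc? y v
  ... | yes a = dec-true (anc? y (par v)) (proj₂ (proj₂ (anc-par a ne)))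
  ... | no ¬a = dec-false (anc? y (par v)) λ a → ¬a (anc-step e a)

  private
    at : ∀ {x z} → x ≡ z ⊎ x ≡ t2 M z → φ 0F x ≡ φ 0F z × φ 1F x ≡ φ 1F z
    at (inj₁ refl) = refl , refl
    at {z = z} (inj₂ refl) = φ-τ 2F 0F z (λ ()) , φ-τ 2F 1F z λ ()

    xor-not : ∀ {b c} → b ≡ c → b xor c ≢ true
    xor-not {b} refl e = contradiction (trans (sym e) (BoolP.xor-same b)) λ ()

  -- A tree side joins two corners assigned to one vertex, or to a vertex and its parent. The latter
  -- leaves the subtree of `y` only when that vertex is `y`.
  cross-T : ∀ y s x → T s x → cross y s x ≡ true → s ≡ 2F × (x ≡ xv y ⊎ x ≡ t2 M (xv y))
  cross-T y 1F x t c = contradiction c (xor-not (cong (below y) (eq t)))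
    where
    eq : TF x → oV x ≡ oV (xf (oF x))
    eq (inj₁ e) = cong oV e
    eq (inj₂ e) = trans (cong oV e) (oV-1 _)
  cross-T y 2F x (inj₂ t) c = contradiction c (xor-not (cong (below y) (eq t)))
    where
    eq : TE x → oV x ≡ oV (xe (oE x))
    eq (inj₁ e) = cong oV e
    eq (inj₂ e) = trans (cong oV e) (oV-2 _)
  cross-T y 2F x (inj₁ (ne , t)) c with y Fin.≟ oV x
  ... | yes refl = refl , t
  ... | no y≢ with nonzero ne
  ...   | m , e = contradiction c (xor-not (sym (trans (cong (below y) (trans (proj₂ (at t)) (φ1-xv (oV x) m e))) (below-par e y≢))))

  cross-own : ∀ y m → ℓ y ≡ suc m → cross y 2F (xv y) ≡ true
  cross-own y m e = trans (cong₂ (λ a b → below y a xor below y b) (oV-xv y) (φ1-xv y m e))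
    (cong₂ _xor_ (dec-true (anc? y y) (anc-refl y))
      (dec-false (anc? y (par y)) λ a → contradiction (≤-trans (≤-reflexive (sym e)) (≤-trans (anc-lev a) (≤-reflexive (ℓ-par y m e)))) 1+n≰n))

  module _ (A : Fin K → Bool) (closed : ∀ s x → ¬ T s x → A (τ s x) ≡ A x) where

    private
      -- The cut consists of the sides at the centre of face `f`; the only tree side among them is
      -- the one hanging `f`.
      allF : ∀ f → A (t1 M (xf f)) ≡ A (xf f)
      allF f = last-crossing τ τ-inv τ-fpf c c-τ (λ x → sidePair-even (β x)) A 1F (xf f)
          (dec-true (oF (xf f) Fin.≟ f) (oF-xf f)) cl
        where
        β : Fin K → Fin 3 → Bool
        β x 0F = false
        β x 1F = false
        β x 2F = does (oF x Fin.≟ f)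
        c : Fin 3 → Fin K → Bool
        c s x = sidePair (β x) s
        c-τ : ∀ s x → c s (τ s x) ≡ c s x
        c-τ 0F x = cong (λ g → does (g Fin.≟ f)) (oF-0 x)
        c-τ 1F x = cong (λ g → does (g Fin.≟ f)) (oF-1 x)
        c-τ 2F x = refl
        cl : ∀ s x → c s x ≡ true → (s ≡ 1F × (x ≡ xf f ⊎ x ≡ t1 M (xf f))) ⊎ A (τ s x) ≡ A x
        cl 0F x e = inj₂ (closed 0F x λ ())
        cl 2F x ()
        cl 1F x e with TF? x | oF x Fin.≟ f
        ... | no ¬t | _        = inj₂ (closed 1F x ¬t)
        ... | yes t | yes refl = inj₁ (refl , t)

      -- The cut surrounds the subtree of `y`, and its only tree side leads from `y` to its parent.
      allV : ∀ y m → ℓ y ≡ suc m → A (t2 M (xv y)) ≡ A (xv y)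
      allV y m e = last-crossing τ τ-inv τ-fpf (cross y) (cross-τ y) (λ x → sidePair-even (λ j → below y (φ j x))) A 2F (xv y) (cross-own y m e) cl
        where
        cl : ∀ s x → cross y s x ≡ true → (s ≡ 2F × (x ≡ xv y ⊎ x ≡ t2 M (xv y))) ⊎ A (τ s x) ≡ A x
        cl s x c with T? s x
        ... | no ¬t = inj₂ (closed s x ¬t)
        ... | yes t = inj₁ (cross-T y s x t c)

      both : ∀ {s x z} → A (τ s z) ≡ A z → x ≡ z ⊎ x ≡ τ s z → A (τ s x) ≡ A x
      both h (inj₁ refl) = h
      both {s} {z = z} h (inj₂ refl) = trans (cong A (τ-inv s z)) (sym h)

      allTV : ∀ x → TV x → A (t2 M x) ≡ A x
      allTV x (ne , t) = both {2F} (allV (oV x) (proj₁ (nonzero ne)) (proj₂ (nonzero ne))) t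

      -- Around the edge one can go the other way, where the side is not a TE-side.
      allE : ∀ e → A (t2 M (xe e)) ≡ A (xe e)
      allE e = trans (sym (closed 0F (t2 M x) λ ())) (trans (cong A (t02-comm M x)) (trans (far (T? 2F (t0 M x))) (closed 0F x λ ())))
        where
        x = xe e
        same : oE (t0 M x) ≡ e
        same = trans (oE-0 x) (oE-xe e)
        far : Dec (T 2F (t0 M x)) → A (t2 M (t0 M x)) ≡ A (t0 M x)
        far (no ¬t) = closed 2F (t0 M x) ¬t
        far (yes (inj₁ t)) = allTV (t0 M x) t
        far (yes (inj₂ (inj₁ q))) = contradiction (trans q (cong xe same)) (t0-fpf M x)
        far (yes (inj₂ (inj₂ q))) = contradiction
          (trans (cong (t0 M) (sym (trans q (cong (λ z → t2 M (xe z)) same)))) (t0-inv M x)) (t02-fpf M x)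

    allClosed : ∀ s x → A (τ s x) ≡ A x
    allClosed s x with T? s x
    ... | no ¬t = closed s x ¬t
    allClosed 1F x | yes t = both {1F} (allF (oF x)) t
    allClosed 2F x | yes (inj₁ t) = allTV x t
    allClosed 2F x | yes (inj₂ t) = both {2F} (allE (oE x)) t

  -- The spanning forest of the dual: breadth-first search on flags through sides off the tree.
  StepD : Fin K → Fin K → Set
  StepD x y = ∃ λ s → ¬ T s x × τ s x ≡ y

  stepD? : ∀ x y → Dec (StepD x y)
  stepD? x y = FinP.any? λ s → ¬? (T? s x) ×-dec (τ s x Fin.≟ y)

  RootD : Fin K → Set
  RootD x = ∃ λ j → ϱ j ≡ x

  rootD? : ∀ x → Dec (RootD x)
  rootD? x = FinP.any? λ j → ϱ j Fin.≟ x

  abstract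
    -- The flags reachable off the tree from the dual roots form a set closed under such steps,
    -- hence by `allClosed` under all steps. So the tree does not disconnect the dual of any
    -- component.
    reachD : ∀ x → ∃ λ r → RootD r × Star StepD r x
    reachD x = Closure.reached cl (inB (go (connected x) (trans (sym (VecP.[]=⇒lookup (Closure.root∈ cl (oC x , refl)))) refl)))
      where
      cl : Closure StepD RootD
      cl = closure stepD? rootD?
      A : Fin K → Bool
      A y = lookup (Closure.B cl) y
      inB : ∀ {y} → true ≡ A y → y ∈ Closure.B cl
      inB {y} e = VecP.lookup⇒[]= y _ (sym e)
      pass : ∀ s y → ¬ T s y → A y ≡ true → A (τ s y) ≡ true
      pass s y ¬t e = VecP.[]=⇒lookup (Closure.closed cl (s , ¬t , refl) (inB (sym e)))
      closedA : ∀ s y → ¬ T s y → A (τ s y) ≡ A y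
      closedA s y ¬t = iff-≡
        (λ e → trans (cong A (sym (τ-inv s y))) (pass s (τ s y) (λ t → ¬t (subst (T s) (τ-inv s y) (T-τ s _ t))) e))
        (pass s y ¬t)
      go : ∀ {y z} → Star (Gen3 (t0 M) (t1 M) (t2 M)) y z → true ≡ A y → true ≡ A z
      go []* e = e
      go {y} (inj₁ refl ∷* s) e = go s (trans e (sym (allClosed A closedA 0F y)))
      go {y} (inj₂ (inj₁ refl) ∷* s) e = go s (trans e (sym (allClosed A closedA 1F y)))
      go {y} (inj₂ (inj₂ refl) ∷* s) e = go s (trans e (sym (allClosed A closedA 2F y)))

  module DBFS = BFS StepD stepD? RootD rootD? reachD

  dd : Fin K → ℕ
  dd = DBFS.depth

  abstract
    ddata : ∀ x → ∃ λ s → ∀ m → dd x ≡ suc m → ¬ T s x × dd (τ s x) ≡ m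
    ddata x = go (dd x) refl
      where
      Good : Fin 3 → Set
      Good s = ∀ m → dd x ≡ suc m → ¬ T s x × dd (τ s x) ≡ m
      via : ∀ {d u} → dd x ≡ suc d → StepD u x → dd u ≡ d → ∃ Good
      via {u = u} e (s , ¬t , q) du = s , λ m e′ →
        (λ t → ¬t (subst (T s) back (T-τ s x t))) , trans (cong dd back) (trans du (suc-injective (trans (sym e) e′)))
        where
        back : τ s x ≡ u
        back = trans (cong (τ s) (sym q)) (τ-inv s u)
      go : ∀ d → dd x ≡ d → ∃ Good
      go zero e = 0F , λ m e′ → contradiction (trans (sym e) e′) λ ()
      go (suc d) e = via e (proj₁ (proj₂ (DBFS.parent e))) (proj₂ (proj₂ (DBFS.parent e)))

  sD : Fin K → Fin 3
  sD x = proj₁ (ddata x)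

  pD : Fin K → Fin K
  pD x = τ (sD x) x

  dd-pD : ∀ x m → dd x ≡ suc m → dd (pD x) ≡ m
  dd-pD x m e = proj₂ (proj₂ (ddata x) m e)

  sD-free : ∀ x m → dd x ≡ suc m → ¬ T (sD x) x
  sD-free x m e = proj₁ (proj₂ (ddata x) m e)

  module DF = Forest pD dd dd-pD

  -- Sides are recorded from both adjacent flags: a dual forest edge is a `ParentSide` from one and
  -- a `Child` from the other, and a leftover side occurs twice in `X`. This is the factor 2 in
  -- `q≤`.
  ParentSide Child X : Fin 3 → Fin K → Set
  ParentSide s x = dd x ≢ 0 × sD x ≡ s
  Child s x = dd (τ s x) ≢ 0 × sD (τ s x) ≡ s
  X s x = ¬ T s x × ¬ ParentSide s x × ¬ Child s x

  parentSide? : ∀ s x → Dec (ParentSide s x)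
  parentSide? s x = ¬? (dd x ℕ.≟ 0) ×-dec (sD x Fin.≟ s)
  child? : ∀ s x → Dec (Child s x)
  child? s x = parentSide? s (τ s x)
  X? : ∀ s x → Dec (X s x)
  X? s x = ¬? (T? s x) ×-dec (¬? (parentSide? s x) ×-dec ¬? (child? s x))

  child-pD : ∀ {s x} → Child s x → pD (τ s x) ≡ x
  child-pD {s} {x} (_ , e) = trans (cong (λ z → τ z (τ s x)) e) (τ-inv s x)

  child-dd : ∀ {s x} → Child s x → dd (τ s x) ≡ suc (dd x)
  child-dd {s} {x} ch = go (dd (τ s x)) refl
    where
    go : ∀ d → dd (τ s x) ≡ d → dd (τ s x) ≡ suc (dd x)
    go zero    e = contradiction e (proj₁ ch)
    go (suc m) e = trans e (cong suc (sym (trans (cong dd (sym (child-pD ch))) (dd-pD (τ s x) m e))))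

-- Counting the remaining sides by Euler's formula

Inj : ∀ {A B : Set} → (A → B) → Set
Inj f = ∀ {x y} → f x ≡ f y → x ≡ y

inj-⊎ : ∀ {A B D : Set} {f : A → D} {g : B → D} → Inj f → Inj g → (∀ a b → f a ≢ g b) → Inj [ f , g ]′
inj-⊎ fi gi d {inj₁ x} {inj₁ y} e = cong inj₁ (fi e)
inj-⊎ fi gi d {inj₂ x} {inj₂ y} e = cong inj₂ (gi e)
inj-⊎ fi gi d {inj₁ x} {inj₂ y} e = contradiction e (d x y)
inj-⊎ fi gi d {inj₂ x} {inj₁ y} e = contradiction (sym e) (d y x)

_↪_ : Set → Set → Set
A ↪ B = Σ (A → B) Inj

splitAt-inj : ∀ m n → Inj (splitAt m {n})
splitAt-inj m n {x} {y} e = trans (sym (FinP.join-splitAt m n x)) (trans (cong (join m n) e) (FinP.join-splitAt m n y))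

map-inj : ∀ {A B A′ B′ : Set} → A ↪ A′ → B ↪ B′ → (A ⊎ B) ↪ (A′ ⊎ B′)
map-inj (f , fi) (g , gi) = [ (λ x → inj₁ (f x)) , (λ y → inj₂ (g y)) ]′ ,
  inj-⊎ (λ e → fi (SumP.inj₁-injective e)) (λ e → gi (SumP.inj₂-injective e)) (λ _ _ ())

_⨟_ : ∀ {A B D : Set} → A ↪ B → B ↪ D → A ↪ D
(f , fi) ⨟ (g , gi) = (λ x → g (f x)) , λ e → fi (gi e)

fromFin-⊎ : ∀ {m n} {B : Set} → Fin n ↪ B → Fin (m + n) ↪ (Fin m ⊎ B)
fromFin-⊎ {m} {n} b = (splitAt m , splitAt-inj m n) ⨟ map-inj ((λ x → x) , λ e → e) b

joins : ∀ {m n} → (Fin m ⊎ Fin n) ↪ Fin (m + n)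
joins {m} {n} = join m n , λ {x} {y} → join-inj x y

pairs : ∀ {n} → Fin (n * 2) ↪ (Fin n × Fin 2)
pairs {n} = remQuot 2 , λ {x} {y} e → trans (sym (FinP.combine-remQuot {n} 2 x)) (trans (cong (λ z → combine (proj₁ z) (proj₂ z)) e) (FinP.combine-remQuot {n} 2 y))

unpairs : ∀ {m n} → (Fin m × Fin n) ↪ Fin (m * n)
unpairs = (λ z → combine (proj₁ z) (proj₂ z)) , λ {x} {y} e → cong₂ _,_ (FinP.combine-injectiveˡ (proj₁ x) (proj₂ x) (proj₁ y) (proj₂ y) e) (FinP.combine-injectiveʳ (proj₁ x) (proj₂ x) (proj₁ y) (proj₂ y) e)

module Count (M : FlagMap) {V E F C : ℕ}
  (NV : NumClasses (Star (Gen2 (t1 M) (t2 M))) V) (NE : NumClasses (Star (Gen2 (t0 M) (t2 M))) E)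
  (NF : NumClasses (Star (Gen2 (t0 M) (t1 M))) F) (NC : NumClasses (Star (Gen3 (t0 M) (t1 M) (t2 M))) C) where

  open Surface M NV NE NF NC

  XSide : Fin (3 * K) → Set
  XSide z = X (proj₁ (remQuot {3} K z)) (proj₂ (remQuot {3} K z))

  abstract
    enumX : Enumeration XSide
    enumX = enumerate λ z → X? _ _

  q : ℕ
  q = Enumeration.count enumX

  xside : Fin q → Fin 3 × Fin K
  xside i = remQuot {3} K (Enumeration.elem enumX i)

  xside-inj : Inj xside
  xside-inj {i} {j} e = Enumeration.elem-inj enumX (trans (sym (FinP.combine-remQuot {3} K _))
    (trans (cong (λ z → combine (proj₁ z) (proj₂ z)) e) (FinP.combine-remQuot {3} K _)))

  xside-X : ∀ i → X (proj₁ (xside i)) (proj₂ (xside i))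
  xside-X = Enumeration.elem-P enumX

  xside-index : ∀ s x → X s x → ∃ λ i → xside i ≡ (s , x)
  xside-index s x h with Enumeration.index enumX (combine s x) (subst (λ z → X (proj₁ z) (proj₂ z)) (sym (FinP.remQuot-combine s x)) h)
  ... | i , e = i , trans (cong (remQuot {3} K) e) (FinP.remQuot-combine s x)

  private
    -- The 3K pairs of a side and a flag, with two spare places for each tree root and each dual
    -- root, so that every vertex, edge, face and flag owns exactly two places. `kind` separates
    -- these four owners and the leftover sides.
    Slot : Set
    Slot = Fin 3 × Fin K ⊎ (Fin C × Fin 2 ⊎ Fin C × Fin 2)

    pick : ∀ {A : Set} → A → A → Fin 2 → A
    pick a b zero    = a
    pick a b (suc _) = b

    pick-inj : ∀ {A : Set} {a b : A} → a ≢ b → Inj (pick a b)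
    pick-inj ne {zero}     {zero}     e = refl
    pick-inj ne {zero}     {1F} e = contradiction e ne
    pick-inj ne {1F} {zero}     e = contradiction (sym e) ne
    pick-inj ne {1F} {1F} e = refl

    pick-cases : ∀ {s : Fin 3} {z} b → pick z (τ s z) b ≡ z ⊎ pick z (τ s z) b ≡ τ s z
    pick-cases zero       = inj₁ refl
    pick-cases 1F = inj₂ refl

    kindT : ∀ s x → Dec (T s x) → Fin 5
    kindT s x (no _) with X? s x
    ... | yes _ = 4F
    ... | no _  = 3F
    kindT zero x (yes _) = zero
    kindT 1F x (yes _) = 2F
    kindT 2F x (yes _) with TV? x
    ... | yes _ = zero
    ... | no _  = 1F

    kind : Slot → Fin 5
    kind (inj₁ (s , x)) = kindT s x (T? s x)
    kind (inj₂ (inj₁ _)) = zero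
    kind (inj₂ (inj₂ _)) = 3F

    kind-V : ∀ x d → TV x → kindT 2F x d ≡ zero
    kind-V x (no ¬t) t = contradiction (inj₁ t) ¬t
    kind-V x (yes _) t with TV? x
    ... | yes _ = refl
    ... | no ¬t = contradiction t ¬t

    kind-E : ∀ x d → TE x → ¬ TV x → kindT 2F x d ≡ 1F
    kind-E x (no ¬t) t ¬v = contradiction (inj₂ t) ¬t
    kind-E x (yes _) t ¬v with TV? x
    ... | yes v = contradiction v ¬v
    ... | no _ = refl

    kind-F : ∀ x d → TF x → kindT 1F x d ≡ 2F
    kind-F x (no ¬t) t = contradiction t ¬t
    kind-F x (yes _) t = refl

    kind-D : ∀ s x d → ¬ T s x → ¬ X s x → kindT s x d ≡ 3F
    kind-D s x (yes t) ¬t ¬x = contradiction t ¬t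
    kind-D s x (no _) ¬t ¬x with X? s x
    ... | yes h = contradiction h ¬x
    ... | no _  = refl

    kind-X : ∀ s x d → X s x → kindT s x d ≡ 4F
    kind-X s x (yes t) h = contradiction t (proj₁ h)
    kind-X s x (no _) h with X? s x
    ... | yes _ = refl
    ... | no ¬x = contradiction h ¬x

    disjoint : ∀ {a b c d} → kind a ≡ c → kind b ≡ d → c ≢ d → a ≢ b
    disjoint p r ne e = ne (trans (sym p) (trans (cong kind e) r))

    fE : Fin E × Fin 2 → Slot
    fE (e , b) = inj₁ (2F , pick (xe e) (t2 M (xe e)) b)

    oE-flag : ∀ e b → oE (pick (xe e) (t2 M (xe e)) b) ≡ e
    oE-flag e zero = oE-xe e
    oE-flag e 1F = trans (oE-2 _) (oE-xe e)

    fE-inj : Inj fE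
    fE-inj {e , b} {e′ , b′} q with cong proj₂ (SumP.inj₁-injective q)
    ... | q′ with trans (sym (oE-flag e b)) (trans (cong oE q′) (oE-flag e′ b′))
    ...   | refl = cong (e ,_) (pick-inj (λ r → t2-fpf M (xe e) (sym r)) q′)

    fE-TE : ∀ e b → TE (pick (xe e) (t2 M (xe e)) b)
    fE-TE e b rewrite oE-flag e b = pick-cases {2F} b

    oV-E : ∀ {x} → TE x → oV x ≡ φ 1F x
    oV-E (inj₁ r) = cong oV r
    oV-E (inj₂ r) = trans (cong oV r) (oV-2 _)

    -- On a `TE` side the edge is represented by the vertex of the flag itself, on a `TV` side by
    -- the parent, which has smaller level.
    TE-not-TV : ∀ x → TE x → ¬ TV x
    TE-not-TV x te (ne , tv) with nonzero ne
    ... | m , e = contradiction (≤-reflexive (trans (sym e) (trans (cong ℓ (trans (oV-E te) (trans (at tv) (φ1-xv (oV x) m e)))) (ℓ-par (oV x) m e)))) 1+n≰n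
      where
      at : ∀ {z} → x ≡ z ⊎ x ≡ t2 M z → φ 1F x ≡ φ 1F z
      at (inj₁ refl) = refl
      at {z} (inj₂ refl) = φ-τ 2F 1F z λ ()

    kind-fE : ∀ a → kind (fE a) ≡ 1F
    kind-fE (e , b) = kind-E _ (T? 2F (pick (xe e) (t2 M (xe e)) b)) (fE-TE e b) (TE-not-TV _ (fE-TE e b))

    fF : Fin F × Fin 2 → Slot
    fF (f , b) = inj₁ (1F , pick (xf f) (t1 M (xf f)) b)

    oF-flag : ∀ f b → oF (pick (xf f) (t1 M (xf f)) b) ≡ f
    oF-flag f zero = oF-xf f
    oF-flag f 1F = trans (oF-1 _) (oF-xf f)

    fF-inj : Inj fF
    fF-inj {e , b} {e′ , b′} q with cong proj₂ (SumP.inj₁-injective q)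
    ... | q′ with trans (sym (oF-flag e b)) (trans (cong oF q′) (oF-flag e′ b′))
    ...   | refl = cong (e ,_) (pick-inj (λ r → t1-fpf M (xf e) (sym r)) q′)

    fF-TF : ∀ f b → TF (pick (xf f) (t1 M (xf f)) b)
    fF-TF f b rewrite oF-flag f b = pick-cases {1F} b

    kind-fF : ∀ a → kind (fF a) ≡ 2F
    kind-fF (f , b) = kind-F _ (T? 1F (pick (xf f) (t1 M (xf f)) b)) (fF-TF f b)

    vFlag : Fin V → Fin 2 → Fin K
    vFlag v = pick (xv v) (t2 M (xv v))

    oV-flag : ∀ v b → oV (vFlag v b) ≡ v
    oV-flag v zero = oV-xv v
    oV-flag v 1F = trans (oV-2 _) (oV-xv v)

    fV′ : ∀ v → Dec (ℓ v ≡ 0) → Fin 2 → Slot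
    fV′ v (yes e) b = inj₂ (inj₁ (proj₁ (VBFS.depth-zero e) , b))
    fV′ v (no _)  b = inj₁ (2F , vFlag v b)

    fV : Fin V × Fin 2 → Slot
    fV (v , b) = fV′ v (ℓ v ℕ.≟ 0) b

    fV′-inj : ∀ v v′ d d′ b b′ → fV′ v d b ≡ fV′ v′ d′ b′ → _≡_ {A = Fin V × Fin 2} (v , b) (v′ , b′)
    fV′-inj v v′ (yes e) (yes e′) b b′ q with SumP.inj₁-injective (SumP.inj₂-injective q)
    ... | q′ = cong₂ _,_ (trans (sym (proj₂ (VBFS.depth-zero e))) (trans (cong (λ z → oV (ϱ (proj₁ z))) q′) (proj₂ (VBFS.depth-zero e′)))) (cong proj₂ q′)
    fV′-inj v v′ (no _) (no _) b b′ q with cong proj₂ (SumP.inj₁-injective q)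
    ... | q′ with trans (sym (oV-flag v b)) (trans (cong oV q′) (oV-flag v′ b′))
    ...   | refl = cong (v ,_) (pick-inj (λ r → t2-fpf M (xv v) (sym r)) q′)

    fV-inj : Inj fV
    fV-inj {v , b} {v′ , b′} = fV′-inj v v′ (ℓ v ℕ.≟ 0) (ℓ v′ ℕ.≟ 0) b b′

    kind-fV′ : ∀ v d b → kind (fV′ v d b) ≡ zero
    kind-fV′ v (yes _) b = refl
    kind-fV′ v (no ne) b = kind-V _ (T? 2F (vFlag v b)) ((λ e → ne (trans (cong ℓ (sym (oV-flag v b))) e)) , own)
      where
      own : vFlag v b ≡ xv (oV (vFlag v b)) ⊎ vFlag v b ≡ t2 M (xv (oV (vFlag v b)))
      own rewrite oV-flag v b = pick-cases {2F} b

    kind-fV : ∀ a → kind (fV a) ≡ zero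
    kind-fV (v , b) = kind-fV′ v (ℓ v ℕ.≟ 0) b

    fD′ : ∀ x → Dec (dd x ≡ 0) → Fin 2 → Slot
    fD′ x (yes e) b = inj₂ (inj₂ (proj₁ (DBFS.depth-zero e) , b))
    fD′ x (no _)  b = inj₁ (sD x , pick x (pD x) b)

    fD : Fin K × Fin 2 → Slot
    fD (x , b) = fD′ x (dd x ℕ.≟ 0) b

    dnz : ∀ {x} → dd x ≢ 0 → ∃ λ m → dd x ≡ suc m
    dnz {x} ne = go (dd x) refl
      where
      go : ∀ d → dd x ≡ d → ∃ λ m → dd x ≡ suc m
      go zero    e = contradiction e ne
      go (suc m) e = m , e

    -- With different selectors each flag would be the parent of the other, which the depths forbid.
    fD-same : ∀ x x′ b b′ → dd x ≢ 0 → dd x′ ≢ 0 → sD x ≡ sD x′ → pick x (pD x) b ≡ pick x′ (pD x′) b′ → _≡_ {A = Fin K × Fin 2} (x , b) (x′ , b′)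
    fD-same x x′ zero zero n n′ s e = cong (_, zero) e
    fD-same x x′ 1F 1F n n′ s e = cong (_, 1F) (trans (τ-swap {sD x} refl) (trans (cong₂ τ s e) (τ-inv (sD x′) x′)))
    fD-same x x′ zero 1F n n′ s e = ⊥-elim (cycle (dnz n) (dnz n′))
      where
      cycle : (∃ λ m → dd x ≡ suc m) → (∃ λ m → dd x′ ≡ suc m) → ⊥
      cycle (m , p) (m′ , p′) = contradiction (≤-reflexive (trans (sym p′) (trans (cong dd (trans (τ-swap {sD x′} (sym e)) (cong (λ z → τ z x) (sym s)))) (dd-pD x m p))))
        (<⇒≱ (≤-trans (≤-reflexive (trans (sym p) (trans (cong dd e) (dd-pD x′ m′ p′)))) (n≤1+n m′)))
    fD-same x x′ 1F zero n n′ s e = ⊥-elim (cycle (dnz n) (dnz n′))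
      where
      cycle : (∃ λ m → dd x ≡ suc m) → (∃ λ m → dd x′ ≡ suc m) → ⊥
      cycle (m , p) (m′ , p′) = contradiction (≤-reflexive (trans (sym p) (trans (cong dd (trans (τ-swap {sD x} e) (cong (λ z → τ z x′) s))) (dd-pD x′ m′ p′))))
        (<⇒≱ (≤-trans (≤-reflexive (trans (sym p′) (trans (cong dd (sym e)) (dd-pD x m p)))) (n≤1+n m)))

    fD′-inj : ∀ x x′ d d′ b b′ → fD′ x d b ≡ fD′ x′ d′ b′ → _≡_ {A = Fin K × Fin 2} (x , b) (x′ , b′)
    fD′-inj x x′ (yes e) (yes e′) b b′ q with SumP.inj₂-injective (SumP.inj₂-injective q)
    ... | q′ = cong₂ _,_ (trans (sym (proj₂ (DBFS.depth-zero e))) (trans (cong (λ z → ϱ (proj₁ z)) q′) (proj₂ (DBFS.depth-zero e′)))) (cong proj₂ q′)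
    fD′-inj x x′ (no n) (no n′) b b′ q with SumP.inj₁-injective q
    ... | q′ = fD-same x x′ b b′ n n′ (cong proj₁ q′) (cong proj₂ q′)

    fD-inj : Inj fD
    fD-inj {x , b} {x′ , b′} = fD′-inj x x′ (dd x ℕ.≟ 0) (dd x′ ℕ.≟ 0) b b′

    kind-fD′ : ∀ x d b → kind (fD′ x d b) ≡ 3F
    kind-fD′ x (yes _) b = refl
    kind-fD′ x (no n) zero = kind-D (sD x) x (T? (sD x) x) (sD-free x _ (proj₂ (dnz n))) λ h → proj₁ (proj₂ h) (n , refl)
    kind-fD′ x (no n) 1F = kind-D (sD x) (pD x) (T? (sD x) (pD x))
      (λ t → sD-free x _ (proj₂ (dnz n)) (subst (T (sD x)) (τ-inv (sD x) x) (T-τ (sD x) (pD x) t)))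
      λ h → proj₂ (proj₂ h) (subst (λ z → dd z ≢ 0 × sD z ≡ sD x) (sym (τ-inv (sD x) x)) (n , refl))

    kind-fD : ∀ a → kind (fD a) ≡ 3F
    kind-fD (x , b) = kind-fD′ x (dd x ℕ.≟ 0) b

    fX : Fin q → Slot
    fX i = inj₁ (xside i)

    kind-fX : ∀ i → kind (fX i) ≡ 4F
    kind-fX i = kind-X (proj₁ (xside i)) (proj₂ (xside i)) (T? _ _) (xside-X i)

    source : Fin (V * 2 + (E * 2 + (F * 2 + (K * 2 + q)))) ↪
      (Fin V × Fin 2 ⊎ (Fin E × Fin 2 ⊎ (Fin F × Fin 2 ⊎ (Fin K × Fin 2 ⊎ Fin q))))
    source = fromFin-⊎ (fromFin-⊎ (fromFin-⊎ (fromFin-⊎ ((λ x → x) , λ e → e)))) ⨟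
      map-inj pairs (map-inj pairs (map-inj pairs (map-inj pairs ((λ x → x) , λ e → e))))

    target : Slot ↪ Fin (3 * K + (C * 2 + C * 2))
    target = map-inj unpairs (map-inj unpairs unpairs ⨟ joins) ⨟ joins

    all : (Fin V × Fin 2 ⊎ (Fin E × Fin 2 ⊎ (Fin F × Fin 2 ⊎ (Fin K × Fin 2 ⊎ Fin q)))) ↪ Slot
    all = [ fV , [ fE , [ fF , [ fD , fX ]′ ]′ ]′ ]′ ,
      inj-⊎ fV-inj
        (inj-⊎ fE-inj
          (inj-⊎ fF-inj
            (inj-⊎ fD-inj (λ e → xside-inj (SumP.inj₁-injective e)) (λ a b → disjoint (kind-fD a) (kind-fX b) λ ()))
            (λ { a (inj₁ b) → disjoint (kind-fF a) (kind-fD b) λ () ; a (inj₂ b) → disjoint (kind-fF a) (kind-fX b) λ () }))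
          (λ { a (inj₁ b) → disjoint (kind-fE a) (kind-fF b) λ () ; a (inj₂ (inj₁ b)) → disjoint (kind-fE a) (kind-fD b) λ ()
             ; a (inj₂ (inj₂ b)) → disjoint (kind-fE a) (kind-fX b) λ () }))
        (λ { a (inj₁ b) → disjoint (kind-fV a) (kind-fE b) λ () ; a (inj₂ (inj₁ b)) → disjoint (kind-fV a) (kind-fF b) λ ()
           ; a (inj₂ (inj₂ (inj₁ b))) → disjoint (kind-fV a) (kind-fD b) λ () ; a (inj₂ (inj₂ (inj₂ b))) → disjoint (kind-fV a) (kind-fX b) λ () })

  sides≤ : V * 2 + (E * 2 + (F * 2 + (K * 2 + q))) ≤ 3 * K + (C * 2 + C * 2)
  sides≤ = FinP.injective⇒≤ (proj₂ (source ⨟ (all ⨟ target)))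

  flags≤ : K ≤ E * 4
  flags≤ = FinP.injective⇒≤ (proj₂ (embed ⨟ unpairs))
    where
    decode : Fin E × Fin 4 → Fin K
    decode (e , zero) = xe e
    decode (e , 1F) = t0 M (xe e)
    decode (e , 2F) = t2 M (xe e)
    decode (e , 3F) = t0 M (t2 M (xe e))
    code : ∀ x → ∃ λ b → x ≡ decode (oE x , b)
    code x with orbit (Equivalence.to (proj₂ (proj₂ NE) (xe (oE x)) x) (oE-xe (oE x)))
    ... | inj₁ r = zero , r
    ... | inj₂ (inj₁ r) = 1F , r
    ... | inj₂ (inj₂ (inj₁ r)) = 2F , r
    ... | inj₂ (inj₂ (inj₂ r)) = 3F , r
    embed : Fin K ↪ (Fin E × Fin 4)
    embed = (λ x → oE x , proj₁ (code x)) , λ {x} {y} e → trans (proj₂ (code x)) (trans (cong decode e) (sym (proj₂ (code y))))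

  -- The places give 2V + 2E + 2F + 2K + q ≤ 3K + 4C. With K ≤ 4E this leaves 2V + 2F + q ≤ 2E + 4C,
  -- and by Euler's formula the right side is 2(g + V + F).
  q≤ : ∀ g → g + V + F ≡ 2 * C + E → q ≤ 2 * g
  q≤ g eq = +-cancelˡ-≤ (2 * V + 2 * E + 2 * F) _ _ (+-cancelˡ-≤ (2 * K) _ _ (begin
    2 * K + (2 * V + 2 * E + 2 * F + q)                  ≡⟨ solve 5 (λ K V E F q → con 2 :* K :+ (con 2 :* V :+ con 2 :* E :+ con 2 :* F :+ q)
                                                              := V :* con 2 :+ (E :* con 2 :+ (F :* con 2 :+ (K :* con 2 :+ q)))) refl K V E F q ⟩
    V * 2 + (E * 2 + (F * 2 + (K * 2 + q)))              ≤⟨ sides≤ ⟩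
    3 * K + (C * 2 + C * 2)                              ≡⟨ solve 2 (λ K C → con 3 :* K :+ (C :* con 2 :+ C :* con 2) := con 2 :* K :+ (K :+ con 4 :* C)) refl K C ⟩
    2 * K + (K + 4 * C)                                  ≤⟨ +-monoʳ-≤ (2 * K) (+-monoˡ-≤ (4 * C) flags≤) ⟩
    2 * K + (E * 4 + 4 * C)                              ≡⟨ cong (2 * K +_) (solve 2 (λ E C → E :* con 4 :+ con 4 :* C := con 2 :* E :+ con 2 :* (con 2 :* C :+ E)) refl E C) ⟩
    2 * K + (2 * E + 2 * (2 * C + E))                    ≡⟨ cong (λ z → 2 * K + (2 * E + 2 * z)) (sym eq) ⟩
    2 * K + (2 * E + 2 * (g + V + F))                    ≡⟨ cong (2 * K +_) (solve 4 (λ E g V F → con 2 :* E :+ con 2 :* (g :+ V :+ F) := con 2 :* V :+ con 2 :* E :+ con 2 :* F :+ con 2 :* g) refl E g V F) ⟩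
    2 * K + (2 * V + 2 * E + 2 * F + 2 * g)              ∎))
    where
    open ≤-Reasoning
    open +-*-Solver

-- Cutting a component open to a polygon

bit : Bool → ℕ
bit true  = 1
bit false = 0

bit≤1 : ∀ b → bit b ≤ 1
bit≤1 true  = ≤-refl
bit≤1 false = z≤n

changes : (ℕ → Bool) → ℕ → ℕ → ℕ
changes b i zero    = 0
changes b i (suc n) = bit (b i xor b (suc i)) + changes b (suc i) n

changes-+ : ∀ b i m n → changes b i (m + n) ≡ changes b i m + changes b (i + m) n
changes-+ b i zero n = cong (λ z → changes b z n) (sym (+-identityʳ i))
changes-+ b i (suc m) n = trans (cong (bit (b i xor b (suc i)) +_) (trans (changes-+ b (suc i) m n) (cong (λ z → changes b (suc i) m + changes b z n) (sym (+-suc i m)))))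
  (sym (+-assoc (bit (b i xor b (suc i))) _ _))

changes-pos : ∀ b i n → b i ≢ b (i + n) → 1 ≤ changes b i n
changes-pos b i zero ne = contradiction (cong b (sym (+-identityʳ i))) ne
changes-pos b i (suc n) ne with b i Data.Bool.≟ b (suc i)
... | yes e = ≤-trans (changes-pos b (suc i) n λ e′ → ne (trans e (trans e′ (cong b (sym (+-suc i n)))))) (m≤n+m _ _)
... | no ne′ = ≤-trans (≤-reflexive (sym (cong bit (differ (b i) (b (suc i)) ne′)))) (m≤m+n _ _)
  where
  differ : ∀ x y → x ≢ y → x xor y ≡ true
  differ true true ne = contradiction refl ne
  differ true false ne = refl
  differ false true ne = refl
  differ false false ne = contradiction refl ne

-- A false value between two true ones, with both ends false, would need four changes.
changes-interval : ∀ b {p q r last} → changes b 0 last ≤ 2 → b 0 ≡ false → b last ≡ false → p ≤ q → q ≤ r → r ≤ last →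
  b p ≡ true → b r ≡ true → b q ≡ true
changes-interval b {p} {q} {r} {last} few b0 bl pq qr rl bp br with b q in bq
... | true  = refl
... | false = contradiction (≤-trans four (≤-reflexive (sym total))) (<⇒≱ (s≤s (≤-trans few (s≤s (s≤s z≤n)))))
  where
  d₁ = q ∸ p
  d₂ = r ∸ q
  d₃ = last ∸ r
  e₁ : p + d₁ ≡ q
  e₁ = m+[n∸m]≡n pq
  e₂ : q + d₂ ≡ r
  e₂ = m+[n∸m]≡n qr
  e₃ : r + d₃ ≡ last
  e₃ = m+[n∸m]≡n rl
  total : changes b 0 last ≡ changes b 0 p + (changes b p d₁ + (changes b q d₂ + changes b r d₃))
  total = trans (cong (changes b 0) (sym (trans (cong (p +_) (trans (cong (d₁ +_) refl) refl)) (trans (sym (+-assoc p d₁ (d₂ + d₃)))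
      (trans (cong (_+ (d₂ + d₃)) e₁) (trans (sym (+-assoc q d₂ d₃)) (trans (cong (_+ d₃) e₂) e₃)))))))
    (trans (changes-+ b 0 p (d₁ + (d₂ + d₃))) (cong (changes b 0 p +_) (trans (changes-+ b p d₁ (d₂ + d₃))
      (cong (changes b p d₁ +_) (trans (cong (λ z → changes b z (d₂ + d₃)) e₁) (trans (changes-+ b q d₂ d₃)
        (cong (changes b q d₂ +_) (cong (λ z → changes b z d₃) e₂))))))))
  neq : ∀ {i j x y} → b i ≡ x → b j ≡ y → x ≢ y → b i ≢ b j
  neq ei ej ne e = ne (trans (sym ei) (trans e ej))
  four : 4 ≤ changes b 0 p + (changes b p d₁ + (changes b q d₂ + changes b r d₃))
  four = +-mono-≤ (changes-pos b 0 p (neq {0} {p} b0 bp λ ()))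
    (+-mono-≤ (changes-pos b p d₁ (neq {p} {p + d₁} bp (trans (cong b e₁) bq) λ ()))
      (+-mono-≤ (changes-pos b q d₂ (neq {q} {q + d₂} bq (trans (cong b e₂) br) λ ()))
        (changes-pos b r d₃ (neq {r} {r + d₃} br (trans (cong b e₃) bl) λ ()))))

-- Side s of a triangle is opposite to corner s; p and q are the corners at its ends.
data Ends : (p q s : Fin 3) → Set where
  p012 : Ends 0F 1F 2F
  p120 : Ends 1F 2F 0F
  p201 : Ends 2F 0F 1F
  p102 : Ends 1F 0F 2F
  p021 : Ends 0F 2F 1F
  p210 : Ends 2F 1F 0F

ends-l : ∀ {p q s} → Ends p q s → Ends p s q
ends-l p012 = p021
ends-l p120 = p102
ends-l p201 = p210
ends-l p102 = p120
ends-l p021 = p012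
ends-l p210 = p201

ends-r : ∀ {p q s} → Ends p q s → Ends s q p
ends-r p012 = p210
ends-r p120 = p021
ends-r p201 = p102
ends-r p102 = p201
ends-r p021 = p120
ends-r p210 = p012

ends-≢ : ∀ {p q s} → Ends p q s → p ≢ s × q ≢ s × p ≢ q
ends-≢ p012 = (λ ()) , (λ ()) , λ ()
ends-≢ p120 = (λ ()) , (λ ()) , λ ()
ends-≢ p201 = (λ ()) , (λ ()) , λ ()
ends-≢ p102 = (λ ()) , (λ ()) , λ ()
ends-≢ p021 = (λ ()) , (λ ()) , λ ()
ends-≢ p210 = (λ ()) , (λ ()) , λ ()

ends-cases : ∀ {p q s} → Ends p q s → ∀ e → e ≡ p ⊎ e ≡ s ⊎ e ≡ q
ends-cases p012 0F = inj₁ refl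
ends-cases p012 1F = inj₂ (inj₂ refl)
ends-cases p012 2F = inj₂ (inj₁ refl)
ends-cases p120 0F = inj₂ (inj₁ refl)
ends-cases p120 1F = inj₁ refl
ends-cases p120 2F = inj₂ (inj₂ refl)
ends-cases p201 0F = inj₂ (inj₂ refl)
ends-cases p201 1F = inj₂ (inj₁ refl)
ends-cases p201 2F = inj₁ refl
ends-cases p102 0F = inj₂ (inj₂ refl)
ends-cases p102 1F = inj₁ refl
ends-cases p102 2F = inj₂ (inj₁ refl)
ends-cases p021 0F = inj₁ refl
ends-cases p021 1F = inj₂ (inj₁ refl)
ends-cases p021 2F = inj₂ (inj₂ refl)
ends-cases p210 0F = inj₂ (inj₁ refl)
ends-cases p210 1F = inj₂ (inj₂ refl)
ends-cases p210 2F = inj₁ refl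

-- The polygon without positions, which recursion on the dual forest can build; `corner` and `toTri`
-- number its corners afterwards.
data Poly (A : Set) : Set where
  side : Poly A
  node : A → Poly A → Poly A → Poly A

module _ {A : Set} where

  sides : Poly A → ℕ
  sides side         = 1
  sides (node w l r) = sides l + sides r

  sides>0 : ∀ P → 0 < sides P
  sides>0 side         = s≤s z≤n
  sides>0 (node w l r) = <-≤-trans (sides>0 l) (m≤m+n _ _)

  corner : Poly A → A → A → ℕ → A
  corner side u v zero    = u
  corner side u v (suc _) = v
  corner (node w l r) u v n with n <? sides l
  ... | yes _ = corner l u w n
  ... | no  _ = corner r w v (n ∸ sides l)

  corner-zero : ∀ P u v → corner P u v 0 ≡ u
  corner-zero side u v = refl
  corner-zero (node w l r) u v with 0 <? sides l
  ... | yes _ = corner-zero l u w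
  ... | no n  = contradiction (sides>0 l) n

  corner-r′ : ∀ w l r u v m → corner (node w l r) u v (sides l + m) ≡ corner r w v m
  corner-r′ w l r u v m with sides l + m <? sides l
  ... | yes lt = contradiction (m≤m+n (sides l) m) (<⇒≱ lt)
  ... | no _   = cong (corner r w v) (m+n∸m≡n (sides l) m)

  corner-end : ∀ P u v → corner P u v (sides P) ≡ v
  corner-end side u v = refl
  corner-end (node w l r) u v = trans (corner-r′ w l r u v (sides r)) (corner-end r w v)

  corner-l′ : ∀ w l r u v n → n ≤ sides l → corner (node w l r) u v n ≡ corner l u w n
  corner-l′ w l r u v n le with n <? sides l
  ... | yes _ = refl
  ... | no nlt with ≤-antisym le (≮⇒≥ nlt)
  ...   | refl = trans (cong (corner r w v) (n∸n≡0 (sides l))) (trans (corner-zero r w v) (sym (corner-end l u w)))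

  toTri : ∀ (P : Poly A) i j → j ≡ i + sides P → Tri i j
  toTri side i j _ = leaf
  toTri (node w l r) i j e = tri (i + sides l) (m<m+n i (sides>0 l))
    (subst (i + sides l <_) (trans (+-assoc i (sides l) (sides r)) (sym e)) (m<m+n (i + sides l) (sides>0 r)))
    (toTri l i _ refl) (toTri r (i + sides l) j (trans e (sym (+-assoc i (sides l) (sides r)))))

  Fits : (ℕ → A) → Poly A → ℕ → A → A → Set
  Fits s P i u v = ∀ n → n ≤ sides P → s (i + n) ≡ corner P u v n

  fits-l : ∀ {s w l r i u v} → Fits s (node w l r) i u v → Fits s l i u w
  fits-l {l = l} {r} h n le = trans (h n (≤-trans le (m≤m+n _ _))) (corner-l′ _ l r _ _ n le)

  fits-r : ∀ {s w l r i u v} → Fits s (node w l r) i u v → Fits s r (i + sides l) w v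
  fits-r {s} {w} {l} {r} {i} {u} {v} h n le = trans (cong s (+-assoc i (sides l) n))
    (trans (h (sides l + n) (+-monoʳ-≤ (sides l) le)) (corner-r′ w l r u v n))

  fits-start : ∀ {s} P {i u v} → Fits s P i u v → s i ≡ u
  fits-start {s} P {i} {u} {v} h = trans (cong s (sym (+-identityʳ i))) (trans (h 0 z≤n) (corner-zero P u v))

  fits-end : ∀ {s} P {i u v} → Fits s P i u v → s (i + sides P) ≡ v
  fits-end P {i} {u} {v} h = trans (h (sides P) ≤-refl) (corner-end P u v)

  variation : (A → Bool) → Poly A → A → A → ℕ
  variation b side u v         = bit (b u xor b v)
  variation b (node w l r) u v = variation b l u w + variation b r w v

  changes≡variation : ∀ {s} b P {i u v} → Fits s P i u v → changes (λ n → b (s n)) i (sides P) ≡ variation b P u v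
  changes≡variation {s} b side {i} {u} {v} h = trans (+-identityʳ _) (cong₂ (λ x y → bit (b x xor b y))
    (fits-start {s = s} side {i} {u} {v} h) (trans (cong s (+-comm 1 i)) (fits-end {s = s} side {i} {u} {v} h)))
  changes≡variation {s} b (node w l r) {i} {u} {v} h = trans (changes-+ _ i (sides l) (sides r))
    (cong₂ _+_ (changes≡variation b l (fits-l {s} {w} {l} {r} {i} {u} {v} h)) (changes≡variation b r (fits-r {s} {w} {l} {r} {i} {u} {v} h)))

bits≤ : ∀ {P Q R D : Set} (p : Dec P) (q : Dec Q) (r : Dec R) (d : Dec D) → (P → D) → (Q → D) → (R → D) →
  ¬ (P × Q) → ¬ (P × R) → ¬ (Q × R) → bit (does p) + (bit (does q) + bit (does r)) ≤ bit (does d)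
bits≤ (yes p) (yes q) _ _ _ _ _ pq _ _ = contradiction (p , q) pq
bits≤ (yes p) (no _) (yes r) _ _ _ _ _ pr _ = contradiction (p , r) pr
bits≤ (yes p) (no _) (no _) (yes _) _ _ _ _ _ _ = ≤-refl
bits≤ (yes p) (no _) (no _) (no ¬d) f _ _ _ _ _ = contradiction (f p) ¬d
bits≤ (no _) (yes q) (yes r) _ _ _ _ _ _ qr = contradiction (q , r) qr
bits≤ (no _) (yes q) (no _) (yes _) _ _ _ _ _ _ = ≤-refl
bits≤ (no _) (yes q) (no _) (no ¬d) _ g _ _ _ _ = contradiction (g q) ¬d
bits≤ (no _) (no _) (yes r) (yes _) _ _ _ _ _ _ = ≤-refl
bits≤ (no _) (no _) (yes r) (no ¬d) _ _ h _ _ _ = contradiction (h r) ¬d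
bits≤ (no _) (no _) (no _) _ _ _ _ _ _ _ = z≤n

-- The boundary walk of a component and its crossings

module Polygons (M : FlagMap) {V E F C : ℕ}
  (NV : NumClasses (Star (Gen2 (t1 M) (t2 M))) V) (NE : NumClasses (Star (Gen2 (t0 M) (t2 M))) E)
  (NF : NumClasses (Star (Gen2 (t0 M) (t1 M))) F) (NC : NumClasses (Star (Gen3 (t0 M) (t1 M) (t2 M))) C) where

  open Surface M NV NE NF NC
  open Count M NV NE NF NC

  o₁ o₂ : Fin 3 → Fin 3
  o₁ 0F = 1F
  o₁ 1F = 0F
  o₁ 2F = 0F
  o₂ 0F = 2F
  o₂ 1F = 2F
  o₂ 2F = 1F

  endOf : Fin q → Fin 2 → Fin V
  endOf i zero    = φ (o₁ (proj₁ (xside i))) (proj₂ (xside i))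
  endOf i (suc _) = φ (o₂ (proj₁ (xside i))) (proj₂ (xside i))

  ZX : Fin V → Set
  ZX v = ∃ λ i → ∃ λ b → Anc v (endOf i b)

  ZX? : ∀ v → Dec (ZX v)
  ZX? v = FinP.any? λ i → FinP.any? λ b → anc? v (endOf i b)

  -- The vertices treated separately: the roots and the tree paths to the ends of the sides
  -- in neither forest.
  ZV : Fin V → Set
  ZV v = ℓ v ≡ 0 ⊎ ZX v

  abstract
    ZV? : ∀ v → Dec (ZV v)
    ZV? v = (ℓ v ℕ.≟ 0) ⊎-dec ZX? v

  Z : Fin V → Bool
  Z v = does (ZV? v)

  Z-false : ∀ {v} → Z v ≡ false → ¬ ZV v
  Z-false {v} e z = contradiction (trans (sym (dec-true (ZV? v) z)) e) λ ()

  Z-closed : ∀ v m → ℓ v ≡ suc m → Z (par v) ≡ false → Z v ≡ false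
  Z-closed v m e zp = dec-false (ZV? v) λ { (inj₁ z) → contradiction (trans (sym e) z) λ ()
    ; (inj₂ (i , b , a)) → Z-false zp (inj₂ (i , b , anc-trans (anc-parent e) a)) }

  X-Z : ∀ {s x j y} → X s x → j ≢ s → Anc y (φ j x) → ZV y
  X-Z {s} {x} {j} {y} h ne a with xside-index s x h
  ... | i , e with pick s j ne
    where
    pick : ∀ s j → j ≢ s → j ≡ o₁ s ⊎ j ≡ o₂ s
    pick 0F 0F ne = contradiction refl ne
    pick 0F 1F ne = inj₁ refl
    pick 0F 2F ne = inj₂ refl
    pick 1F 0F ne = inj₁ refl
    pick 1F 1F ne = contradiction refl ne
    pick 1F 2F ne = inj₂ refl
    pick 2F 0F ne = inj₁ refl
    pick 2F 1F ne = inj₂ refl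
    pick 2F 2F ne = contradiction refl ne
  ...   | inj₁ refl = inj₂ (i , zero , subst (Anc y) (cong (λ z → φ (o₁ (proj₁ z)) (proj₂ z)) (sym e)) a)
  ...   | inj₂ refl = inj₂ (i , 1F , subst (Anc y) (cong (λ z → φ (o₂ (proj₁ z)) (proj₂ z)) (sym e)) a)

  -- The polygon behind side s of flag a, from corner p to corner q of a.
  mutual
    build : ℕ → Fin K → Fin 3 → Fin 3 → Fin 3 → Poly (Fin V)
    build zero    a s p q = side
    build (suc f) a s p q = branch f a s p q (child? s a)

    branch : ℕ → ∀ a s → Fin 3 → Fin 3 → Dec (Child s a) → Poly (Fin V)
    branch f a s p q (no _)  = side
    branch f a s p q (yes _) = node (φ s (τ s a)) (build f (τ s a) q p s) (build f (τ s a) p s q)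

  sidePair-ends : ∀ {p q s} (b : Fin 3 → Bool) → Ends p q s → b p xor b q ≡ sidePair b s
  sidePair-ends b p012 = refl
  sidePair-ends b p120 = refl
  sidePair-ends b p201 = BoolP.xor-comm (b 2F) (b 0F)
  sidePair-ends b p102 = BoolP.xor-comm (b 1F) (b 0F)
  sidePair-ends b p021 = refl
  sidePair-ends b p210 = BoolP.xor-comm (b 2F) (b 1F)

  -- For a flag `z` at a tree segment: `z` lies behind side `s` of `a`, or is `a` itself with `s` as
  -- the segment. As `z` has one place in the dual forest, a triangle is hit through at most one
  -- side.
  Hit : Fin K → Fin 3 → Fin K → Set
  Hit z s a = (Child s a × DF.Anc (τ s a) z) ⊎ (¬ Child s a × s ≡ 2F × a ≡ z)

  abstract
    hit? : ∀ z s a → Dec (Hit z s a)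
    hit? z s a = (child? s a ×-dec DF.anc? (τ s a) z) ⊎-dec (¬? (child? s a) ×-dec ((s Fin.≟ 2F) ×-dec (a Fin.≟ z)))

  hits : Fin K → Fin 3 → Fin K → ℕ
  hits z s a = bit (does (hit? z s a))

  child-anc : ∀ {s a} → Child s a → DF.Anc a (τ s a)
  child-anc {s} {a} ch = subst (λ z → DF.Anc z (τ s a)) (child-pD ch) (DF.anc-parent (child-dd ch))

  hit-anc : ∀ {z s a} → Hit z s a → DF.Anc a z
  hit-anc (inj₁ (ch , h)) = DF.anc-trans (child-anc ch) h
  hit-anc {a = a} (inj₂ (_ , _ , refl)) = DF.anc-refl a

  hit-unique : ∀ {z s s′ a} → Hit z s a → Hit z s′ a → s ≡ s′
  hit-unique {z} {s} {s′} {a} (inj₁ (ch , h)) (inj₁ (ch′ , h′)) = trans (sym (proj₂ ch))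
    (trans (cong sD (DF.anc-unique h h′ (trans (child-dd ch) (sym (child-dd ch′))))) (proj₂ ch′))
  hit-unique (inj₂ (_ , e , _)) (inj₂ (_ , e′ , _)) = trans e (sym e′)
  hit-unique (inj₁ (ch , h)) (inj₂ (_ , _ , refl)) = contradiction (≤-trans (≤-reflexive (sym (child-dd ch))) (DF.anc-lev h)) 1+n≰n
  hit-unique (inj₂ (_ , _ , refl)) (inj₁ (ch , h)) = contradiction (≤-trans (≤-reflexive (sym (child-dd ch))) (DF.anc-lev h)) 1+n≰n

  hits≤ : ∀ z a {s s′ s″} → s ≢ s′ → s ≢ s″ → s′ ≢ s″ → hits z s a + (hits z s′ a + hits z s″ a) ≤ bit (does (DF.anc? a z))
  hits≤ z a {s} {s′} {s″} n₁ n₂ n₃ = bits≤ (hit? z s a) (hit? z s′ a) (hit? z s″ a) (DF.anc? a z) hit-anc hit-anc hit-anc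
    (λ { (h , h′) → n₁ (hit-unique h h′) }) (λ { (h , h′) → n₂ (hit-unique h h′) }) (λ { (h , h′) → n₃ (hit-unique h h′) })

  bound : ℕ
  bound = proj₁ (bounded dd)

  module Crossings (y : Fin V) (y∉ : ¬ ZV y) where

    z₁ z₂ : Fin K
    z₁ = xv y
    z₂ = t2 M (xv y)

    total : Fin 3 → Fin K → ℕ
    total s a = hits z₁ s a + hits z₂ s a

    -- Such a side is leftover or on the tree. All ancestors of the ends of a leftover side are
    -- exceptional, so `y` is none of them; on the tree, by `cross-T`, only the segment from `y` to
    -- its parent counts, seen from `z₁` or `z₂`.
    outside : ∀ {s a p q} → Ends p q s → ¬ Child s a → ¬ ParentSide s a →
      variation (below y) side (φ p a) (φ q a) ≤ total s a
    outside {s} {a} {p} {q} ends ¬ch ¬ps = go (below y (φ p a) xor below y (φ q a)) refl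
      where
      hit : ∀ z → s ≡ 2F → a ≡ z → 1 ≤ hits z s a
      hit z e e′ = ≤-reflexive (sym (cong bit (dec-true (hit? z s a) (inj₂ (¬ch , e , e′)))))
      none : ∀ {j} → X s a → j ≢ s → below y (φ j a) ≡ false
      none {j} x ne = dec-false (anc? y (φ j a)) λ h → y∉ (X-Z x ne h)
      byT : Dec (T s a) → cross y s a ≡ true → 1 ≤ total s a
      byT (no ¬t) c = contradiction (trans (sym c) (trans (sym (sidePair-ends (λ j → below y (φ j a)) ends))
        (cong₂ _xor_ (none (¬t , ¬ps , ¬ch) (proj₁ (ends-≢ ends))) (none (¬t , ¬ps , ¬ch) (proj₁ (proj₂ (ends-≢ ends))))))) λ ()
      byT (yes t) c with cross-T y s a t c
      ... | e , inj₁ e′ = ≤-trans (hit z₁ e e′) (m≤m+n _ _)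
      ... | e , inj₂ e′ = ≤-trans (hit z₂ e e′) (m≤n+m _ _)
      go : ∀ b → below y (φ p a) xor below y (φ q a) ≡ b → bit (below y (φ p a) xor below y (φ q a)) ≤ total s a
      go false e = ≤-trans (≤-reflexive (cong bit e)) z≤n
      go true  e = ≤-trans (≤-reflexive (cong bit e)) (byT (T? s a) (trans (sym (sidePair-ends (λ j → below y (φ j a)) ends)) e))

    mutual
      -- The segment above `y` borders just the flags `z₁` and `z₂`, so the boundary behind a side
      -- enters or leaves the subtree of `y` at most as often as these flags lie behind that side.
      crossings : ∀ f {a s p q} → Ends p q s → ¬ ParentSide s a → bound ≤ dd a + f →
        variation (below y) (build f a s p q) (φ p a) (φ q a) ≤ total s a
      -- Fuel runs out only at the maximal depth `bound`, where a child is impossible.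
      crossings zero {a} {s} ends ¬ps fuel = outside ends (λ ch → contradiction (proj₂ (bounded dd) (τ s a))
        (<⇒≱ (≤-trans (s≤s (≤-trans fuel (≤-reflexive (+-identityʳ (dd a))))) (≤-reflexive (sym (child-dd ch)))))) ¬ps
      crossings (suc f) {a} {s} ends ¬ps fuel = crossings′ f ends ¬ps fuel (child? s a)

      crossings′ : ∀ f {a s p q} → Ends p q s → ¬ ParentSide s a → bound ≤ dd a + suc f → (d : Dec (Child s a)) →
        variation (below y) (branch f a s p q d) (φ p a) (φ q a) ≤ total s a
      crossings′ f ends ¬ps fuel (no ¬ch) = outside ends ¬ch ¬ps
      crossings′ f {a} {s} {p} {q} ends ¬ps fuel (yes ch) = begin
        variation (below y) (build f b q p s) (φ p a) (φ s b) + variation (below y) (build f b p s q) (φ s b) (φ q a)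
          ≡⟨ cong₂ (λ u v → variation (below y) (build f b q p s) u (φ s b) + variation (below y) (build f b p s q) (φ s b) v)
               (sym (φ-τ s p a p≢s)) (sym (φ-τ s q a q≢s)) ⟩
        variation (below y) (build f b q p s) (φ p b) (φ s b) + variation (below y) (build f b p s q) (φ s b) (φ q b)
          ≤⟨ +-mono-≤ (crossings f (ends-l ends) (λ ps → q≢s (trans (sym (proj₂ ps)) (proj₂ ch))) fuel′)
                      (crossings f (ends-r ends) (λ ps → p≢s (trans (sym (proj₂ ps)) (proj₂ ch))) fuel′) ⟩
        (hits z₁ q b + hits z₂ q b) + (hits z₁ p b + hits z₂ p b)
          ≡⟨ solve 4 (λ a b c d → (a :+ b) :+ (c :+ d) := (a :+ c) :+ (b :+ d)) refl (hits z₁ q b) (hits z₂ q b) (hits z₁ p b) (hits z₂ p b) ⟩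
        (hits z₁ q b + hits z₁ p b) + (hits z₂ q b + hits z₂ p b)
          ≤⟨ +-mono-≤ (two z₁) (two z₂) ⟩
        total s a ∎
        where
        open ≤-Reasoning
        open +-*-Solver
        b = τ s a
        p≢s = proj₁ (ends-≢ ends)
        q≢s = proj₁ (proj₂ (ends-≢ ends))
        p≢q = proj₂ (proj₂ (ends-≢ ends))
        fuel′ : bound ≤ dd b + f
        fuel′ = ≤-trans fuel (≤-reflexive (trans (+-suc (dd a) f) (cong (_+ f) (sym (child-dd ch)))))
        two : ∀ z → hits z q b + hits z p b ≤ hits z s a
        two z = ≤-trans (+-monoʳ-≤ (hits z q b) (m≤m+n (hits z p b) (hits z s b))) (≤-trans (hits≤ z b (≢-sym p≢q) q≢s p≢s) sub)
          where
          sub : bit (does (DF.anc? b z)) ≤ hits z s a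
          sub = byD (DF.anc? b z)
            where
            byD : (d : Dec (DF.Anc b z)) → bit (does d) ≤ hits z s a
            byD (no _)  = z≤n
            byD (yes h) = ≤-reflexive (sym (cong bit (dec-true (hit? z s a) (inj₁ (ch , h)))))

  child-towards : ∀ {b z} → DF.Anc b z → b ≢ z → ∃ λ s → Child s b × DF.Anc (τ s b) z
  child-towards {b} {z} h ne = go (dd z) z ≤-refl h ne
    where
    go : ∀ m z → dd z ≤ m → DF.Anc b z → b ≢ z → ∃ λ s → Child s b × DF.Anc (τ s b) z
    step : ∀ m z → dd z ≤ m → (∃ λ l → dd z ≡ suc l × DF.Anc b (pD z)) → ∃ λ s → Child s b × DF.Anc (τ s b) z
    step zero z le (l , e , h) = contradiction (≤-trans (≤-reflexive (sym e)) le) λ ()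
    step (suc m) z le (l , e , h) = byEq (b Fin.≟ pD z)
      where
      byEq : Dec (b ≡ pD z) → ∃ λ s → Child s b × DF.Anc (τ s b) z
      byEq (yes r) = sD z , subst (λ x → dd x ≢ 0 × sD x ≡ sD z) (sym back) ((λ e′ → contradiction (trans (sym e) e′) λ ()) , refl) ,
                     subst (λ x → DF.Anc x z) (sym back) (DF.anc-refl z)
        where
        back : τ (sD z) b ≡ z
        back = trans (cong (τ (sD z)) r) (τ-inv (sD z) z)
      byEq (no ne) = lift (go m (pD z) (≤-trans (≤-reflexive (dd-pD z l e)) (ℕ.s≤s⁻¹ (≤-trans (≤-reflexive (sym e)) le))) h ne)
        where
        lift : (∃ λ s → Child s b × DF.Anc (τ s b) (pD z)) → ∃ λ s → Child s b × DF.Anc (τ s b) z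
        lift (s , ch , h′) = s , ch , DF.anc-step e h′
    go m z le h ne = step m z le (DF.anc-par h ne)

  dual-root : ∀ z → DF.Anc (ϱ (oC z)) z
  dual-root z = go (dd z) z refl
    where
    go : ∀ m z → dd z ≡ m → DF.Anc (ϱ (oC z)) z
    go zero z e with DBFS.depth-zero e
    ... | j , refl = subst (λ i → DF.Anc (ϱ i) (ϱ j)) (sym (oC-ϱ j)) (DF.anc-refl (ϱ j))
    go (suc m) z e = subst (λ i → DF.Anc (ϱ i) z) (oC-τ (sD z) z) (DF.anc-step e (go m (pD z) (dd-pD z m e)))

  Joined : (ℕ → Fin V) → ∀ {i j} → Tri i j → Fin V → Fin V → Set
  Joined s t u v = ∃ λ a → ∃ λ b → s a ≡ u × s b ≡ v × Linked a b t

  module _ (z : Fin K) (e₁ e₂ : Fin 3) (s : ℕ → Fin V) where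
    mutual
      appears : ∀ f {a σ p q i j} → Ends p q σ → Child σ a → DF.Anc (τ σ a) z → bound ≤ dd a + f →
        (eq : j ≡ i + sides (build f a σ p q)) → Fits s (build f a σ p q) i (φ p a) (φ q a) →
        Joined s (toTri (build f a σ p q) i j eq) (φ e₁ z) (φ e₂ z)
      appears zero {a} {σ} ends ch h fuel = contradiction (proj₂ (bounded dd) (τ σ a))
        (<⇒≱ (≤-trans (s≤s (≤-trans fuel (≤-reflexive (+-identityʳ (dd a))))) (≤-reflexive (sym (child-dd ch)))))
      appears (suc f) {a} {σ} ends ch h fuel = appears′ f ends ch h fuel (child? σ a)

      appears′ : ∀ f {a σ p q i j} → Ends p q σ → Child σ a → DF.Anc (τ σ a) z → bound ≤ dd a + suc f → (d : Dec (Child σ a)) →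
        (eq : j ≡ i + sides (branch f a σ p q d)) → Fits s (branch f a σ p q d) i (φ p a) (φ q a) →
        Joined s (toTri (branch f a σ p q d) i j eq) (φ e₁ z) (φ e₂ z)
      appears′ f ends ch h fuel (no ¬ch) = contradiction ch ¬ch
      appears′ f {a} {σ} {p} {q} {i} {j} ends ch h fuel (yes _) eq fits = byEq (b Fin.≟ z)
        where
        b = τ σ a
        p≢σ = proj₁ (ends-≢ ends)
        q≢σ = proj₁ (proj₂ (ends-≢ ends))
        Lₚ = build f b q p σ
        Rₚ = build f b p σ q
        P = node (φ σ b) Lₚ Rₚ
        fitsL : Fits s Lₚ i (φ p b) (φ σ b)
        fitsL = subst (λ u → Fits s Lₚ i u (φ σ b)) (sym (φ-τ σ p a p≢σ)) (fits-l {s = s} {φ σ b} {Lₚ} {Rₚ} {i} {φ p a} {φ q a} fits)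
        fitsR : Fits s Rₚ (i + sides Lₚ) (φ σ b) (φ q b)
        fitsR = subst (Fits s Rₚ (i + sides Lₚ) (φ σ b)) (sym (φ-τ σ q a q≢σ)) (fits-r {s = s} {φ σ b} {Lₚ} {Rₚ} {i} {φ p a} {φ q a} fits)
        fuel′ : bound ≤ dd b + f
        fuel′ = ≤-trans fuel (≤-reflexive (trans (+-suc (dd a) f) (cong (_+ f) (sym (child-dd ch)))))
        eqR : j ≡ (i + sides Lₚ) + sides Rₚ
        eqR = trans eq (sym (+-assoc i (sides Lₚ) (sides Rₚ)))
        vertexAt : ∀ e → e ≡ p ⊎ e ≡ σ ⊎ e ≡ q → ∃ λ x → s x ≡ φ e b × Vertex x i (i + sides Lₚ) j
        vertexAt e (inj₁ r)        = i , trans (fits-start {s = s} Lₚ {i} {φ p b} {φ σ b} fitsL) (cong (λ x → φ x b) (sym r)) , inj₁ refl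
        vertexAt e (inj₂ (inj₁ r)) = i + sides Lₚ , trans (fits-end {s = s} Lₚ {i} {φ p b} {φ σ b} fitsL) (cong (λ x → φ x b) (sym r)) , inj₂ (inj₁ refl)
        vertexAt e (inj₂ (inj₂ r)) = j , trans (cong s eqR) (trans (fits-end {s = s} Rₚ {i + sides Lₚ} {φ σ b} {φ q b} fitsR) (cong (λ x → φ x b) (sym r))) , inj₂ (inj₂ refl)
        triangle : b ≡ z → (∃ λ x → s x ≡ φ e₁ b × Vertex x i (i + sides Lₚ) j) → (∃ λ x → s x ≡ φ e₂ b × Vertex x i (i + sides Lₚ) j) →
          Joined s (toTri P i j eq) (φ e₁ z) (φ e₂ z)
        triangle r (x , ex , vx) (x′ , ex′ , vx′) = x , x′ , trans ex (cong (φ e₁) r) , trans ex′ (cong (φ e₂) r) , inj₁ (vx , vx′)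
        left : Joined s (toTri Lₚ i (i + sides Lₚ) refl) (φ e₁ z) (φ e₂ z) → Joined s (toTri P i j eq) (φ e₁ z) (φ e₂ z)
        left (x , y , ex , ey , l) = x , y , ex , ey , inj₂ (inj₁ l)
        right : Joined s (toTri Rₚ (i + sides Lₚ) j eqR) (φ e₁ z) (φ e₂ z) → Joined s (toTri P i j eq) (φ e₁ z) (φ e₂ z)
        right (x , y , ex , ey , l) = x , y , ex , ey , inj₂ (inj₂ l)
        descend : ∀ σ′ → Child σ′ b → DF.Anc (τ σ′ b) z → σ′ ≡ p ⊎ σ′ ≡ σ ⊎ σ′ ≡ q → Joined s (toTri P i j eq) (φ e₁ z) (φ e₂ z)
        -- Side `σ` of `b` leads back to its parent `a` and not to a child.
        descend σ′ ch′ h′ (inj₂ (inj₁ r)) = contradiction (≤-trans (n≤1+n (suc (dd a))) (≤-reflexive (sym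
          (trans (trans (sym (cong dd (τ-inv σ a))) (child-dd (subst (λ x → Child x b) r ch′))) (cong suc (child-dd ch)))))) 1+n≰n
        descend σ′ ch′ h′ (inj₁ r) = right (appears f {b} {p} {σ} {q} {i + sides Lₚ} {j} (ends-r ends)
          (subst (λ x → Child x b) r ch′) (subst (λ x → DF.Anc (τ x b) z) r h′) fuel′ eqR fitsR)
        descend σ′ ch′ h′ (inj₂ (inj₂ r)) = left (appears f {b} {q} {p} {σ} {i} {i + sides Lₚ} (ends-l ends)
          (subst (λ x → Child x b) r ch′) (subst (λ x → DF.Anc (τ x b) z) r h′) fuel′ refl fitsL)
        byEq : Dec (b ≡ z) → Joined s (toTri P i j eq) (φ e₁ z) (φ e₂ z)
        byEq (yes r) = triangle r (vertexAt e₁ (ends-cases ends e₁)) (vertexAt e₂ (ends-cases ends e₂))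
        byEq (no ne) = towards (child-towards h ne)
          where
          towards : (∃ λ σ′ → Child σ′ b × DF.Anc (τ σ′ b) z) → Joined s (toTri P i j eq) (φ e₁ z) (φ e₂ z)
          towards (σ′ , ch′ , h′) = descend σ′ ch′ h′ (ends-cases ends σ′)

  module Component (j : Fin C) where

    ρ = ϱ j

    dd-ρ : dd ρ ≡ 0
    dd-ρ = n≤0⇒n≡0 (DBFS.depth-≤ {0} (j , refl))

    ℓ-ρ : ℓ (oV ρ) ≡ 0
    ℓ-ρ = n≤0⇒n≡0 (VBFS.depth-≤ {0} (j , refl))

    P₂ P₀ P₁ P : Poly (Fin V)
    P₂ = build bound ρ 2F 0F 1F
    P₀ = build bound ρ 0F 1F 2F
    P₁ = build bound ρ 1F 2F 0F
    -- The closed walk starts and ends at the root vertex `φ 0F ρ`, so its top triangle carries the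
    -- corners 0F, 1F, 0F of the root flag, and corner 2F enters with the next triangle. This is why
    -- `joined` speaks of the corners 0F and 1F only.
    P = node (φ 1F ρ) P₂ (node (φ 2F ρ) P₀ P₁)

    s : ℕ → Fin V
    s = corner P (φ 0F ρ) (φ 0F ρ)

    last : ℕ
    last = sides P

    t : Tri 0 last
    t = toTri P 0 last refl

    fits : Fits s P 0 (φ 0F ρ) (φ 0F ρ)
    fits n le = refl

    -- Each of the two flags at the segment above `y` is hit through at most one of the three sides
    -- of the root flag.
    few-changes : ∀ y → ¬ ZV y → changes (λ n → below y (s n)) 0 last ≤ 2
    few-changes y y∉ = begin
      changes (λ n → below y (s n)) 0 last
        ≡⟨ changes≡variation {s = s} (below y) P {0} {φ 0F ρ} {φ 0F ρ} fits ⟩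
      variation (below y) P₂ (φ 0F ρ) (φ 1F ρ) + (variation (below y) P₀ (φ 1F ρ) (φ 2F ρ) + variation (below y) P₁ (φ 2F ρ) (φ 0F ρ))
        ≤⟨ +-mono-≤ (crossings bound p012 ¬ps fuel) (+-mono-≤ (crossings bound p120 ¬ps fuel) (crossings bound p201 ¬ps fuel)) ⟩
      total 2F ρ + (total 0F ρ + total 1F ρ)
        ≡⟨ solve 6 (λ a b c d e f → (a :+ b) :+ ((c :+ d) :+ (e :+ f)) := (a :+ (c :+ e)) :+ (b :+ (d :+ f))) refl
             (hits z₁ 2F ρ) (hits z₂ 2F ρ) (hits z₁ 0F ρ) (hits z₂ 0F ρ) (hits z₁ 1F ρ) (hits z₂ 1F ρ) ⟩
      (hits z₁ 2F ρ + (hits z₁ 0F ρ + hits z₁ 1F ρ)) + (hits z₂ 2F ρ + (hits z₂ 0F ρ + hits z₂ 1F ρ))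
        ≤⟨ +-mono-≤ (≤-trans (hits≤ z₁ ρ (λ ()) (λ ()) λ ()) (bit≤1 _)) (≤-trans (hits≤ z₂ ρ (λ ()) (λ ()) λ ()) (bit≤1 _)) ⟩
      2 ∎
      where
      open Crossings y y∉
      open ≤-Reasoning
      open +-*-Solver
      ¬ps : ∀ {σ} → ¬ ParentSide σ ρ
      ¬ps (ne , _) = ne dd-ρ
      fuel : bound ≤ dd ρ + bound
      fuel = m≤n+m bound (dd ρ)

    -- The walk starts and ends at the tree root, which is not below a vertex `y` that is not
    -- exceptional, and it changes at most twice between inside and outside the subtree of `y`.
    interval : ∀ {y p q r} → Z y ≡ false → p ≤ q → q ≤ r → r ≤ last → Anc y (s p) → Anc y (s r) → Anc y (s q)
    interval {y} {p} {q} {r} zy pq qr rl ap ar = from (changes-interval (λ n → below y (s n)) (few-changes y (Z-false zy))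
        (root (fits-start {s = s} P {0} {φ 0F ρ} {φ 0F ρ} fits)) (root (fits-end {s = s} P {0} {φ 0F ρ} {φ 0F ρ} fits))
        pq qr rl (dec-true (anc? y (s p)) ap) (dec-true (anc? y (s r)) ar))
      where
      root : ∀ {n} → s n ≡ φ 0F ρ → below y (s n) ≡ false
      root {n} e = dec-false (anc? y (s n)) λ a → Z-false zy (inj₁ (n≤0⇒n≡0 (≤-trans (anc-lev a) (≤-reflexive (trans (cong ℓ e) ℓ-ρ)))))
      from : below y (s q) ≡ true → Anc y (s q)
      from e = byD (anc? y (s q)) e
        where
        byD : (d : Dec (Anc y (s q))) → does d ≡ true → Anc y (s q)
        byD (yes a) _ = a

    open Region par ℓ ℓ-par s last Z interval

    nest : Nesting t
    nest = nesting Z-closed t tt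

    joined : ∀ z → oC z ≡ j → ∀ e₁ e₂ → e₁ ≢ 2F → e₂ ≢ 2F → Joined s t (φ e₁ z) (φ e₂ z)
    joined z refl e₁ e₂ n₁ n₂ = byEq (ρ Fin.≟ z)
      where
      k₁ = sides P₂
      k₂ = k₁ + sides P₀
      Q = node (φ 2F ρ) P₀ P₁
      fits₂ : Fits s P₂ 0 (φ 0F ρ) (φ 1F ρ)
      fits₂ = fits-l {s = s} {φ 1F ρ} {P₂} {Q} {0} {φ 0F ρ} {φ 0F ρ} fits
      fitsQ : Fits s Q k₁ (φ 1F ρ) (φ 0F ρ)
      fitsQ = fits-r {s = s} {φ 1F ρ} {P₂} {Q} {0} {φ 0F ρ} {φ 0F ρ} fits
      fits₀ : Fits s P₀ k₁ (φ 1F ρ) (φ 2F ρ)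
      fits₀ = fits-l {s = s} {φ 2F ρ} {P₀} {P₁} {k₁} {φ 1F ρ} {φ 0F ρ} fitsQ
      fits₁ : Fits s P₁ k₂ (φ 2F ρ) (φ 0F ρ)
      fits₁ = fits-r {s = s} {φ 2F ρ} {P₀} {P₁} {k₁} {φ 1F ρ} {φ 0F ρ} fitsQ
      fuel : bound ≤ dd ρ + bound
      fuel = m≤n+m bound (dd ρ)
      vertexAt : ∀ e → e ≢ 2F → ∃ λ x → s x ≡ φ e ρ × Vertex x 0 k₁ last
      vertexAt 0F _  = 0 , fits-start {s = s} P {0} {φ 0F ρ} {φ 0F ρ} fits , inj₁ refl
      vertexAt 1F _  = k₁ , fits-end {s = s} P₂ {0} {φ 0F ρ} {φ 1F ρ} fits₂ , inj₂ (inj₁ refl)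
      vertexAt 2F ne = contradiction refl ne
      Goal : Set
      Goal = Joined s t (φ e₁ z) (φ e₂ z)
      triangle : ρ ≡ z → (∃ λ x → s x ≡ φ e₁ ρ × Vertex x 0 k₁ last) → (∃ λ x → s x ≡ φ e₂ ρ × Vertex x 0 k₁ last) → Goal
      triangle r (x , ex , vx) (x′ , ex′ , vx′) = x , x′ , trans ex (cong (φ e₁) r) , trans ex′ (cong (φ e₂) r) , inj₁ (vx , vx′)
      descend : (∃ λ σ → Child σ ρ × DF.Anc (τ σ ρ) z) → Goal
      descend (2F , ch , h) = wrap (appears z e₁ e₂ s bound p012 ch h fuel refl fits₂)
        where
        wrap : Joined s (toTri P₂ 0 k₁ refl) (φ e₁ z) (φ e₂ z) → Goal
        wrap (x , y , ex , ey , l) = x , y , ex , ey , inj₂ (inj₁ l)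
      descend (0F , ch , h) = wrap (appears z e₁ e₂ s bound p120 ch h fuel refl fits₀)
        where
        wrap : Joined s (toTri P₀ k₁ k₂ refl) (φ e₁ z) (φ e₂ z) → Goal
        wrap (x , y , ex , ey , l) = x , y , ex , ey , inj₂ (inj₂ (inj₂ (inj₁ l)))
      descend (1F , ch , h) = wrap (appears z e₁ e₂ s bound p201 ch h fuel _ fits₁)
        where
        wrap : Joined s (toTri P₁ k₂ last _) (φ e₁ z) (φ e₂ z) → Goal
        wrap (x , y , ex , ey , l) = x , y , ex , ey , inj₂ (inj₂ (inj₂ (inj₂ l)))
      byEq : Dec (ρ ≡ z) → Goal
      byEq (yes r) = triangle r (vertexAt e₁ n₁) (vertexAt e₂ n₂)
      byEq (no ne) = descend (child-towards (dual-root z) ne)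

  record Cover (j : Fin C) : Set where
    field
      last   : ℕ
      t      : Tri 0 last
      s      : ℕ → Fin V
      f      : ℕ → Word × Fin 3
      cons   : ∀ p q → Corner p t → Corner q t → ¬ ZV (s p) → s p ≡ s q → f p ≡ f q
      inj    : ∀ p q → Corner p t → Corner q t → ¬ ZV (s p) → ¬ ZV (s q) → f p ≡ f q → ℓ (s p) ≡ ℓ (s q) → s p ≡ s q
      compat : ∀ p q → Linked p q t → ¬ ZV (s p) → ¬ ZV (s q) → ∀ {w} → w ⊑ proj₁ (f q) →
               w ⊑ proj₁ (f p) ⊎ ∃ λ x → ∂ w x ≡ just (proj₁ (f p))
      joined : ∀ z → oC z ≡ j → ∀ e₁ e₂ → e₁ ≢ 2F → e₂ ≢ 2F → Joined s t (φ e₁ z) (φ e₂ z)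

  abstract
    cover : ∀ j → Cover j
    cover j = record
      { last = last ; t = t ; s = s ; f = f
      ; cons = λ p q cp cq zp → cons p q cp cq (free zp)
      ; inj = λ p q cp cq zp zq → inj p q cp cq (free zp) (free zq)
      ; compat = λ p q l zp zq → compat p q l (free zp) (free zq)
      ; joined = joined }
      where
      open Component j
      open Region par ℓ ℓ-par s last Z interval using (module Nesting)
      open Nesting nest
      free : ∀ {v} → ¬ ZV v → Z v ≡ false
      free {v} = dec-false (ZV? v)

-- The layout of an embedded graph

module Assembly (G : Graph) (M : FlagMap) {V E F C : ℕ}
  (NV : NumClasses (Star (Gen2 (t1 M) (t2 M))) V) (NE : NumClasses (Star (Gen2 (t0 M) (t2 M))) E)
  (NF : NumClasses (Star (Gen2 (t0 M) (t1 M))) F) (NC : NumClasses (Star (Gen3 (t0 M) (t1 M) (t2 M))) C)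
  (vo : Fin (flagCount M) → Fin (order G))
  (vo-orbit : ∀ x y → (vo x ≡ vo y) ⇔ Star (Gen2 (t1 M) (t2 M)) x y)
  (vo-adj : ∀ u v → adj G u v ≡ true → ∃ λ x → vo x ≡ u × vo (t0 M x) ≡ v) where

  open Surface M NV NE NF NC
  open Count M NV NE NF NC
  open Polygons M NV NE NF NC

  module Comp (j : Fin C) = Cover (cover j)

  Sits : ∀ j → Fin V → ℕ → Set
  Sits j v a = Corner a (Comp.t j) × Comp.s j a ≡ v

  place : Fin C → ℕ → Word × Fin 3
  place j = Comp.f j

  compV : Fin V → Fin C
  compV v = oC (proj₁ (repV v))

  compV-flag : ∀ x → compV (oV x) ≡ oC x
  compV-flag x = oC-V (proj₂ (repV (oV x)))

  abstract
    position : ∀ v → ∃ (Sits (compV v) v)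
    position v with Comp.joined (compV v) (proj₁ (repV v)) refl 0F 0F (λ ()) (λ ())
    ... | a , _ , e , _ , l = a , proj₁ (linked-corner _ l) , trans e (proj₂ (repV v))

  place-cons : ∀ {v j a b} → ¬ ZV v → Sits j v a → Sits j v b → place j a ≡ place j b
  place-cons {j = j} {a} {b} z (ca , refl) (cb , e) = Comp.cons j a b ca cb z (sym e)

  place-inj : ∀ {u v j a b} → ¬ ZV u → ¬ ZV v → Sits j u a → Sits j v b → place j a ≡ place j b → ℓ u ≡ ℓ v → u ≡ v
  place-inj {j = j} {a} {b} zu zv (ca , refl) (cb , refl) = Comp.inj j a b ca cb zu zv

  place-compat : ∀ {u v j a b} → ¬ ZV u → ¬ ZV v → Sits j v a → Sits j u b → Linked a b (Comp.t j) →
    ∀ {w} → w ⊑ proj₁ (place j b) → w ⊑ proj₁ (place j a) ⊎ ∃ λ x → ∂ w x ≡ just (proj₁ (place j a))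
  place-compat {j = j} {a} {b} zu zv (_ , refl) (_ , refl) l = Comp.compat j a b l zv zu

  placeV : Fin V → Word × Fin 3
  placeV v = place (compV v) (proj₁ (position v))

  placeV-at : ∀ {v j a} → ¬ ZV v → compV v ≡ j → Sits j v a → placeV v ≡ place j a
  placeV-at z refl h = place-cons z (proj₂ (position _)) h

  -- Zero for all roots, then one index for each end of each leftover side: at most 4g + 1 in all,
  -- since q ≤ 2g. An index occurs at most once in each layer of a component.
  Exceptional : Set
  Exceptional = Fin (suc (q * 2))

  zone′ : ∀ v → Dec (ℓ v ≡ 0) → Dec (ZX v) → Exceptional ⊎ (Word × Fin 3)
  zone′ v (yes _) _                 = inj₁ zero
  zone′ v (no _)  (yes (i , b , _)) = inj₁ (suc (combine i b))
  zone′ v (no _)  (no _)            = inj₂ (placeV v)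

  zoneV : Fin V → Exceptional ⊎ (Word × Fin 3)
  zoneV v = zone′ v (ℓ v ℕ.≟ 0) (ZX? v)

  zone′-free : ∀ v d d′ {w} → zone′ v d d′ ≡ inj₂ w → ¬ ZV v × placeV v ≡ w
  zone′-free v (no nr) (no nx) e = (λ { (inj₁ r) → nr r ; (inj₂ x) → nx x }) , SumP.inj₂-injective e

  zone′-inj : ∀ u v d₁ d₂ d₃ d₄ → compV u ≡ compV v → ℓ u ≡ ℓ v → zone′ u d₁ d₂ ≡ zone′ v d₃ d₄ → u ≡ v
  zone′-inj u v (yes r) _ (yes r′) _ c l e with VBFS.depth-zero r | VBFS.depth-zero r′
  ... | j , refl | j′ , refl = cong (λ i → oV (ϱ i)) (trans (sym (trans (compV-flag (ϱ j)) (oC-ϱ j))) (trans c (trans (compV-flag (ϱ j′)) (oC-ϱ j′))))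
  zone′-inj u v (no _) (yes (i , b , a)) (no _) (yes (i′ , b′ , a′)) c l e
    with FinP.combine-injective i b i′ b′ (FinP.suc-injective (SumP.inj₁-injective e))
  ... | refl , refl = anc-unique a a′ l
  zone′-inj u v d₁@(no _) d₂@(no _) d₃@(no _) d₄@(no _) c l e = go (zone′-free u d₁ d₂ e) (zone′-free v d₃ d₄ refl)
    where
    move : ∀ {j} → compV v ≡ j → ∃ λ b → Sits j v b × place j b ≡ placeV v
    move refl = proj₁ (position v) , proj₂ (position v) , refl
    go : ¬ ZV u × placeV u ≡ placeV v → ¬ ZV v × placeV v ≡ placeV v → u ≡ v
    go (zu , eu) (zv , _) with move (sym c)
    ... | b , at , eb = place-inj zu zv (proj₂ (position u)) at (trans eu (sym eb)) l
  zone′-inj u v (yes _) _ (no _) (yes _) c l e = contradiction (SumP.inj₁-injective e) λ ()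
  zone′-inj u v (no _) (yes _) (yes _) _ c l e = contradiction (SumP.inj₁-injective e) λ ()
  zone′-inj u v (yes _) _ (no _) (no _) c l ()
  zone′-inj u v (no _) (no _) (yes _) _ c l ()
  zone′-inj u v (no _) (yes _) (no _) (no _) c l ()
  zone′-inj u v (no _) (no _) (no _) (yes _) c l ()

  zoneV-inj : ∀ {u v} → compV u ≡ compV v → ℓ u ≡ ℓ v → zoneV u ≡ zoneV v → u ≡ v
  zoneV-inj {u} {v} = zone′-inj u v (ℓ u ℕ.≟ 0) (ZX? u) (ℓ v ℕ.≟ 0) (ZX? v)

  zoneV-free : ∀ {v w} → zoneV v ≡ inj₂ w → ¬ ZV v × placeV v ≡ w
  zoneV-free {v} = zone′-free v (ℓ v ℕ.≟ 0) (ZX? v)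

  -- The ends of an edge are two corners of one of its flags, as the edge is represented by one of them.
  edge-joined : ∀ x → ∃ λ a → ∃ λ b → Sits (oC x) (oV (t0 M x)) a × Sits (oC x) (oV x) b × Linked a b (Comp.t (oC x))
  edge-joined x = go (proj₁ (φ1-end x))
    where
    build-at : ∀ {j u v} → Joined (Comp.s j) (Comp.t j) u v → ∃ λ a → ∃ λ b → Sits j u a × Sits j v b × Linked a b (Comp.t j)
    build-at {j} (a , b , ea , eb , l) = a , b , (proj₁ (linked-corner _ l) , ea) , (proj₂ (linked-corner _ l) , eb) , l
    go : φ 1F x ≡ oV x ⊎ φ 1F x ≡ oV (t0 M x) → ∃ λ a → ∃ λ b → Sits (oC x) (oV (t0 M x)) a × Sits (oC x) (oV x) b × Linked a b (Comp.t (oC x))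
    go (inj₂ e) = build-at (subst (λ u → Joined (Comp.s (oC x)) (Comp.t (oC x)) u (oV x)) e
      (Comp.joined (oC x) x refl 1F 0F (λ ()) (λ ())))
    go (inj₁ e) = build-at (subst (Joined (Comp.s (oC x)) (Comp.t (oC x)) (oV (t0 M x))) (trans (φ-τ 0F 1F x λ ()) e)
      (Comp.joined (oC x) (t0 M x) (oC-τ 0F x) 0F 1F (λ ()) (λ ())))

  nestedV : ∀ x {wu wv lu lv} → zoneV (oV x) ≡ inj₂ (wu , lu) → zoneV (oV (t0 M x)) ≡ inj₂ (wv , lv) →
    ∀ {w} → w ⊑ wu → w ⊑ wv ⊎ ∃ λ i → ∂ w i ≡ just wv
  nestedV x eu ev {w} h = go (zoneV-free eu) (zoneV-free ev) (edge-joined x) h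
    where
    go : ∀ {wu wv lu lv} → ¬ ZV (oV x) × placeV (oV x) ≡ (wu , lu) → ¬ ZV (oV (t0 M x)) × placeV (oV (t0 M x)) ≡ (wv , lv) →
      (∃ λ a → ∃ λ b → Sits (oC x) (oV (t0 M x)) a × Sits (oC x) (oV x) b × Linked a b (Comp.t (oC x))) → w ⊑ wu → w ⊑ wv ⊎ ∃ λ i → ∂ w i ≡ just wv
    go (zu , pu) (zv , pv) (a , b , ata , atb , l) h = subst (λ z → w ⊑ z ⊎ ∃ λ i → ∂ w i ≡ just z) (cong proj₁ (trans (sym qv) pv))
        (place-compat zu zv ata atb l (subst (w ⊑_) (cong proj₁ (trans (sym pu) qu)) h))
      where
      qu : placeV (oV x) ≡ place (oC x) b
      qu = placeV-at zu (compV-flag x) atb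
      qv : placeV (oV (t0 M x)) ≡ place (oC x) a
      qv = placeV-at zv (trans (compV-flag (t0 M x)) (oC-τ 0F x)) ata

  vo⇒oV : ∀ {x y} → vo x ≡ vo y → oV x ≡ oV y
  vo⇒oV {x} {y} e = Equivalence.from (proj₂ (proj₂ NV) x y) (Equivalence.to (vo-orbit x y) e)

  oV⇒vo : ∀ {x y} → oV x ≡ oV y → vo x ≡ vo y
  oV⇒vo {x} {y} e = Equivalence.from (vo-orbit x y) (Equivalence.to (proj₂ (proj₂ NV) x y) e)

  Covered : Fin (order G) → Set
  Covered u = ∃ λ x → vo x ≡ u

  covered? : ∀ u → Dec (Covered u)
  covered? u = FinP.any? λ x → vo x Fin.≟ u

  layer′ : ∀ u → Dec (Covered u) → ℕ
  layer′ u (yes (x , _)) = ℓ (oV x)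
  layer′ u (no _)        = 0

  comp′ : ∀ u → Dec (Covered u) → ℕ
  comp′ u (yes (x , _)) = toℕ (compV (oV x))
  -- A vertex without flags is a component of its own, numbered past those of the map, so its
  -- default layer and zone clash with nothing.
  comp′ u (no _)        = C + toℕ u

  zoneG′ : ∀ u → Dec (Covered u) → Exceptional ⊎ (Word × Fin 3)
  zoneG′ u (yes (x , _)) = zoneV (oV x)
  zoneG′ u (no _)        = inj₂ (ε , zero)

  layer-at : ∀ x d → layer′ (vo x) d ≡ ℓ (oV x)
  layer-at x (yes (y , e)) = cong ℓ (vo⇒oV e)
  layer-at x (no ¬c)       = contradiction (x , refl) ¬c

  comp-at : ∀ x d → comp′ (vo x) d ≡ toℕ (compV (oV x))
  comp-at x (yes (y , e)) = cong (λ v → toℕ (compV v)) (vo⇒oV e)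
  comp-at x (no ¬c)       = contradiction (x , refl) ¬c

  zone-at : ∀ x d → zoneG′ (vo x) d ≡ zoneV (oV x)
  zone-at x (yes (y , e)) = cong zoneV (vo⇒oV e)
  zone-at x (no ¬c)       = contradiction (x , refl) ¬c

  zoneG-inj : ∀ u v d d′ → comp′ u d ≡ comp′ v d′ → layer′ u d ≡ layer′ v d′ → zoneG′ u d ≡ zoneG′ v d′ → u ≡ v
  zoneG-inj u v (yes (x , ex)) (yes (y , ey)) c l z = trans (sym ex) (trans (oV⇒vo (zoneV-inj (FinP.toℕ-injective c) l z)) ey)
  zoneG-inj u v (yes (x , _)) (no _) c l z = contradiction (≤-trans (m≤m+n C (toℕ v)) (≤-reflexive (sym c))) (<⇒≱ (FinP.toℕ<n (compV (oV x))))
  zoneG-inj u v (no _) (yes (y , _)) c l z = contradiction (≤-trans (m≤m+n C (toℕ u)) (≤-reflexive c)) (<⇒≱ (FinP.toℕ<n (compV (oV y))))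
  zoneG-inj u v (no _) (no _) c l z = FinP.toℕ-injective (+-cancelˡ-≡ C _ _ c)

  layout : Layout G (suc (q * 2))
  layout = record
    { layer     = λ u → layer′ u (covered? u)
    ; layer-adj = λ {u} {v} a → layer-adj (vo-adj u v a)
    ; comp      = λ u → comp′ u (covered? u)
    ; comp-adj  = λ {u} {v} a → comp-adj (vo-adj u v a)
    ; zone      = λ u → zoneG′ u (covered? u)
    ; zone-inj  = λ {u} {v} → zoneG-inj u v (covered? u) (covered? v)
    ; nested    = λ {u} {v} a → nested (vo-adj u v a) }
    where
    layer-adj : ∀ {u v} → (∃ λ x → vo x ≡ u × vo (t0 M x) ≡ v) → layer′ v (covered? v) ≤ suc (layer′ u (covered? u))
    layer-adj (x , refl , refl) = subst₂ (λ a b → a ≤ suc b) (sym (layer-at (t0 M x) (covered? _))) (sym (layer-at x (covered? _))) (ℓ-step x)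
    comp-adj : ∀ {u v} → (∃ λ x → vo x ≡ u × vo (t0 M x) ≡ v) → comp′ u (covered? u) ≡ comp′ v (covered? v)
    comp-adj (x , refl , refl) = trans (comp-at x (covered? _)) (trans (cong toℕ (trans (compV-flag x)
      (trans (sym (oC-τ 0F x)) (sym (compV-flag (t0 M x)))))) (sym (comp-at (t0 M x) (covered? _))))
    nested : ∀ {u v wu wv lu lv} → (∃ λ x → vo x ≡ u × vo (t0 M x) ≡ v) → zoneG′ u (covered? u) ≡ inj₂ (wu , lu) →
      zoneG′ v (covered? v) ≡ inj₂ (wv , lv) → ∀ {w} → w ⊑ wu → w ⊑ wv ⊎ ∃ λ i → ∂ w i ≡ just wv
    nested (x , refl , refl) eu ev = nestedV x (trans (sym (zone-at x (covered? _))) eu) (trans (sym (zone-at (t0 M x) (covered? _))) ev)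

-- The numerical bound and the theorem

p<2^[1+log] : ∀ p → p < 2 ^ suc ⌊log₂ p ⌋
p<2^[1+log] p = ≰⇒> λ le → contradiction
  (≤-trans (≤-reflexive (sym (⌊log₂[2^n]⌋≡n (suc ⌊log₂ p ⌋)))) (⌊log₂⌋-mono-≤ le)) 1+n≰n

-- Estimating p+1 by 2p, lg+3 by 4 lg and 2p+1 by 3p lg gives 8gp + 2p + 132 p^3 lg, with 132 = 12
-- (8 + 3); the term 2p is absorbed by 2 p^3 lg, whence 134.
colours-bound : ∀ g p lg q → 2 ≤ p → 1 ≤ lg → q ≤ 2 * g → colours (suc (q * 2)) p (suc lg) ≤ 134 * (g * p + p ^ 3 * lg)
colours-bound g p lg q 2≤p 1≤lg q≤ = begin
  suc p * (suc (q * 2) + 3 * (suc p * (suc p * (2 + suc lg) + suc (p + p))))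
    ≤⟨ *-mono-≤ p1 (+-mono-≤ (s≤s (*-monoˡ-≤ 2 q≤)) (*-monoʳ-≤ 3 (*-mono-≤ p1 (+-mono-≤ (*-mono-≤ p1 lg3) p3)))) ⟩
  (2 * p) * (suc (2 * g * 2) + 3 * ((2 * p) * ((2 * p) * (4 * lg) + 3 * p * lg)))
    ≡⟨ solve 3 (λ g p lg → (con 2 :* p) :* ((con 1 :+ con 2 :* g :* con 2) :+ con 3 :* ((con 2 :* p) :* ((con 2 :* p) :* (con 4 :* lg) :+ con 3 :* p :* lg)))
         := con 8 :* (g :* p) :+ con 2 :* (p :* con 1) :+ con 132 :* (p :^ 3 :* lg)) refl g p lg ⟩
  8 * (g * p) + 2 * (p * 1) + 132 * (p ^ 3 * lg)
    ≤⟨ +-monoˡ-≤ (132 * (p ^ 3 * lg)) (+-mono-≤ (*-monoˡ-≤ (g * p) {8} {134} (m≤m+n 8 126)) (*-monoʳ-≤ 2 (*-mono-≤ cube 1≤lg))) ⟩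
  134 * (g * p) + 2 * (p ^ 3 * lg) + 132 * (p ^ 3 * lg)
    ≡⟨ solve 2 (λ a b → con 134 :* a :+ con 2 :* b :+ con 132 :* b := con 134 :* (a :+ b)) refl (g * p) (p ^ 3 * lg) ⟩
  134 * (g * p + p ^ 3 * lg) ∎
  where
  open ≤-Reasoning
  open +-*-Solver
  1≤p : 1 ≤ p
  1≤p = ≤-trans (s≤s z≤n) 2≤p
  p1 : suc p ≤ 2 * p
  p1 = +-mono-≤ 1≤p (≤-reflexive (sym (+-identityʳ p)))
  lg3 : 2 + suc lg ≤ 4 * lg
  lg3 = ≤-trans (≤-reflexive (+-comm 3 lg)) (+-monoʳ-≤ lg (*-monoʳ-≤ 3 1≤lg))
  p3 : suc (p + p) ≤ 3 * p * lg
  p3 = ≤-trans (≤-trans (+-monoˡ-≤ (p + p) 1≤p) (≤-reflexive (cong (λ z → p + (p + z)) (sym (+-identityʳ p)))))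
    (≤-trans (≤-reflexive (sym (*-identityʳ (3 * p)))) (*-monoʳ-≤ (3 * p) 1≤lg))
  cube : p ≤ p ^ 3
  cube = ≤-trans (≤-reflexive (sym (*-identityʳ p))) (*-monoʳ-≤ p (*-mono-≤ 1≤p (*-mono-≤ 1≤p ≤-refl)))

theorem2 : Σ ℕ λ C → 0 < C × (∀ (g p : ℕ) (G : Graph) → 2 ≤ p → EulerGenus G g →
    χ≤ G p (C * (g * p + p ^ 3 * ⌊log₂ p ⌋)))
theorem2 = 134 , s≤s z≤n , λ g p G 2≤p genus → colouring g p G 2≤p (proj₁ genus)
  where
  colouring : ∀ g p G → 2 ≤ p → EmbedsWithEulerGenus G g → χ≤ G p (134 * (g * p + p ^ 3 * ⌊log₂ p ⌋))
  colouring g p G 2≤p (M , vo , vo-orbit , _ , vo-adj , _ , V , E , F , C , NV , NE , NF , NC , euler) = φ , centered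
    where
    open Assembly G M NV NE NF NC vo vo-orbit vo-adj
    open Colouring layout p (suc ⌊log₂ p ⌋) (p<2^[1+log] p)
      (colours-bound g p ⌊log₂ p ⌋ _ 2≤p (⌊log₂⌋-mono-≤ 2≤p) (Count.q≤ M NV NE NF NC g euler))
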